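{- There exist an absolute constant $C>0$ and a randomized online edge-coloring algorithm with the following guarantee. For all integers $n\ge 2$ and $\Delta\ge 1$, and for every $n$-vertex graph $G$ of maximum degree $\Delta$ together with an arrival order of its edges, both fixed in advance (oblivious adversary), the algorithm (given $n$ and $\Delta$ in advance) outputs a proper edge coloring of $G$ which, with high probability in $n$ (i.e., with probability at least $1-1/n^{c}$ for some absolute constant $c>0$), uses at most $$\Delta + C\,\Delta^{15/16}(\ln n)^{1/32}$$ distinct colors.
   Context: Online edge coloring: an unknown graph $G=(V,E)$ with $|V|=n$ and maximum degree $\Delta$ is given to the algorithm via $V$ and $\Delta$ in advance; edges are revealed one at a time, and upon arrival each edge must be immediately and irrevocably assigned a color so that edges sharing an endpoint receive distinct colors. An oblivious adversary fixes the graph and the arrival order in advance, independently of the algorithm's random choices; the probability is over the algorithm's internal randomness. -}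

module Defs where

open import Data.Nat as ℕ using (ℕ; zero; suc; _≤_; _^_; _*_; _∸_; _!)
open import Data.Nat.Properties using (_!≢0)
open import Data.Integer as ℤ using (+_)
open import Data.Rational as ℚ using (ℚ; 0ℚ)
open import Data.Fin using (Fin)
import Data.Fin.Properties as FinP
open import Data.List using (List; []; _∷_; _++_; [_]; length; filter; map; deduplicate)
open import Data.List.Relation.Unary.All using (All)
open import Data.List.Relation.Unary.AllPairs using (AllPairs)
open import Data.Product using (_×_; _,_; proj₁; proj₂; ∃)
open import Data.Sum using (_⊎_)
open import Relation.Binary.PropositionalEquality using (_≡_; _≢_)
open import Relation.Nullary using (¬_)
open import Relation.Nullary.Decidable using (_⊎-dec_)
open import Relation.Unary using (Decidable)

-- Graphs on vertex set Fin n, given as the list of edges in arrival order.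

Edge : ℕ → Set
Edge n = Fin n × Fin n

Incident : ∀ {n} → Fin n → Edge n → Set
Incident v e = v ≡ proj₁ e ⊎ v ≡ proj₂ e

incident? : ∀ {n} (v : Fin n) → Decidable (Incident v)
incident? v e = (v FinP.≟ proj₁ e) ⊎-dec (v FinP.≟ proj₂ e)

SameEdge : ∀ {n} → Edge n → Edge n → Set
SameEdge e e' = (proj₁ e ≡ proj₁ e' × proj₂ e ≡ proj₂ e')
              ⊎ (proj₁ e ≡ proj₂ e' × proj₂ e ≡ proj₁ e')

Simple : ∀ {n} → List (Edge n) → Set
Simple es = All (λ e → proj₁ e ≢ proj₂ e) es
          × AllPairs (λ e e' → ¬ SameEdge e e') es

deg : ∀ {n} → Fin n → List (Edge n) → ℕ
deg v es = length (filter (incident? v) es)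

MaxDegree : ∀ {n} → List (Edge n) → ℕ → Set
MaxDegree {n} es Δ = (∀ (v : Fin n) → deg v es ≤ Δ) × ∃ λ (v : Fin n) → deg v es ≡ Δ

ShareEndpoint : ∀ {n} → Edge n → Edge n → Set
ShareEndpoint e e' = Incident (proj₁ e) e' ⊎ Incident (proj₂ e) e'

-- Randomized online edge-coloring algorithms.
-- Given n and Δ, the algorithm draws a seed uniformly from
-- Fin (suc (seeds n Δ)); the color of an arriving edge is a function
-- of n, Δ, the seed, the previously arrived edges and the current edge
-- (the earlier colors are determined by these).  Colors are naturals.

record OnlineAlg : Set where
  field
    seeds : ℕ → ℕ → ℕ
    color : (n Δ : ℕ) → Fin (suc (seeds n Δ)) → List (Edge n) → Edge n → ℕ

open OnlineAlg public

runFrom : ∀ {n} → (List (Edge n) → Edge n → ℕ) → List (Edge n) → List (Edge n)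
        → List (Edge n × ℕ)
runFrom f hist [] = []
runFrom f hist (e ∷ es) = (e , f hist e) ∷ runFrom f (hist ++ [ e ]) es

run : (A : OnlineAlg) (n Δ : ℕ) → Fin (suc (seeds A n Δ)) → List (Edge n)
    → List (Edge n × ℕ)
run A n Δ s es = runFrom (color A n Δ s) [] es

Proper : ∀ {n} → List (Edge n × ℕ) → Set
Proper cs = AllPairs (λ p q → ShareEndpoint (proj₁ p) (proj₁ q) → proj₂ p ≢ proj₂ q) cs

numColors : ∀ {n} → List (Edge n × ℕ) → ℕ
numColors cs = length (deduplicate ℕ._≟_ (map proj₂ cs))

-- Exponential comparison without reals:
-- expPartial a N = Σ_{j<N} a^j / j!, and  e^a ≤ m  iff all partial sums ≤ m.

expPartial : ℕ → ℕ → ℚ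
expPartial a zero = 0ℚ
expPartial a (suc N) = expPartial a N ℚ.+ ((+ (a ^ N)) ℚ./ (N !)) {{N !≢0}}

ExpLe : ℕ → ℕ → Set
ExpLe a m = ∀ (N : ℕ) → expPartial a N ℚ.≤ (+ m) ℚ./ 1

-- k ≤ Δ + C·Δ^{15/16}·(ln n)^{1/32}
-- ⇔ (k ∸ Δ)^32 ≤ C^32·Δ^30·ln n  ⇔  e^{(k ∸ Δ)^32} ≤ n^{C^32·Δ^30}
ColorBound : ℕ → ℕ → ℕ → ℕ → Set
ColorBound C n Δ k = ExpLe ((k ∸ Δ) ^ 32) (n ^ (C ^ 32 * Δ ^ 30))

-- Every vertex v keeps, for each of D = Δ + O(Δ / g) colours c, a weight x_v(c), initially 1.
-- An edge uv is given colour c with probability y_u(c) y_v(c) / N, where y is x rounded down to a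
-- grid (and 0 once c is used at the vertex or discarded there) and N makes the probabilities add
-- up to 1.  At both ends the chosen colour then loses its weight and the others gain just enough
-- to make all weights martingales.  If N is too small, the edge is coloured greedily outside the
-- D colours.
--
-- For fixed v, consider sums of x_z(c) over sets of pairs of a neighbour z (at the arrival of vz)
-- and a colour c.  Their increments are bounded and only O(Δ²) steps matter, so a deviation by
-- Δ² / poly(g) has probability exp(- Δ² / poly(g)).  This beats a union bound over n vertices and
-- the 2^O(Δ log Δ) sets given by a set of rows and one interval of rows per colour as soon as
-- Δ² ≥ poly(g) log n, which is why √(log n) is the right threshold for Δ.
--
-- When none of these sums deviates, the colouring at v is under control whatever colours v itself
-- has received: with λ_v the sum of 1 / N over the coloured edges at v, few colours are discarded
-- for having met too much weight, x_v(c) ≈ 1 / (1 - λ_v) for almost all free colours c, and hence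
-- N ≈ |free colours| / (1 - λ_v) for all but few edges.  The latter makes 1 - λ_v follow the
-- fraction of free colours, so N ≈ D, and only O(Δ / g²) edges at v are left to the greedy rule.
--
-- Finally g is the largest integer with K g³² log n ≤ Δ²; for g = 0 the greedy rule suffices.

module Submission where

open import Defs
open import Data.Nat
open import Data.Empty using (⊥)
open import Data.Fin using (Fin; toℕ)
import Data.Fin.Properties as FinP
open import Data.Integer as ℤ using () renaming (+_ to int)
import Data.Integer.Properties as ℤP
open import Data.List
  using (List; []; _∷_; [_]; _++_; length; map; filter; foldl; tabulate; allFin; upTo; deduplicate;
         cartesianProduct; cartesianProductWith)
open import Data.List.Membership.DecPropositional _≟_ using (_∈?_)
open import Data.List.Membership.Propositional using (_∈_; _∉_)
open import Data.List.Membership.Propositional.Properties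
  using (∈-allFin; ∈-cartesianProduct⁺; ∈-cartesianProductWith⁺; ∈-filter⁺; ∈-map⁺; ∈-upTo⁺)
open import Data.List.Properties
  using (filter-accept; filter-notAll; filter-reject; foldl-++; length-++; length-map; length-tabulate; length-upTo)
open import Data.List.Relation.Unary.All as All using (All; []; _∷_)
open import Data.List.Relation.Unary.All.Properties using (all-filter; deduplicate⁺; map⁺)
open import Data.List.Relation.Unary.AllPairs using (AllPairs; []; _∷_)
open import Data.List.Relation.Unary.Any as Any using (Any; any?; here; there)
open import Data.List.Relation.Unary.Unique.DecPropositional.Properties _≟_ using (deduplicate-!)
open import Data.List.Relation.Unary.Unique.Propositional using (Unique)
open import Data.List.Relation.Unary.Unique.Propositional.Properties using (allFin⁺; filter⁺)
open import Data.Nat.DivMod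
open import Data.Nat.Divisibility using (_∣_; m∣m*n; m≤n⇒m!∣n!; ∣-trans)
open import Data.Nat.Properties
open import Data.Nat.Tactic.RingSolver using (solve-∀)
open import Data.Product using (Σ; _×_; _,_; proj₁; proj₂; ∃)
import Data.Rational as ℚ
import Data.Rational.Properties as ℚP
import Data.Rational.Unnormalised as ℚᵘ
import Data.Rational.Unnormalised.Properties as ℚᵘP
open import Data.Sum using (_⊎_; inj₁; inj₂)
open import Function using (_∘_)
open import Relation.Binary.PropositionalEquality hiding (J; [_])
open import Relation.Nullary using (¬_; Dec; yes; no; contradiction)
open import Relation.Nullary.Decidable using (_×-dec_; _⊎-dec_; ¬?)

-- Finite sums

-- Everything is arithmetic in ℕ. `M` is a factorial, so each probability y y / N is a multiple of 1
-- / `M`; a seed is a numeral in base `M`, one digit per edge, and expectations are exact sums over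
-- seeds. The obstacle is adaptivity: the colours still free at v depend on the same random choices
-- as the weights of the neighbours. The analysis of v therefore uses randomness only through tests
-- fixed beforehand. Intervals of rows suffice because y_v(c) never decreases while c is active and
-- then is 0 for good, so each of its level sets is an interval. The tail bound avoids the
-- exponential function: a product of factors linear in the martingale increments has an exactly
-- known mean, and 1 + k h ≥ (1 + h)^(k - 1) compares it with a power. Each relevant step loses
-- about two units; scaling the increments by q of order G⁶ makes this harmless. The exponent 32
-- arises as 28 + 4: with t of order Δ / g², a deviation of t² / poly(g) beats the number of tests
-- once t² ≥ g²⁸ log n up to constants, and Δ² is of order g⁴ t².

∑ : ℕ → (ℕ → ℕ) → ℕ
∑ zero f = 0
∑ (suc n) f = ∑ n f + f n

⟦_⟧ : ∀ {a} {A : Set a} → Dec A → ℕ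
⟦ yes _ ⟧ = 1
⟦ no _ ⟧ = 0

⟦⟧-yes : ∀ {a} {A : Set a} (d : Dec A) → A → ⟦ d ⟧ ≡ 1
⟦⟧-yes (yes _) _ = refl
⟦⟧-yes (no ¬p) p = contradiction p ¬p

⟦⟧-no : ∀ {a} {A : Set a} (d : Dec A) → ¬ A → ⟦ d ⟧ ≡ 0
⟦⟧-no (yes p) ¬p = contradiction p ¬p
⟦⟧-no (no _) _ = refl

⟦⟧≤1 : ∀ {a} {A : Set a} (d : Dec A) → ⟦ d ⟧ ≤ 1
⟦⟧≤1 (yes _) = ≤-refl
⟦⟧≤1 (no _) = z≤n

⟦⟧-⇒ : ∀ {a b} {A : Set a} {B : Set b} (d : Dec A) (e : Dec B) → (A → B) → ⟦ d ⟧ ≤ ⟦ e ⟧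
⟦⟧-⇒ (no _) e f = z≤n
⟦⟧-⇒ (yes p) e f = ≤-reflexive (sym (⟦⟧-yes e (f p)))

≤-by : ∀ {a b} s → a + s ≡ b → a ≤ b
≤-by {a} s eq = subst (a ≤_) eq (m≤m+n a s)

∑-cong : ∀ n {f g : ℕ → ℕ} → (∀ i → i < n → f i ≡ g i) → ∑ n f ≡ ∑ n g
∑-cong zero h = refl
∑-cong (suc n) h = cong₂ _+_ (∑-cong n (λ i lt → h i (m<n⇒m<1+n lt))) (h n (n<1+n n))

∑-mono : ∀ n {f g : ℕ → ℕ} → (∀ i → i < n → f i ≤ g i) → ∑ n f ≤ ∑ n g
∑-mono zero h = z≤n
∑-mono (suc n) h = +-mono-≤ (∑-mono n (λ i lt → h i (m<n⇒m<1+n lt))) (h n (n<1+n n))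

∑-+ : ∀ n (f g : ℕ → ℕ) → ∑ n (λ i → f i + g i) ≡ ∑ n f + ∑ n g
∑-+ zero f g = refl
∑-+ (suc n) f g = trans (cong (_+ (f n + g n)) (∑-+ n f g)) (lemma (∑ n f) (∑ n g) (f n) (g n))
  where
  lemma : ∀ a b c d → a + b + (c + d) ≡ a + c + (b + d)
  lemma = solve-∀

∑-*ˡ : ∀ n k (f : ℕ → ℕ) → ∑ n (λ i → k * f i) ≡ k * ∑ n f
∑-*ˡ zero k f = sym (*-zeroʳ k)
∑-*ˡ (suc n) k f = trans (cong (_+ k * f n) (∑-*ˡ n k f)) (sym (*-distribˡ-+ k (∑ n f) (f n)))

∑-*ʳ : ∀ n k (f : ℕ → ℕ) → ∑ n (λ i → f i * k) ≡ ∑ n f * k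
∑-*ʳ n k f = trans (∑-cong n (λ i _ → *-comm (f i) k)) (trans (∑-*ˡ n k f) (*-comm k (∑ n f)))

∑-const : ∀ n k → ∑ n (λ _ → k) ≡ n * k
∑-const zero k = refl
∑-const (suc n) k = trans (cong (_+ k) (∑-const n k)) (+-comm (n * k) k)

∑-zero : ∀ n {f : ℕ → ℕ} → (∀ i → i < n → f i ≡ 0) → ∑ n f ≡ 0
∑-zero n h = trans (∑-cong n h) (trans (∑-const n 0) (*-zeroʳ n))

∑-swap : ∀ m n (f : ℕ → ℕ → ℕ) → ∑ m (λ i → ∑ n (f i)) ≡ ∑ n (λ j → ∑ m (λ i → f i j))
∑-swap zero n f = sym (∑-zero n (λ _ _ → refl))
∑-swap (suc m) n f = trans (cong (_+ ∑ n (f m)) (∑-swap m n f))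
  (sym (∑-+ n (λ j → ∑ m (λ i → f i j)) (f m)))

∑-head : ∀ n (f : ℕ → ℕ) → ∑ (suc n) f ≡ f 0 + ∑ n (f ∘ suc)
∑-head zero f = sym (+-identityʳ (f 0))
∑-head (suc n) f = trans (cong (_+ f (suc n)) (∑-head n f)) (+-assoc (f 0) _ _)

∑-split : ∀ m n (f : ℕ → ℕ) → ∑ (m + n) f ≡ ∑ m f + ∑ n (λ i → f (m + i))
∑-split m zero f = trans (cong (λ k → ∑ k f) (+-identityʳ m)) (sym (+-identityʳ _))
∑-split m (suc n) f = trans (cong (λ k → ∑ k f) (+-suc m n))
  (trans (cong (_+ f (m + n)) (∑-split m n f)) (+-assoc (∑ m f) _ _))

-- Used to peel off the lowest base-`M` digit of a seed, which is the digit spent on the next edge.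
∑-digits : ∀ M N (f : ℕ → ℕ) → ∑ (N * M) f ≡ ∑ M (λ r → ∑ N (λ q → f (q * M + r)))
∑-digits M N f = trans (go N) (∑-swap N M (λ q r → f (q * M + r)))
  where
  go : ∀ N → ∑ (N * M) f ≡ ∑ N (λ q → ∑ M (λ r → f (q * M + r)))
  go zero = refl
  go (suc N) = trans (cong (λ k → ∑ k f) (+-comm M (N * M)))
    (trans (∑-split (N * M) M f) (cong (_+ ∑ M (λ r → f (N * M + r))) (go N)))

term≤∑ : ∀ n (f : ℕ → ℕ) i → i < n → f i ≤ ∑ n f
term≤∑ (suc n) f i lt with i ≟ n
... | yes refl = m≤n+m (f n) (∑ n f)
... | no i≢n = ≤-trans (term≤∑ n f i (≤∧≢⇒< (s≤s⁻¹ lt) i≢n)) (m≤m+n _ _)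

∑-single : ∀ n (f : ℕ → ℕ) i → i < n → ∑ n (λ j → ⟦ j ≟ i ⟧ * f j) ≡ f i
∑-single (suc n) f i lt with n ≟ i
... | yes refl = trans (cong (_+ (f n + 0)) (∑-zero n (λ j j<n →
        cong (_* f j) (⟦⟧-no (j ≟ n) (<⇒≢ j<n))))) (+-identityʳ (f n))
... | no n≢i = trans (+-identityʳ _) (∑-single n f i (≤∧≢⇒< (s≤s⁻¹ lt) (n≢i ∘ sym)))

∑-≤-range : ∀ {m n} (f : ℕ → ℕ) → m ≤ n → ∑ m f ≤ ∑ n f
∑-≤-range {m} {n} f m≤n with m≤n⇒∃[o]m+o≡n m≤n
... | o , refl = subst (∑ m f ≤_) (sym (∑-split m o f)) (m≤m+n _ _)

^-distribʳ-* : ∀ k m n → (m * n) ^ k ≡ m ^ k * n ^ k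
^-distribʳ-* zero m n = refl
^-distribʳ-* (suc k) m n = trans (cong (m * n *_) (^-distribʳ-* k m n)) (lemma m n (m ^ k) (n ^ k))
  where
  lemma : ∀ a b c d → a * b * (c * d) ≡ a * c * (b * d)
  lemma = solve-∀

-- Sampling from integer weights

-- pick k D r = D encodes that no colour is drawn, which happens for r ≥ ∑ D k.
pick : (ℕ → ℕ) → ℕ → ℕ → ℕ
pick k zero r = 0
pick k (suc D) r with r <? ∑ D k | r <? ∑ (suc D) k
... | yes _ | _ = pick k D r
... | no _ | yes _ = D
... | no _ | no _ = suc D

pick-< : ∀ k D r → r < ∑ D k → pick k D r < D
pick-< k (suc D) r lt with r <? ∑ D k | r <? ∑ (suc D) k
... | yes p | _ = m<n⇒m<1+n (pick-< k D r p)
... | no _ | yes _ = n<1+n D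
... | no _ | no ¬p = contradiction lt ¬p

pick-≥ : ∀ k D r → ∑ D k ≤ r → pick k D r ≡ D
pick-≥ k zero r ge = refl
pick-≥ k (suc D) r ge with r <? ∑ D k | r <? ∑ (suc D) k
... | yes p | _ = contradiction (≤-trans (m≤m+n _ _) ge) (<⇒≱ p)
... | no _ | yes p = contradiction ge (<⇒≱ p)
... | no _ | no _ = refl

pick-pos : ∀ k D r → r < ∑ D k → 0 < k (pick k D r)
pick-pos k (suc D) r lt with r <? ∑ D k | r <? ∑ (suc D) k
... | yes p | _ = pick-pos k D r p
... | no ¬p | yes _ = n≢0⇒n>0 λ z → ¬p (subst (r <_) (trans (cong (∑ D k +_) z) (+-identityʳ _)) lt)
... | no _ | no ¬p = contradiction lt ¬p

pick-cong : ∀ k k′ D r → (∀ c → c < D → k c ≡ k′ c) → pick k D r ≡ pick k′ D r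
pick-cong k k′ zero r h = refl
pick-cong k k′ (suc D) r h
  with r <? ∑ D k | r <? ∑ (suc D) k | r <? ∑ D k′ | r <? ∑ (suc D) k′
     | ∑-cong D (λ i lt → h i (m<n⇒m<1+n lt)) | ∑-cong (suc D) h
... | yes _ | _ | yes _ | _ | _ | _ = pick-cong k k′ D r (λ i lt → h i (m<n⇒m<1+n lt))
... | yes p | _ | no q | _ | e | _ = contradiction (subst (r <_) e p) q
... | no p | _ | yes q | _ | e | _ = contradiction (subst (r <_) (sym e) q) p
... | no _ | yes _ | no _ | yes _ | _ | _ = refl
... | no _ | yes p | no _ | no q | _ | e = contradiction (subst (r <_) e p) q
... | no _ | no p | no _ | yes q | _ | e = contradiction (subst (r <_) (sym e) q) p
... | no _ | no _ | no _ | no _ | _ | _ = refl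

-- `pick` cuts [0, n) into consecutive blocks of lengths k 0, k 1, ... and names the block
-- containing r; the surplus beyond `∑ D k` is named D and so never counts for c.
pick-count : ∀ k D n c → c < D → ∑ D k ≤ n → ∑ n (λ r → ⟦ c ≟ pick k D r ⟧) ≡ k c
pick-count k (suc D) n c c<D ge with m≤n⇒∃[o]m+o≡n ge
... | o , refl = begin
    ∑ (∑ D k + k D + o) F ≡⟨ ∑-split (∑ D k + k D) o F ⟩
    ∑ (∑ D k + k D) F + ∑ o (λ i → F (∑ D k + k D + i))
      ≡⟨ cong₂ _+_ (∑-split (∑ D k) (k D) F) (∑-zero o (λ i _ → third i)) ⟩
    ∑ (∑ D k) F + ∑ (k D) (λ i → F (∑ D k + i)) + 0 ≡⟨ +-identityʳ _ ⟩
    ∑ (∑ D k) F + ∑ (k D) (λ i → F (∑ D k + i))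
      ≡⟨ cong₂ _+_ (∑-cong (∑ D k) (λ r lt → cong (λ x → ⟦ c ≟ x ⟧) (first r lt)))
                   (∑-cong (k D) (λ i lt → cong (λ x → ⟦ c ≟ x ⟧) (second i lt))) ⟩
    ∑ (∑ D k) (λ r → ⟦ c ≟ pick k D r ⟧) + ∑ (k D) (λ _ → ⟦ c ≟ D ⟧) ≡⟨ fin (c ≟ D) ⟩
    k c ∎
  where
  open ≡-Reasoning
  F : ℕ → ℕ
  F r = ⟦ c ≟ pick k (suc D) r ⟧
  first : ∀ r → r < ∑ D k → pick k (suc D) r ≡ pick k D r
  first r lt with r <? ∑ D k | r <? ∑ (suc D) k
  ... | yes _ | _ = refl
  ... | no ¬p | _ = contradiction lt ¬p
  second : ∀ i → i < k D → pick k (suc D) (∑ D k + i) ≡ D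
  second i lt with ∑ D k + i <? ∑ D k | ∑ D k + i <? ∑ (suc D) k
  ... | yes p | _ = contradiction p (m+n≮m (∑ D k) i)
  ... | no _ | yes _ = refl
  ... | no _ | no ¬p = contradiction (+-monoʳ-< (∑ D k) lt) ¬p
  third : ∀ i → F (∑ (suc D) k + i) ≡ 0
  third i = ⟦⟧-no _ λ e → <⇒≢ c<D (trans e (pick-≥ k (suc D) _ (m≤m+n _ i)))
  fin : (d : Dec (c ≡ D)) → ∑ (∑ D k) (λ r → ⟦ c ≟ pick k D r ⟧) + ∑ (k D) (λ _ → ⟦ c ≟ D ⟧) ≡ k c
  fin (yes refl) = cong₂ _+_
    (∑-zero (∑ D k) (λ r lt → ⟦⟧-no (D ≟ pick k D r) (λ e → <⇒≢ (pick-< k D r lt) (sym e))))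
    (trans (∑-const (k D) ⟦ D ≟ D ⟧) (trans (cong (k D *_) (⟦⟧-yes (D ≟ D) refl)) (*-identityʳ (k D))))
  fin (no c≢D) = trans (cong₂ _+_ (pick-count k D (∑ D k) c (≤∧≢⇒< (s≤s⁻¹ c<D) c≢D) ≤-refl)
     (∑-zero (k D) (λ _ _ → ⟦⟧-no (c ≟ D) c≢D))) (+-identityʳ _)

-- The local state of a vertex

data Status : Set where
  active used killed : Status

-- In units of M J, X c is a martingale that estimates 1 / Pr[c is still free] while c is active.
-- In units of M, L c and Λ accumulate J (Y z c) / N and J² / N over the sampled edges to partners z,
-- N being the total sampling weight, so that x ≈ 1 / (1 - l) and l ≈ λ for most colours.
record Local : Set where
  constructor mkLocal
  field
    X L : ℕ → ℕ
    st  : ℕ → Status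
    Λ   : ℕ

open Local public

-- Being chosen takes precedence over being discarded, so that the number of used colours equals the
-- number of sampled edges.
next : Status → {P Q : Set} → Dec P → Dec Q → Status
next active (yes _) _ = used
next active (no _) (yes _) = killed
next active (no _) (no _) = active
next used _ _ = used
next killed _ _ = killed

module Dynamics (D J E B thr M : ℕ) {{M≢0 : NonZero M}} where

  -- The cutoff at B / 2 makes the bound X ≤ B unconditional, as the martingale increments need. For
  -- active colours `2X≤B` shows later that it never takes effect.
  weight : Status → ℕ → ℕ
  weight active x with 2 * x ≤? B
  ... | yes _ = x / M
  ... | no _ = 0
  weight used x = 0
  weight killed x = 0

  Y : Local → ℕ → ℕ
  Y u c = weight (st u c) (X u c)

  -- The common factor that turns products of weights into counts of seed digits. In `Params` the
  -- division is exact; the value 0 marks an edge left to the greedy rule.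
  rate : ℕ → ℕ
  rate zero = 0
  rate N@(suc _) with N <? thr
  ... | yes _ = 0
  ... | no _ = M / N

  common : Local → Local → ℕ
  common u z = ∑ D (λ c → Y u c * Y z c)

  probs : Local → Local → ℕ → ℕ
  probs u z c = Y u c * Y z c * rate (common u z)

  choice : Local → Local → ℕ → ℕ
  choice u z r = pick (probs u z) D r

  -- In real terms l > λ + 1/E. Discarding by this rule keeps l, and with it x ≈ 1 / (1 - l), under
  -- control in every outcome and not merely in likely ones.
  kill? : ∀ l λ′ → Dec (E * λ′ + M < E * l)
  kill? l λ′ = E * λ′ + M <? E * l

  -- In real terms y p is added, where p is the probability of c, and y is subtracted if c is
  -- chosen. Only the rounded weight y is at stake, hence the subtraction never truncates and the
  -- part x - y stays behind.
  upd : Local → (ℕ → ℕ) → ℕ → ℕ → Local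
  upd u Z m ch = mkLocal
    (λ c → X u c + Y u c * (Y u c * Z c * m) ∸ ⟦ c ≟ ch ⟧ * (M * Y u c))
    (λ c → L u c + J * Z c * m)
    (λ c → next (st u c) (c ≟ ch) (kill? (L u c + J * Z c * m) (Λ u + J * J * m)))
    (Λ u + J * J * m)

  M*weight≤ : ∀ s x → M * weight s x ≤ x
  M*weight≤ active x with 2 * x ≤? B
  ... | yes _ = subst (_≤ x) (*-comm (x / M) M) (m/n*n≤m x M)
  ... | no _ = subst (_≤ x) (sym (*-zeroʳ M)) z≤n
  M*weight≤ used x = subst (_≤ x) (sym (*-zeroʳ M)) z≤n
  M*weight≤ killed x = subst (_≤ x) (sym (*-zeroʳ M)) z≤n

  M*Y≤X : ∀ u c → M * Y u c ≤ X u c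
  M*Y≤X u c = M*weight≤ (st u c) (X u c)

  rate*N≤M : ∀ N → N * rate N ≤ M
  rate*N≤M zero = z≤n
  rate*N≤M N@(suc _) with N <? thr
  ... | yes _ = subst (_≤ M) (sym (*-zeroʳ N)) z≤n
  ... | no _ = subst (_≤ M) (*-comm (M / N) N) (m/n*n≤m M N)

  probs-sum : ∀ u z → ∑ D (probs u z) ≡ common u z * rate (common u z)
  probs-sum u z = ∑-*ʳ D (rate (common u z)) (λ c → Y u c * Y z c)

  probs-sum≤M : ∀ u z → ∑ D (probs u z) ≤ M
  probs-sum≤M u z = subst (_≤ M) (sym (probs-sum u z)) (rate*N≤M (common u z))

  common-comm : ∀ u z → common u z ≡ common z u
  common-comm u z = ∑-cong D (λ c _ → *-comm (Y u c) (Y z c))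

  probs-comm : ∀ u z c → probs u z c ≡ probs z u c
  probs-comm u z c = cong₂ _*_ (*-comm (Y u c) (Y z c)) (cong rate (common-comm u z))

  -- Each endpoint computes the colour with itself as first argument; they must arrive at the same
  -- one.
  choice-comm : ∀ u z r → choice u z r ≡ choice z u r
  choice-comm u z r = pick-cong (probs u z) (probs z u) D r (λ c _ → probs-comm u z c)

  step : Local → Local → ℕ → Local
  step u z r = upd u (Y z) (rate (common u z)) (choice u z r)

  prob≤M : ∀ u z c → c < D → probs u z c ≤ M
  prob≤M u z c c<D = ≤-trans (term≤∑ D (probs u z) c c<D) (probs-sum≤M u z)

  drop≤X : ∀ u c ch → ⟦ c ≟ ch ⟧ * (M * Y u c) ≤ X u c
  drop≤X u c ch with c ≟ ch
  ... | yes _ = subst (_≤ X u c) (sym (+-identityʳ (M * Y u c))) (M*Y≤X u c)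
  ... | no _ = z≤n

  step-X : ∀ u z r c → X (step u z r) c + ⟦ c ≟ choice u z r ⟧ * (M * Y u c)
         ≡ X u c + Y u c * probs u z c
  step-X u z r c = m∸n+n≡m (≤-trans (drop≤X u c (choice u z r)) (m≤m+n _ _))

  -- Exactly `probs u z c` of the M digits choose c. The losses M Y on these digits balance the gain
  -- Y * `probs u z c` made on all M of them.
  martingale : ∀ u z c → c < D → ∑ M (λ r → X (step u z r) c) ≡ M * X u c
  martingale u z c c<D = +-cancelʳ-≡ (probs u z c * (M * Y u c)) _ _ (begin
    ∑ M (λ r → X (step u z r) c) + probs u z c * (M * Y u c)
      ≡⟨ cong (λ k → ∑ M (λ r → X (step u z r) c) + k * (M * Y u c))
           (sym (pick-count (probs u z) D M c c<D (probs-sum≤M u z))) ⟩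
    ∑ M (λ r → X (step u z r) c) + ∑ M (λ r → ⟦ c ≟ choice u z r ⟧) * (M * Y u c)
      ≡⟨ cong (∑ M (λ r → X (step u z r) c) +_)
           (sym (∑-*ʳ M (M * Y u c) (λ r → ⟦ c ≟ choice u z r ⟧))) ⟩
    ∑ M (λ r → X (step u z r) c) + ∑ M (λ r → ⟦ c ≟ choice u z r ⟧ * (M * Y u c))
      ≡⟨ sym (∑-+ M _ _) ⟩
    ∑ M (λ r → X (step u z r) c + ⟦ c ≟ choice u z r ⟧ * (M * Y u c))
      ≡⟨ ∑-cong M (λ r _ → step-X u z r c) ⟩
    ∑ M (λ r → X u c + Y u c * probs u z c) ≡⟨ ∑-const M _ ⟩
    M * (X u c + Y u c * probs u z c) ≡⟨ alg M (X u c) (Y u c) (probs u z c) ⟩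
    M * X u c + probs u z c * (M * Y u c) ∎)
    where
    open ≡-Reasoning
    alg : ∀ m x y p → m * (x + y * p) ≡ m * x + p * (m * y)
    alg = solve-∀

  Bounded : Local → Set
  Bounded u = ∀ c → c < D → X u c ≤ B

  -- A step at most doubles X, and it does so only below the cutoff.
  weight-double : ∀ s x k → x ≤ B → k ≤ M → x + weight s x * k ≤ B
  weight-double active x k x≤B k≤M with 2 * x ≤? B
  ... | yes p = ≤-trans (+-monoʳ-≤ x (≤-trans (*-monoʳ-≤ (x / M) k≤M) (m/n*n≤m x M)))
                  (subst (_≤ B) (cong (x +_) (+-identityʳ x)) p)
  ... | no _ = subst (_≤ B) (sym (+-identityʳ x)) x≤B
  weight-double used x k x≤B _ = subst (_≤ B) (sym (+-identityʳ x)) x≤B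
  weight-double killed x k x≤B _ = subst (_≤ B) (sym (+-identityʳ x)) x≤B

  step-bounded : ∀ u z r → Bounded u → Bounded (step u z r)
  step-bounded u z r bd c c<D = ≤-trans (m∸n≤m _ (⟦ c ≟ choice u z r ⟧ * (M * Y u c)))
    (weight-double (st u c) (X u c) (probs u z c) (bd c c<D) (prob≤M u z c c<D))

  Y*prob≤ : ∀ u z → Bounded u → ∑ D (λ c → Y u c * probs u z c) ≤ B
  Y*prob≤ u z bd = *-cancelˡ-≤ M (begin
    M * ∑ D (λ c → Y u c * probs u z c) ≡⟨ sym (∑-*ˡ D M _) ⟩
    ∑ D (λ c → M * (Y u c * probs u z c)) ≤⟨ ∑-mono D (λ c lt → pt c lt) ⟩
    ∑ D (λ c → B * probs u z c) ≡⟨ ∑-*ˡ D B _ ⟩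
    B * ∑ D (probs u z) ≤⟨ *-monoʳ-≤ B (probs-sum≤M u z) ⟩
    B * M ≡⟨ *-comm B M ⟩
    M * B ∎)
    where
    open ≤-Reasoning
    pt : ∀ c → c < D → M * (Y u c * probs u z c) ≤ B * probs u z c
    pt c lt = begin
      M * (Y u c * probs u z c) ≡⟨ sym (*-assoc M (Y u c) _) ⟩
      M * Y u c * probs u z c ≤⟨ *-monoˡ-≤ (probs u z c) (≤-trans (M*Y≤X u c) (bd c lt)) ⟩
      B * probs u z c ∎

  -- One B bounds the change over all colours together, not one B per colour: the gains form an
  -- average of the weights with respect to the sampling probabilities, and in `step-down` only the
  -- chosen colour loses.
  step-up : ∀ u z r (a : ℕ → ℕ) → Bounded u → (∀ c → a c ≤ 1)
    → ∑ D (λ c → a c * X (step u z r) c) ≤ ∑ D (λ c → a c * X u c) + B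
  step-up u z r a bd a≤1 = begin
    ∑ D (λ c → a c * X (step u z r) c) ≤⟨ ∑-mono D (λ c _ → pt c) ⟩
    ∑ D (λ c → a c * X u c + Y u c * probs u z c) ≡⟨ ∑-+ D _ _ ⟩
    ∑ D (λ c → a c * X u c) + ∑ D (λ c → Y u c * probs u z c)
      ≤⟨ +-monoʳ-≤ _ (Y*prob≤ u z bd) ⟩
    ∑ D (λ c → a c * X u c) + B ∎
    where
    open ≤-Reasoning
    pt : ∀ c → a c * X (step u z r) c ≤ a c * X u c + Y u c * probs u z c
    pt c = begin
      a c * X (step u z r) c ≤⟨ *-monoʳ-≤ (a c) (m∸n≤m _ (⟦ c ≟ choice u z r ⟧ * (M * Y u c))) ⟩
      a c * (X u c + Y u c * probs u z c) ≡⟨ *-distribˡ-+ (a c) (X u c) _ ⟩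
      a c * X u c + a c * (Y u c * probs u z c)
        ≤⟨ +-monoʳ-≤ _ (≤-trans (*-monoˡ-≤ _ (a≤1 c)) (≤-reflexive (*-identityˡ _))) ⟩
      a c * X u c + Y u c * probs u z c ∎

  ∑-hit : ∀ u ch → Bounded u → ∑ D (λ c → ⟦ c ≟ ch ⟧ * (M * Y u c)) ≤ B
  ∑-hit u ch bd with ch <? D
  ... | yes lt = ≤-trans (≤-reflexive (∑-single D (λ c → M * Y u c) ch lt))
                   (≤-trans (M*Y≤X u ch) (bd ch lt))
  ... | no ≥D = ≤-trans (≤-reflexive (∑-zero D (λ c lt → cong (_* (M * Y u c))
                   (⟦⟧-no (c ≟ ch) (λ { refl → ≥D lt }))))) z≤n

  step-down : ∀ u z r (a : ℕ → ℕ) → Bounded u → (∀ c → a c ≤ 1)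
    → ∑ D (λ c → a c * X u c) ≤ ∑ D (λ c → a c * X (step u z r) c) + B
  step-down u z r a bd a≤1 = begin
    ∑ D (λ c → a c * X u c) ≤⟨ ∑-mono D (λ c _ → pt c) ⟩
    ∑ D (λ c → a c * X (step u z r) c + ⟦ c ≟ choice u z r ⟧ * (M * Y u c)) ≡⟨ ∑-+ D _ _ ⟩
    ∑ D (λ c → a c * X (step u z r) c) + ∑ D (λ c → ⟦ c ≟ choice u z r ⟧ * (M * Y u c))
      ≤⟨ +-monoʳ-≤ _ (∑-hit u (choice u z r) bd) ⟩
    ∑ D (λ c → a c * X (step u z r) c) + B ∎
    where
    open ≤-Reasoning
    pt : ∀ c → a c * X u c ≤ a c * X (step u z r) c + ⟦ c ≟ choice u z r ⟧ * (M * Y u c)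
    pt c = begin
      a c * X u c ≤⟨ *-monoʳ-≤ (a c) (m≤m+n (X u c) (Y u c * probs u z c)) ⟩
      a c * (X u c + Y u c * probs u z c) ≡⟨ cong (a c *_) (sym (step-X u z r c)) ⟩
      a c * (X (step u z r) c + ⟦ c ≟ choice u z r ⟧ * (M * Y u c)) ≡⟨ *-distribˡ-+ (a c) _ _ ⟩
      a c * X (step u z r) c + a c * (⟦ c ≟ choice u z r ⟧ * (M * Y u c))
        ≤⟨ +-monoʳ-≤ _ (≤-trans (*-monoˡ-≤ _ (a≤1 c)) (≤-reflexive (*-identityˡ _))) ⟩
      a c * X (step u z r) c + ⟦ c ≟ choice u z r ⟧ * (M * Y u c) ∎

-- Exponential lower bounds for products

-- With P = j + o fixed, the factor (P + 1) / P is at most (o + 1) / o because o ≤ P, and these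
-- quotients telescope to P / o.
pow-upper : ∀ j o → (j + o + 1) ^ j * o ≤ (j + o) ^ j * (j + o)
pow-upper j o = go j o (j + o) refl
  where
  go : ∀ j o P → j + o ≡ P → (P + 1) ^ j * o ≤ P ^ j * P
  go zero o P refl = ≤-refl
  go (suc j) o P eq = begin
    (P + 1) * (P + 1) ^ j * o ≡⟨ l1 P o x ⟩
    x * (P * o + o) ≤⟨ *-monoʳ-≤ x (+-monoʳ-≤ (P * o) (subst (o ≤_) eq (m≤n+m o (suc j)))) ⟩
    x * (P * o + P) ≡⟨ l2 P o x ⟩
    x * (1 + o) * P ≤⟨ *-monoˡ-≤ P (go j (suc o) P (trans (+-suc j o) eq)) ⟩
    y * P * P ≡⟨ cong (_* P) (*-comm y P) ⟩
    P * y * P ∎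
    where
    open ≤-Reasoning
    x = (P + 1) ^ j
    y = P ^ j
    l1 : ∀ P o x → (P + 1) * x * o ≡ x * (P * o + o)
    l1 = solve-∀
    l2 : ∀ P o x → x * (P * o + P) ≡ x * (1 + o) * P
    l2 = solve-∀

bernoulli : ∀ P j → P ^ j * (P + suc j) ≤ (P + 1) ^ suc j
bernoulli P zero = ≤-reflexive (lemma P)
  where
  lemma : ∀ P → 1 * (P + 1) ≡ (P + 1) * 1
  lemma = solve-∀
bernoulli P (suc j) = begin
  P * y * (P + suc (suc j)) ≤⟨ ≤-by (y * (1 + j)) (lemma P y j) ⟩
  (P + 1) * (y * (P + suc j)) ≤⟨ *-monoʳ-≤ (P + 1) (bernoulli P j) ⟩
  (P + 1) * (P + 1) ^ suc j ∎
  where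
  open ≤-Reasoning
  y = P ^ j
  lemma : ∀ P y j → P * y * (P + (2 + j)) + y * (1 + j) ≡ (P + 1) * (y * (P + (1 + j)))
  lemma = solve-∀

double≤pow : ∀ P → 2 * suc P ^ suc P ≤ (suc P + 1) ^ suc P
double≤pow P = ≤-trans (≤-reflexive (lemma (suc P) (suc P ^ P))) (bernoulli (suc P) P)
  where
  lemma : ∀ P y → 2 * (P * y) ≡ y * (P + P)
  lemma = solve-∀

double^≤pow : ∀ P b → 2 ^ b * suc P ^ (suc P * b) ≤ (suc P + 1) ^ (suc P * b)
double^≤pow P b = begin
  2 ^ b * suc P ^ (suc P * b) ≡⟨ cong (2 ^ b *_) (sym (^-*-assoc (suc P) (suc P) b)) ⟩
  2 ^ b * (suc P ^ suc P) ^ b ≡⟨ sym (^-distribʳ-* b 2 (suc P ^ suc P)) ⟩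
  (2 * suc P ^ suc P) ^ b ≤⟨ ^-monoˡ-≤ b (double≤pow P) ⟩
  ((suc P + 1) ^ suc P) ^ b ≡⟨ ^-*-assoc (suc P + 1) (suc P) b ⟩
  (suc P + 1) ^ (suc P * b) ∎
  where
  open ≤-Reasoning

private
  -- With h = 1/P: (1 + h)^j ≤ 1 / (1 - j h) ≤ 1 + (j + 1) h, the last inequality being j (j + 1) h
  -- ≤ 1.
  up-step : ∀ P j → 0 < P → j * suc j < P → P * (P + 1) ^ j ≤ (P + suc j) * P ^ j
  up-step P j P>0 h with m≤n⇒∃[o]m+o≡n (≤-trans (m≤m*n j (suc j)) (<⇒≤ h))
  ... | o , refl = *-cancelʳ-≤ _ _ o {{>-nonZero o>0}} (begin
      (j + o) * (j + o + 1) ^ j * o ≡⟨ *-assoc (j + o) _ o ⟩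
      (j + o) * ((j + o + 1) ^ j * o) ≤⟨ *-monoʳ-≤ (j + o) (pow-upper j o) ⟩
      (j + o) * (y * (j + o)) ≡⟨ l1 j o y ⟩
      y * (o * o + 2 * j * o + j * j) ≤⟨ *-monoʳ-≤ y (+-monoʳ-≤ (o * o + 2 * j * o) jj≤o) ⟩
      y * (o * o + 2 * j * o + o) ≡⟨ l2 j o y ⟩
      (j + o + suc j) * y * o ∎)
    where
    open ≤-Reasoning
    y = (j + o) ^ j
    l1 : ∀ j o y → (j + o) * (y * (j + o)) ≡ y * (o * o + 2 * j * o + j * j)
    l1 = solve-∀
    l2 : ∀ j o y → y * (o * o + 2 * j * o + o) ≡ (j + o + (1 + j)) * y * o
    l2 = solve-∀
    jj<o : j * j < o
    jj<o = +-cancelˡ-< j _ _ (subst (_< j + o) (*-suc j j) h)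
    jj≤o : j * j ≤ o
    jj≤o = <⇒≤ jj<o
    o>0 : 0 < o
    o>0 = ≤-<-trans z≤n jj<o

  -- With P = f + k and h = 1/P, Bernoulli gives (1 - k h) (1 + h)^(k + 1) ≥ (1 - k h) (1 + (k + 1)
  -- h), which is at least 1 since k (k + 1) h ≤ 1.
  down-step : ∀ f k → k * suc k ≤ f + k → (f + k) * (f + k) ^ suc k ≤ f * (f + k + 1) ^ suc k
  down-step f k h = begin
      (f + k) * ((f + k) * y) ≡⟨ l1 f k y ⟩
      y * (f * f + 2 * f * k + k * k) ≤⟨ *-monoʳ-≤ y (+-monoʳ-≤ (f * f + 2 * f * k) kk≤f) ⟩
      y * (f * f + 2 * f * k + f) ≡⟨ l2 f k y ⟩
      f * (y * (f + k + suc k)) ≤⟨ *-monoʳ-≤ f (bernoulli (f + k) k) ⟩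
      f * (f + k + 1) ^ suc k ∎
    where
    open ≤-Reasoning
    y = (f + k) ^ k
    l1 : ∀ f k y → (f + k) * ((f + k) * y) ≡ y * (f * f + 2 * f * k + k * k)
    l1 = solve-∀
    l2 : ∀ f k y → y * (f * f + 2 * f * k + f) ≡ f * (y * (f + k + (1 + k)))
    l2 = solve-∀
    kk≤f : k * k ≤ f
    kk≤f = +-cancelʳ-≤ k _ _ (subst (_≤ f + k) (trans (*-suc k k) (+-comm k (k * k))) h)

-- With h = 1/P and K = k + p, this reads 1 + k h ≥ (1 + h)^(k - 1) for -p ≤ k ≤ p.
gain : ∀ p K f → 0 < p → K ≤ 2 * p → let P = p * suc p in P + K ≡ f + p
  → P * (P + 1) ^ K * P ^ suc p ≤ f * (P + 1) ^ suc p * P ^ K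
gain p K f p>0 K≤2p eq with ≤-total p K
... | inj₁ p≤K with m≤n⇒∃[o]m+o≡n p≤K
...   | zero , refl = subst (λ f → P * (P + 1) ^ (p + 0) * P ^ suc p ≤ f * (P + 1) ^ suc p * P ^ (p + 0)) f≡ main
  where
  open ≤-Reasoning
  P = p * suc p
  f≡ : P ≡ f
  f≡ = +-cancelʳ-≡ p _ _ (trans (cong (P +_) (sym (+-identityʳ p))) eq)
  main : P * (P + 1) ^ (p + 0) * P ^ suc p ≤ P * (P + 1) ^ suc p * P ^ (p + 0)
  main = subst (λ q → P * (P + 1) ^ q * P ^ suc p ≤ P * (P + 1) ^ suc p * P ^ q) (sym (+-identityʳ p))
    (≤-by _ (lemma P ((P + 1) ^ p) (P ^ p)))
    where
    lemma : ∀ P a b → P * a * (P * b) + P * a * b ≡ P * ((P + 1) * a) * b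
    lemma = solve-∀
...   | suc j , refl = begin
    P * (P + 1) ^ (p + suc j) * P ^ suc p ≡⟨ cong (λ x → P * x * P ^ suc p) (l0 (P + 1)) ⟩
    P * ((P + 1) ^ j * (P + 1) ^ suc p) * P ^ suc p ≡⟨ l1 P ((P + 1) ^ j) ((P + 1) ^ suc p) (P ^ suc p) ⟩
    P * (P + 1) ^ j * ((P + 1) ^ suc p * P ^ suc p) ≤⟨ *-monoˡ-≤ _ (up-step P j P>0 jj<P) ⟩
    (P + suc j) * P ^ j * ((P + 1) ^ suc p * P ^ suc p) ≡⟨ l2 (P + suc j) (P ^ j) ((P + 1) ^ suc p) (P ^ suc p) ⟩
    (P + suc j) * (P + 1) ^ suc p * (P ^ j * P ^ suc p) ≡⟨ cong₂ (λ x y → x * (P + 1) ^ suc p * y) f≡ (sym (l0 P)) ⟩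
    f * (P + 1) ^ suc p * P ^ (p + suc j) ∎
  where
  open ≤-Reasoning
  P = p * suc p
  f≡ : P + suc j ≡ f
  f≡ = +-cancelʳ-≡ p _ _ (trans (lemma P p (suc j)) eq)
    where
    lemma : ∀ a b c → a + c + b ≡ a + (b + c)
    lemma = solve-∀
  l0 : ∀ x → x ^ (p + suc j) ≡ x ^ j * x ^ suc p
  l0 x = trans (cong (x ^_) (trans (+-suc p j) (+-comm (suc p) j))) (^-distribˡ-+-* x j (suc p))
  l1 : ∀ a b c d → a * (b * c) * d ≡ a * b * (c * d)
  l1 = solve-∀
  l2 : ∀ a b c d → a * b * (c * d) ≡ a * c * (b * d)
  l2 = solve-∀
  P>0 : 0 < P
  P>0 = *-mono-≤ p>0 (s≤s (z≤n {p}))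
  j<p : j < p
  j<p = +-cancelˡ-≤ p _ _ (subst (p + suc j ≤_) (cong (p +_) (+-identityʳ p)) K≤2p)
  jj<P : j * suc j < P
  jj<P = *-mono-< j<p (s≤s j<p)
gain p K f p>0 K≤2p eq | inj₂ K≤p with m≤n⇒∃[o]m+o≡n K≤p
... | k , refl = subst (λ P → P * (P + 1) ^ K * P ^ suc p ≤ f * (P + 1) ^ suc p * P ^ K) (sym P≡) (begin
    Q * (Q + 1) ^ K * Q ^ suc p ≡⟨ cong (Q * (Q + 1) ^ K *_) (l0 Q) ⟩
    Q * (Q + 1) ^ K * (Q ^ K * Q ^ suc k) ≡⟨ l1 Q ((Q + 1) ^ K) (Q ^ K) (Q ^ suc k) ⟩
    Q * Q ^ suc k * ((Q + 1) ^ K * Q ^ K) ≤⟨ *-monoˡ-≤ _ (down-step f k kk≤) ⟩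
    f * (Q + 1) ^ suc k * ((Q + 1) ^ K * Q ^ K) ≡⟨ l2 f ((Q + 1) ^ suc k) ((Q + 1) ^ K) (Q ^ K) ⟩
    f * ((Q + 1) ^ K * (Q + 1) ^ suc k) * Q ^ K ≡⟨ cong (λ x → f * x * Q ^ K) (sym (l0 (Q + 1))) ⟩
    f * (Q + 1) ^ suc p * Q ^ K ∎)
  where
  open ≤-Reasoning
  Q = f + k
  P≡ : p * suc p ≡ Q
  P≡ = +-cancelʳ-≡ K _ _ (trans eq (lemma f K k))
    where
    lemma : ∀ a b c → a + (b + c) ≡ a + c + b
    lemma = solve-∀
  l0 : ∀ x → x ^ suc p ≡ x ^ K * x ^ suc k
  l0 x = trans (cong (x ^_) (sym (+-suc K k))) (^-distribˡ-+-* x K (suc k))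
  l1 : ∀ a b c d → a * b * (c * d) ≡ a * d * (b * c)
  l1 = solve-∀
  l2 : ∀ a b c d → a * b * (c * d) ≡ a * (c * b) * d
  l2 = solve-∀
  kk≤ : k * suc k ≤ f + k
  kk≤ = subst (k * suc k ≤_) P≡ (*-mono-≤ (m≤n+m k K) (s≤s (m≤n+m k K)))

-- The global process and its exponential potential

-- Meaningful for edges at w. For any other edge the value is arbitrary and gets multiplied by
-- `inc w e` = 0 in the row sums.
other : ∀ {n} → Fin n → Edge n → Fin n
other w (x , y) with w FinP.≟ x
... | yes _ = y
... | no _ = x

inc : ∀ {n} → Fin n → Edge n → ℕ
inc w e = ⟦ incident? w e ⟧

adv : ∀ {n} → Fin n → ℕ → Edge n → ℕ
adv w i e = inc w e + i

occ : ∀ {n} → Fin n → Fin n → List (Edge n) → ℕ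
occ w x [] = 0
occ w x (e ∷ es) = inc w e * ⟦ other w e FinP.≟ x ⟧ + occ w x es

-- The future rows of w that a step on e can influence: those whose partner is an endpoint of e.
-- Summed over time, `links` counts the steps that matter to w, with multiplicity.
hits : ∀ {n} → Fin n → Edge n → List (Edge n) → ℕ
hits w e es = occ w (proj₁ e) es + occ w (proj₂ e) es

links : ∀ {n} → Fin n → List (Edge n) → ℕ
links w [] = 0
links w (e ∷ es) = hits w e es + links w es

-- In a simple graph w has at most one later edge to each endpoint of e. So one step moves the sum
-- over all rows of w by at most two row increments.
Sparse : ∀ {n} → Fin n → List (Edge n) → Set
Sparse w [] = 0 ≡ 0
Sparse w (e ∷ es) = hits w e es ≤ 2 × Sparse w es

module Global (D J E B thr M : ℕ) {{M≢0 : NonZero M}} (n : ℕ) where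
  open Dynamics D J E B thr M {{M≢0}} public

  Conf : Set
  Conf = Fin n → Local

  gstep : Conf → Edge n → ℕ → Conf
  gstep σ (x , y) r v with v FinP.≟ x | v FinP.≟ y
  ... | yes _ | _ = step (σ x) (σ y) r
  ... | no _ | yes _ = step (σ y) (σ x) r
  ... | no _ | no _ = σ v

  BoundedConf : Conf → Set
  BoundedConf σ = ∀ v → Bounded (σ v)

  gstep-bounded : ∀ σ e r → BoundedConf σ → BoundedConf (gstep σ e r)
  gstep-bounded σ (x , y) r bd v with v FinP.≟ x | v FinP.≟ y
  ... | yes _ | _ = step-bounded (σ x) (σ y) r (bd x)
  ... | no _ | yes _ = step-bounded (σ y) (σ x) r (bd y)
  ... | no _ | no _ = bd v

  -- Covers both X and B - X, so that one upper tail bound serves for the two tails.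
  record Observable : Set where
    field
      val : Local → ℕ → ℕ
      β : ℕ
      val-mart : ∀ u z c → c < D → Bounded u → ∑ M (λ r → val (step u z r) c) ≡ M * val u c
      val-up : ∀ u z r (a : ℕ → ℕ) → Bounded u → (∀ c → a c ≤ 1)
        → ∑ D (λ c → a c * val (step u z r) c) ≤ ∑ D (λ c → a c * val u c) + β
      val-down : ∀ u z r (a : ℕ → ℕ) → Bounded u → (∀ c → a c ≤ 1)
        → ∑ D (λ c → a c * val u c) ≤ ∑ D (λ c → a c * val (step u z r) c) + β

  module Potential (O : Observable) (w : Fin n) (a : ℕ → ℕ → ℕ) (a≤1 : ∀ i c → a i c ≤ 1) where
    open Observable O

    rowVal : ℕ → Local → ℕ
    rowVal i u = ∑ D (λ c → a i c * val u c)

    row : ℕ → Conf → Edge n → ℕ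
    row i σ e = inc w e * rowVal i (σ (other w e))

    -- The value that the rows of es would have if all weights stayed as they are in σ.
    expected : ℕ → Conf → List (Edge n) → ℕ
    expected i σ [] = 0
    expected i σ (e ∷ es) = row i σ e + expected (adv w i e) σ es

    realised : ℕ → Conf → ℕ → List (Edge n) → ℕ
    realised i σ s [] = 0
    realised i σ s (e ∷ es) = row i σ e + realised (adv w i e) (gstep σ e (s % M)) (s / M) es

    rowVal-mart : ∀ i u z → Bounded u → ∑ M (λ r → rowVal i (step u z r)) ≡ M * rowVal i u
    rowVal-mart i u z bd = begin
      ∑ M (λ r → ∑ D (λ c → a i c * val (step u z r) c)) ≡⟨ ∑-swap M D _ ⟩
      ∑ D (λ c → ∑ M (λ r → a i c * val (step u z r) c)) ≡⟨ ∑-cong D (λ c lt → begin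
        ∑ M (λ r → a i c * val (step u z r) c) ≡⟨ ∑-*ˡ M (a i c) _ ⟩
        a i c * ∑ M (λ r → val (step u z r) c) ≡⟨ cong (a i c *_) (val-mart u z c lt bd) ⟩
        a i c * (M * val u c) ≡⟨ lemma (a i c) M (val u c) ⟩
        M * (a i c * val u c) ∎) ⟩
      ∑ D (λ c → M * (a i c * val u c)) ≡⟨ ∑-*ˡ D M _ ⟩
      M * rowVal i u ∎
      where
      open ≡-Reasoning
      lemma : ∀ x y z → x * (y * z) ≡ y * (x * z)
      lemma = solve-∀

    rowVal-gmart : ∀ i σ e v → BoundedConf σ → ∑ M (λ r → rowVal i (gstep σ e r v)) ≡ M * rowVal i (σ v)
    rowVal-gmart i σ (x , y) v bd with v FinP.≟ x | v FinP.≟ y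
    ... | yes refl | _ = rowVal-mart i (σ x) (σ y) (bd x)
    ... | no _ | yes refl = rowVal-mart i (σ y) (σ x) (bd y)
    ... | no _ | no _ = ∑-const M _

    expected-mart : ∀ i σ e es → BoundedConf σ
      → ∑ M (λ r → expected i (gstep σ e r) es) ≡ M * expected i σ es
    expected-mart i σ e [] bd = trans (∑-const M 0) refl
    expected-mart i σ e (f ∷ es) bd = begin
      ∑ M (λ r → row i (gstep σ e r) f + expected (adv w i f) (gstep σ e r) es) ≡⟨ ∑-+ M _ _ ⟩
      ∑ M (λ r → row i (gstep σ e r) f) + ∑ M (λ r → expected (adv w i f) (gstep σ e r) es)
        ≡⟨ cong₂ _+_ (trans (∑-*ˡ M (inc w f) _) (cong (inc w f *_) (rowVal-gmart i σ e (other w f) bd)))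
                     (expected-mart (adv w i f) σ e es bd) ⟩
      inc w f * (M * rowVal i (σ (other w f))) + M * expected (adv w i f) σ es
        ≡⟨ lemma (inc w f) M _ _ ⟩
      M * (row i σ f + expected (adv w i f) σ es) ∎
      where
      open ≡-Reasoning
      lemma : ∀ x y z t → x * (y * z) + y * t ≡ y * (x * z + t)
      lemma = solve-∀

    touch : Edge n → Fin n → ℕ
    touch e v = ⟦ v FinP.≟ proj₁ e ⟧ + ⟦ v FinP.≟ proj₂ e ⟧

    rowVal-up : ∀ i σ e r v → BoundedConf σ → rowVal i (gstep σ e r v) ≤ rowVal i (σ v) + touch e v * β
    rowVal-up i σ (x , y) r v bd with v FinP.≟ x | v FinP.≟ y
    ... | yes refl | d = ≤-trans (val-up (σ x) (σ y) r (a i) (bd x) (a≤1 i))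
                           (+-monoʳ-≤ (rowVal i (σ x)) (m≤m+n β (⟦ d ⟧ * β)))
    ... | no _ | yes refl = ≤-trans (val-up (σ y) (σ x) r (a i) (bd y) (a≤1 i))
                           (+-monoʳ-≤ (rowVal i (σ y)) (m≤m+n β 0))
    ... | no _ | no _ = m≤m+n _ _

    rowVal-down : ∀ i σ e r v → BoundedConf σ → rowVal i (σ v) ≤ rowVal i (gstep σ e r v) + touch e v * β
    rowVal-down i σ (x , y) r v bd with v FinP.≟ x | v FinP.≟ y
    ... | yes refl | d = ≤-trans (val-down (σ x) (σ y) r (a i) (bd x) (a≤1 i))
                           (+-monoʳ-≤ (rowVal i (step (σ x) (σ y) r)) (m≤m+n β (⟦ d ⟧ * β)))
    ... | no _ | yes refl = ≤-trans (val-down (σ y) (σ x) r (a i) (bd y) (a≤1 i))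
                           (+-monoʳ-≤ (rowVal i (step (σ y) (σ x) r)) (m≤m+n β 0))
    ... | no _ | no _ = m≤m+n _ _

    private
      regroup : ∀ k A s t β h X → (k * (A + (s + t) * β)) + (X + h * β)
              ≡ (k * A + X) + (k * s + k * t + h) * β
      regroup = solve-∀

      hits-cons : ∀ k s t o p → k * s + k * t + (o + p) ≡ k * s + o + (k * t + p)
      hits-cons = solve-∀

    expected-up : ∀ i σ e r es → BoundedConf σ
      → expected i (gstep σ e r) es ≤ expected i σ es + hits w e es * β
    expected-up i σ e r [] bd = z≤n
    expected-up i σ e@(x , y) r (f ∷ es) bd = begin
      inc w f * rowVal i (gstep σ e r v) + expected i′ (gstep σ e r) es
        ≤⟨ +-mono-≤ (*-monoʳ-≤ (inc w f) (rowVal-up i σ e r v bd)) (expected-up i′ σ e r es bd) ⟩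
      inc w f * (rowVal i (σ v) + touch e v * β) + (expected i′ σ es + hits w e es * β)
        ≡⟨ regroup (inc w f) (rowVal i (σ v)) ⟦ v FinP.≟ x ⟧ ⟦ v FinP.≟ y ⟧ β (hits w e es) _ ⟩
      (row i σ f + expected i′ σ es) + (inc w f * ⟦ v FinP.≟ x ⟧ + inc w f * ⟦ v FinP.≟ y ⟧ + hits w e es) * β
        ≡⟨ cong (λ k → (row i σ f + expected i′ σ es) + k * β)
             (hits-cons (inc w f) ⟦ v FinP.≟ x ⟧ ⟦ v FinP.≟ y ⟧ (occ w x es) (occ w y es)) ⟩
      expected i σ (f ∷ es) + hits w e (f ∷ es) * β ∎
      where
      open ≤-Reasoning
      v = other w f
      i′ = adv w i f

    expected-down : ∀ i σ e r es → BoundedConf σ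
      → expected i σ es ≤ expected i (gstep σ e r) es + hits w e es * β
    expected-down i σ e r [] bd = z≤n
    expected-down i σ e@(x , y) r (f ∷ es) bd = begin
      inc w f * rowVal i (σ v) + expected i′ σ es
        ≤⟨ +-mono-≤ (*-monoʳ-≤ (inc w f) (rowVal-down i σ e r v bd)) (expected-down i′ σ e r es bd) ⟩
      inc w f * (rowVal i (σ′ v) + touch e v * β) + (expected i′ σ′ es + hits w e es * β)
        ≡⟨ regroup (inc w f) (rowVal i (σ′ v)) ⟦ v FinP.≟ x ⟧ ⟦ v FinP.≟ y ⟧ β (hits w e es) _ ⟩
      (row i σ′ f + expected i′ σ′ es) + (inc w f * ⟦ v FinP.≟ x ⟧ + inc w f * ⟦ v FinP.≟ y ⟧ + hits w e es) * β
        ≡⟨ cong (λ k → (row i σ′ f + expected i′ σ′ es) + k * β)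
             (hits-cons (inc w f) ⟦ v FinP.≟ x ⟧ ⟦ v FinP.≟ y ⟧ (occ w x es) (occ w y es)) ⟩
      expected i σ′ (f ∷ es) + hits w e (f ∷ es) * β ∎
      where
      open ≤-Reasoning
      v = other w f
      i′ = adv w i f
      σ′ = gstep σ e r

    module Exponential (p U : ℕ) (p>0 : 0 < p) {{U≢0 : NonZero U}} (2β≤pU : 2 * β ≤ p * U) where

      P R : ℕ
      P = p * suc p
      R = P * U

      pU≤R : p * U ≤ R
      pU≤R = *-monoˡ-≤ U (m≤m*n p (suc p))

      -- The factors R + (T′ - T) are linear in the martingale increment, where an exponential
      -- moment would have exponential ones. Their product therefore has mean exactly R to the
      -- number of edges.
      Π : ℕ → Conf → ℕ → List (Edge n) → ℕ
      Π i σ s [] = 1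
      Π i σ s (e ∷ es) = (R + expected i′ σ′ es ∸ expected i′ σ es) * Π i′ σ′ (s / M) es
        where
        i′ = adv w i e
        σ′ = gstep σ e (s % M)

      hits*β≤ : ∀ e es → hits w e es ≤ 2 → hits w e es * β ≤ p * U
      hits*β≤ e es h = ≤-trans (*-monoˡ-≤ β h) 2β≤pU

      fits : ∀ i σ e r es → BoundedConf σ → hits w e es ≤ 2
        → expected i σ es ≤ R + expected i (gstep σ e r) es
      fits i σ e r es bd h = ≤-trans (expected-down i σ e r es bd)
        (≤-trans (+-monoʳ-≤ _ (≤-trans (hits*β≤ e es h) pU≤R)) (≤-reflexive (+-comm _ R)))

      -- Given the past, the lowest digit is uniform and the mean of the current factor is R; the
      -- later digits are handled by induction. Digits beyond the last edge only multiply the number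
      -- of seeds.
      Π-mean : ∀ k i σ es → length es ≤ k → BoundedConf σ → Sparse w es
        → ∑ (M ^ k) (λ s → Π i σ s es) ≡ M ^ k * R ^ length es
      Π-mean k i σ [] _ bd sp = ∑-const (M ^ k) 1
      Π-mean (suc k) i σ (e ∷ es) (s≤s len) bd (h , sp) = begin
        ∑ (M * M ^ k) F ≡⟨ cong (λ x → ∑ x F) (*-comm M (M ^ k)) ⟩
        ∑ (M ^ k * M) F ≡⟨ ∑-digits M (M ^ k) F ⟩
        ∑ M (λ r → ∑ (M ^ k) (λ q → F (q * M + r)))
          ≡⟨ ∑-cong M (λ r lt → begin
             ∑ (M ^ k) (λ q → F (q * M + r)) ≡⟨ ∑-cong (M ^ k) (λ q _ → cong₂ G (digit r q lt) (rest r q lt)) ⟩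
             ∑ (M ^ k) (λ q → G r q) ≡⟨ ∑-*ˡ (M ^ k) (Fac r) _ ⟩
             Fac r * ∑ (M ^ k) (λ q → Π i′ (gstep σ e r) q es)
               ≡⟨ cong (Fac r *_) (Π-mean k i′ (gstep σ e r) es len (gstep-bounded σ e r bd) sp) ⟩
             Fac r * (M ^ k * R ^ length es) ∎) ⟩
        ∑ M (λ r → Fac r * (M ^ k * R ^ length es)) ≡⟨ ∑-*ʳ M _ Fac ⟩
        ∑ M Fac * (M ^ k * R ^ length es) ≡⟨ cong (_* (M ^ k * R ^ length es)) facs ⟩
        M * R * (M ^ k * R ^ length es) ≡⟨ lemma M R (M ^ k) (R ^ length es) ⟩
        M * M ^ k * (R * R ^ length es) ∎
        where
        open ≡-Reasoning
        i′ = adv w i e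
        F : ℕ → ℕ
        F s = Π i σ s (e ∷ es)
        Fac : ℕ → ℕ
        Fac r = R + expected i′ (gstep σ e r) es ∸ expected i′ σ es
        G : ℕ → ℕ → ℕ
        G r q = Fac r * Π i′ (gstep σ e r) q es
        digit : ∀ r q → r < M → (q * M + r) % M ≡ r
        digit r q lt = trans (cong (_% M) (+-comm (q * M) r)) (trans ([m+kn]%n≡m%n r q M) (m<n⇒m%n≡m lt))
        rest : ∀ r q → r < M → (q * M + r) / M ≡ q
        rest r q lt = trans (+-distrib-/ (q * M) r (subst (_< M) (sym (cong₂ _+_ (m*n%n≡0 q M) (m<n⇒m%n≡m lt))) lt))
          (trans (cong₂ _+_ (m*n/n≡m q M) (m<n⇒m/n≡0 lt)) (+-identityʳ q))
        lemma : ∀ a b c d → a * b * (c * d) ≡ a * c * (b * d)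
        lemma = solve-∀
        facs : ∑ M Fac ≡ M * R
        facs = +-cancelʳ-≡ (M * expected i′ σ es) _ _ (begin
          ∑ M Fac + M * expected i′ σ es ≡⟨ cong (∑ M Fac +_) (sym (∑-const M _)) ⟩
          ∑ M Fac + ∑ M (λ _ → expected i′ σ es) ≡⟨ sym (∑-+ M _ _) ⟩
          ∑ M (λ r → Fac r + expected i′ σ es) ≡⟨ ∑-cong M (λ r _ → m∸n+n≡m (fits i′ σ e r es bd h)) ⟩
          ∑ M (λ r → R + expected i′ (gstep σ e r) es) ≡⟨ ∑-+ M _ _ ⟩
          ∑ M (λ _ → R) + ∑ M (λ r → expected i′ (gstep σ e r) es)
            ≡⟨ cong₂ _+_ (∑-const M R) (expected-mart i′ σ e es bd) ⟩
          M * R + M * expected i′ σ es ∎)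

      P>0 : 0 < P
      P>0 = *-mono-≤ p>0 (s≤s (z≤n {p}))

      instance
        P≢0 : NonZero P
        P≢0 = >-nonZero P>0

      -- In real terms Π / R^l ≥ (1 + 1/P)^(a′ - b′), where realised exceeds expected by (a′ - b′)
      -- units U plus two units per link. The pair a′, b′ represents a possibly negative exponent.
      Π-lower : ∀ i σ s es a′ b′ → BoundedConf σ → Sparse w es
        → expected i σ es + a′ * U + 2 * links w es * U ≤ realised i σ s es + b′ * U
        → R ^ length es * ((P + 1) ^ a′ * P ^ b′) ≤ Π i σ s es * (P ^ a′ * (P + 1) ^ b′)
      Π-lower i σ s [] a′ b′ bd sp h with m≤n⇒∃[o]m+o≡n (*-cancelʳ-≤ a′ b′ U (subst (_≤ b′ * U) (+-identityʳ (a′ * U)) h))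
      ... | o , refl = begin
        1 * ((P + 1) ^ a′ * P ^ (a′ + o)) ≡⟨ cong (λ x → 1 * ((P + 1) ^ a′ * x)) (^-distribˡ-+-* P a′ o) ⟩
        1 * ((P + 1) ^ a′ * (P ^ a′ * P ^ o)) ≤⟨ *-monoʳ-≤ 1 (*-monoʳ-≤ ((P + 1) ^ a′) (*-monoʳ-≤ (P ^ a′) (^-monoˡ-≤ o (m≤m+n P 1)))) ⟩
        1 * ((P + 1) ^ a′ * (P ^ a′ * (P + 1) ^ o)) ≡⟨ lemma ((P + 1) ^ a′) (P ^ a′) ((P + 1) ^ o) ⟩
        1 * (P ^ a′ * ((P + 1) ^ a′ * (P + 1) ^ o)) ≡⟨ cong (λ x → 1 * (P ^ a′ * x)) (sym (^-distribˡ-+-* (P + 1) a′ o)) ⟩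
        1 * (P ^ a′ * (P + 1) ^ (a′ + o)) ∎
        where
        open ≤-Reasoning
        lemma : ∀ a b c → 1 * (a * (b * c)) ≡ 1 * (b * (a * c))
        lemma = solve-∀
      Π-lower i σ s (e ∷ es) a′ b′ bd (h2 , sp) h = main (hits w e es) refl
        where
        open ≤-Reasoning
        i′ = adv w i e
        σ′ = gstep σ e (s % M)
        bd′ = gstep-bounded σ e (s % M) bd
        T T′ RS fac Π′ l : ℕ
        T = expected i′ σ es
        T′ = expected i′ σ′ es
        RS = realised i′ σ′ (s / M) es
        fac = R + T′ ∸ T
        Π′ = Π i′ σ′ (s / M) es
        l = length es

        h′ : T + a′ * U + 2 * (hits w e es + links w es) * U ≤ RS + b′ * U
        h′ = +-cancelˡ-≤ (row i σ e) _ _ (≤-trans (≤-reflexive (l1 (row i σ e) T (a′ * U) _))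
               (≤-trans h (≤-reflexive (+-assoc (row i σ e) RS (b′ * U)))))
          where
          l1 : ∀ r t a x → r + (t + a + x) ≡ r + t + a + x
          l1 = solve-∀

        combine : ∀ {f} u v y z .{{_ : NonZero (y * z)}} → P * z * y ≤ f * u * v → f * U ≤ fac
          → R ^ l * ((P + 1) ^ a′ * u * (P ^ b′ * v)) ≤ Π′ * (P ^ a′ * y * ((P + 1) ^ b′ * z))
          → R * R ^ l * ((P + 1) ^ a′ * P ^ b′) ≤ fac * Π′ * (P ^ a′ * (P + 1) ^ b′)
        combine {f} u v y z g f≤ ih = *-cancelʳ-≤ _ _ (y * z) (begin
          R * R ^ l * ((P + 1) ^ a′ * P ^ b′) * (y * z) ≡⟨ l1 P U (R ^ l) ((P + 1) ^ a′) (P ^ b′) y z ⟩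
          P * z * y * (U * R ^ l * (P + 1) ^ a′ * P ^ b′) ≤⟨ *-monoˡ-≤ _ g ⟩
          f * u * v * (U * R ^ l * (P + 1) ^ a′ * P ^ b′) ≡⟨ l2 f u v U (R ^ l) ((P + 1) ^ a′) (P ^ b′) ⟩
          f * U * (R ^ l * ((P + 1) ^ a′ * u * (P ^ b′ * v))) ≤⟨ *-mono-≤ f≤ ih ⟩
          fac * (Π′ * (P ^ a′ * y * ((P + 1) ^ b′ * z))) ≡⟨ l3 fac Π′ (P ^ a′) y ((P + 1) ^ b′) z ⟩
          fac * Π′ * (P ^ a′ * (P + 1) ^ b′) * (y * z) ∎)
          where
          l1 : ∀ P U r α β y z → P * U * r * (α * β) * (y * z) ≡ P * z * y * (U * r * α * β)
          l1 = solve-∀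
          l2 : ∀ f u v U r α β → f * u * v * (U * r * α * β) ≡ f * U * (r * (α * u * (β * v)))
          l2 = solve-∀
          l3 : ∀ F Q γ y δ z → F * (Q * (γ * y * (δ * z))) ≡ F * Q * (γ * δ) * (y * z)
          l3 = solve-∀

        main : ∀ k → hits w e es ≡ k
          → R * R ^ l * ((P + 1) ^ a′ * P ^ b′) ≤ fac * Π′ * (P ^ a′ * (P + 1) ^ b′)
        main zero k≡ = combine {f = P} 1 1 1 1 ≤-refl
          (≤-trans (≤-reflexive (sym (m+n∸n≡m R T′))) (∸-monoʳ-≤ (R + T′) T≤T′))
          (subst₂ _≤_ (l4 (R ^ l) ((P + 1) ^ a′) (P ^ b′)) (l4 Π′ (P ^ a′) ((P + 1) ^ b′))
            (Π-lower i′ σ′ (s / M) es a′ b′ bd′ sp (≤-trans (+-monoˡ-≤ (2 * links w es * U) (+-monoˡ-≤ (a′ * U) T′≤T))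
              (subst (λ k → T + a′ * U + 2 * (k + links w es) * U ≤ RS + b′ * U) k≡ h′))))
          where
          l4 : ∀ r α β → r * (α * β) ≡ r * (α * 1 * (β * 1))
          l4 = solve-∀
          T′≤T : T′ ≤ T
          T′≤T = subst (T′ ≤_) (trans (cong (λ k → T + k * β) k≡) (+-identityʳ T)) (expected-up i′ σ e (s % M) es bd)
          T≤T′ : T ≤ T′
          T≤T′ = subst (T ≤_) (trans (cong (λ k → T′ + k * β) k≡) (+-identityʳ T′)) (expected-down i′ σ e (s % M) es bd)
        -- The increment is K - p in units of U, rounded down, and lies between -p and p. Rounding
        -- costs one unit and the exponent k - 1 in `gain` another one, whence two units per link.
        -- Steps with no hits cost nothing, since they leave T unchanged.
        main (suc k) k≡ = combine {f = f} ((P + 1) ^ suc p) (P ^ K) (P ^ suc p) ((P + 1) ^ K)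
          {{m*n≢0 (P ^ suc p) ((P + 1) ^ K) {{m^n≢0 P (suc p)}} {{m^n≢0 (P + 1) K {{>-nonZero (≤-trans P>0 (m≤m+n P 1))}}}}}}
          (gain p K f p>0 K≤2p (sym f+p)) fU≤
          (subst₂ (λ x y → R ^ l * x ≤ Π′ * y)
            (cong₂ _*_ (^-distribˡ-+-* (P + 1) a′ (suc p)) (^-distribˡ-+-* P b′ K))
            (cong₂ _*_ (^-distribˡ-+-* P a′ (suc p)) (^-distribˡ-+-* (P + 1) b′ K))
            (Π-lower i′ σ′ (s / M) es (a′ + suc p) (b′ + K) bd′ sp hyp))
          where
          A K f : ℕ
          A = T′ + p * U ∸ T
          K = A / U
          f = P + K ∸ p
          hβ = hits*β≤ e es h2
          A+T : A + T ≡ T′ + p * U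
          A+T = m∸n+n≡m (≤-trans (expected-down i′ σ e (s % M) es bd) (+-monoʳ-≤ T′ hβ))
          A≤ : A ≤ 2 * p * U
          A≤ = +-cancelʳ-≤ T _ _ (begin
            A + T ≡⟨ A+T ⟩
            T′ + p * U ≤⟨ +-monoˡ-≤ (p * U) (≤-trans (expected-up i′ σ e (s % M) es bd) (+-monoʳ-≤ T hβ)) ⟩
            T + p * U + p * U ≡⟨ l5 T p U ⟩
            2 * p * U + T ∎)
            where
            l5 : ∀ t p u → t + p * u + p * u ≡ 2 * p * u + t
            l5 = solve-∀
          K≤2p : K ≤ 2 * p
          K≤2p = ≤-trans (/-monoˡ-≤ U A≤) (≤-reflexive (m*n/n≡m (2 * p) U))
          f+p : f + p ≡ P + K
          f+p = m∸n+n≡m (≤-trans (m≤m*n p (suc p)) (m≤m+n P K))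
          KU≤A : K * U ≤ A
          KU≤A = m/n*n≤m A U
          fU≤ : f * U ≤ fac
          fU≤ = m+n≤o⇒m≤o∸n (f * U) (+-cancelʳ-≤ (p * U) _ _ (begin
            f * U + T + p * U ≡⟨ l6 f U T p ⟩
            (f + p) * U + T ≡⟨ cong (λ x → x * U + T) f+p ⟩
            (P + K) * U + T ≡⟨ l7 P K U T ⟩
            R + (K * U + T) ≤⟨ +-monoʳ-≤ R (+-monoˡ-≤ T KU≤A) ⟩
            R + (A + T) ≡⟨ cong (R +_) A+T ⟩
            R + (T′ + p * U) ≡⟨ sym (+-assoc R T′ (p * U)) ⟩
            R + T′ + p * U ∎))
            where
            l6 : ∀ f u t p → f * u + t + p * u ≡ (f + p) * u + t
            l6 = solve-∀
            l7 : ∀ P K u t → (P + K) * u + t ≡ P * u + (K * u + t)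
            l7 = solve-∀
          hyp : T′ + (a′ + suc p) * U + 2 * links w es * U ≤ RS + (b′ + K) * U
          hyp = begin
            T′ + (a′ + suc p) * U + 2 * links w es * U ≡⟨ l8 T′ a′ p U (links w es) ⟩
            (T′ + p * U) + (a′ * U + U + 2 * links w es * U) ≡⟨ cong (_+ (a′ * U + U + 2 * links w es * U)) (sym A+T) ⟩
            (A + T) + (a′ * U + U + 2 * links w es * U)
              ≤⟨ +-monoˡ-≤ _ (+-monoˡ-≤ T (≤-trans (≤-reflexive (m≡m%n+[m/n]*n A U)) (+-monoˡ-≤ (K * U) (<⇒≤ (m%n<n A U))))) ⟩
            (U + K * U + T) + (a′ * U + U + 2 * links w es * U) ≡⟨ l9 T a′ K U (links w es) ⟩
            (T + a′ * U + 2 * (1 + links w es) * U) + K * U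
              ≤⟨ +-monoˡ-≤ (K * U) (+-monoʳ-≤ (T + a′ * U) (*-monoˡ-≤ U (*-monoʳ-≤ 2 (+-monoˡ-≤ (links w es) (s≤s (z≤n {k})))))) ⟩
            (T + a′ * U + 2 * (suc k + links w es) * U) + K * U
              ≡⟨ cong (λ k → T + a′ * U + 2 * (k + links w es) * U + K * U) (sym k≡) ⟩
            (T + a′ * U + 2 * (hits w e es + links w es) * U) + K * U ≤⟨ +-monoˡ-≤ (K * U) h′ ⟩
            RS + b′ * U + K * U ≡⟨ l10 RS b′ K U ⟩
            RS + (b′ + K) * U ∎
            where
            l8 : ∀ t a p u k → t + (a + (1 + p)) * u + 2 * k * u ≡ (t + p * u) + (a * u + u + 2 * k * u)
            l8 = solve-∀
            l9 : ∀ t a K u k → (u + K * u + t) + (a * u + u + 2 * k * u) ≡ (t + a * u + 2 * (1 + k) * u) + K * u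
            l9 = solve-∀
            l10 : ∀ r b K u → r + b * u + K * u ≡ r + (b + K) * u
            l10 = solve-∀

      exceeds : ∀ σ j s es → Dec (expected 0 σ es + j * U < realised 0 σ s es)
      exceeds σ j s es = expected 0 σ es + j * U <? realised 0 σ s es

      -- Markov's inequality for `Π`: an excess of j units forces Π ≥ R^l (1 + 1/P)^(P b) ≥ 2^b R^l,
      -- whereas its mean is R^l.
      tail-bound : ∀ k σ es j b → length es ≤ k → BoundedConf σ → Sparse w es
        → P * b + 2 * links w es ≤ j
        → ∑ (M ^ k) (λ s → ⟦ exceeds σ j s es ⟧) * 2 ^ b ≤ M ^ k
      tail-bound k σ es j b len bd sp Pb≤j = *-cancelʳ-≤ _ _ (P ^ q * R ^ l) (begin
        bad * 2 ^ b * (P ^ q * R ^ l) ≡⟨ l1 bad (2 ^ b) (P ^ q) (R ^ l) ⟩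
        2 ^ b * P ^ q * (bad * R ^ l) ≤⟨ *-monoˡ-≤ (bad * R ^ l) pw ⟩
        (P + 1) ^ q * (bad * R ^ l) ≡⟨ l2 ((P + 1) ^ q) bad (R ^ l) ⟩
        bad * (R ^ l * ((P + 1) ^ q * 1)) ≡⟨ sym (∑-*ʳ (M ^ k) _ _) ⟩
        ∑ (M ^ k) (λ s → ⟦ exceeds σ j s es ⟧ * (R ^ l * ((P + 1) ^ q * 1))) ≤⟨ ∑-mono (M ^ k) (λ s _ → pt s) ⟩
        ∑ (M ^ k) (λ s → Π 0 σ s es * (P ^ q * 1)) ≡⟨ ∑-*ʳ (M ^ k) _ _ ⟩
        ∑ (M ^ k) (λ s → Π 0 σ s es) * (P ^ q * 1) ≡⟨ cong (_* (P ^ q * 1)) (Π-mean k 0 σ es len bd sp) ⟩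
        M ^ k * R ^ l * (P ^ q * 1) ≡⟨ l3 (M ^ k) (R ^ l) (P ^ q) ⟩
        M ^ k * (P ^ q * R ^ l) ∎)
        where
        open ≤-Reasoning
        q l bad : ℕ
        q = P * b
        l = length es
        bad = ∑ (M ^ k) (λ s → ⟦ exceeds σ j s es ⟧)
        instance
          nz : NonZero (P ^ q * R ^ l)
          nz = m*n≢0 (P ^ q) (R ^ l) {{m^n≢0 P q}} {{m^n≢0 R l {{m*n≢0 P U}}}}
        l1 : ∀ a b c d → a * b * (c * d) ≡ b * c * (a * d)
        l1 = solve-∀
        l2 : ∀ a b c → a * (b * c) ≡ b * (c * (a * 1))
        l2 = solve-∀
        l3 : ∀ a b c → a * b * (c * 1) ≡ a * (c * b)
        l3 = solve-∀
        pw : 2 ^ b * P ^ q ≤ (P + 1) ^ q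
        pw = subst (λ P → 2 ^ b * P ^ (P * b) ≤ (P + 1) ^ (P * b)) (suc-pred P) (double^≤pow (pred P) b)
        pt : ∀ s → ⟦ exceeds σ j s es ⟧ * (R ^ l * ((P + 1) ^ q * 1)) ≤ Π 0 σ s es * (P ^ q * 1)
        pt s with exceeds σ j s es
        ... | no _ = z≤n
        ... | yes lt = ≤-trans (≤-reflexive (*-identityˡ _)) (Π-lower 0 σ s es q 0 bd sp (begin
          expected 0 σ es + q * U + 2 * links w es * U ≡⟨ l4 (expected 0 σ es) q U (links w es) ⟩
          expected 0 σ es + (q + 2 * links w es) * U ≤⟨ +-monoʳ-≤ (expected 0 σ es) (*-monoˡ-≤ U Pb≤j) ⟩
          expected 0 σ es + j * U ≤⟨ <⇒≤ lt ⟩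
          realised 0 σ s es ≡⟨ sym (+-identityʳ _) ⟩
          realised 0 σ s es + 0 * U ∎))
          where
          l4 : ∀ t q u k → t + q * u + 2 * k * u ≡ t + (q + 2 * k) * u
          l4 = solve-∀

-- Analysis at one vertex

private
  sq-bound : ∀ M y x → y * M ≤ x → y * y * (M * M) ≤ x * x
  sq-bound M y x h = subst (_≤ x * x) (lemma y M) (*-mono-≤ h h)
    where
    lemma : ∀ y m → y * m * (y * m) ≡ y * y * (m * m)
    lemma = solve-∀

-- In real terms: x (1 - l) ≤ 1 is preserved by x ↦ x + y² k, l ↦ l + k when y ≤ x.
upper-update : ∀ J M x y k l → .{{_ : NonZero M}} → y * M ≤ x → l ≤ M → x * M ≤ J * M * M + x * l
  → (x + y * (y * k)) * M ≤ J * M * M + (x + y * (y * k)) * (l + J * k)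
upper-update J M x y k l yM≤x l≤M ih with m≤n⇒∃[o]m+o≡n l≤M
... | q , refl = begin
    (x + y * (y * k)) * (l + q) ≡⟨ l1 x y k l q ⟩
    x * (l + q) + y * y * k * l + k * (y * y * q) ≤⟨ +-mono-≤ (+-monoˡ-≤ (y * y * k * l) ih) (*-monoʳ-≤ k yyq) ⟩
    J * (l + q) * (l + q) + x * l + y * y * k * l + k * (x * J)
      ≤⟨ ≤-by (y * (y * k) * (J * k)) (l2 J l q x y k) ⟩
    J * (l + q) * (l + q) + (x + y * (y * k)) * (l + J * k) ∎
  where
  open ≤-Reasoning
  M′ = l + q
  l1 : ∀ x y k l q → (x + y * (y * k)) * (l + q) ≡ x * (l + q) + y * y * k * l + k * (y * y * q)
  l1 = solve-∀
  l2 : ∀ J l q x y k → J * (l + q) * (l + q) + x * l + y * y * k * l + k * (x * J) + y * (y * k) * (J * k)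
     ≡ J * (l + q) * (l + q) + (x + y * (y * k)) * (l + J * k)
  l2 = solve-∀
  xq : x * q ≤ J * M′ * M′
  xq = +-cancelʳ-≤ (x * l) _ _ (≤-trans (≤-reflexive (l3 x q l)) ih)
    where
    l3 : ∀ x q l → x * q + x * l ≡ x * (l + q)
    l3 = solve-∀
  yyq : y * y * q ≤ x * J
  yyq = *-cancelʳ-≤ _ _ (M′ * M′) {{m*n≢0 M′ M′}} (begin
    y * y * q * (M′ * M′) ≡⟨ l4 y q (M′ * M′) ⟩
    y * y * (M′ * M′) * q ≤⟨ *-monoˡ-≤ q (sq-bound M′ y x yM≤x) ⟩
    x * x * q ≡⟨ *-assoc x x q ⟩
    x * (x * q) ≤⟨ *-monoʳ-≤ x xq ⟩
    x * (J * M′ * M′) ≡⟨ l5 x J M′ ⟩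
    x * J * (M′ * M′) ∎)
    where
    l4 : ∀ y q m → y * y * q * m ≡ y * y * m * q
    l4 = solve-∀
    l5 : ∀ x J m → x * (J * m * m) ≡ x * J * (m * m)
    l5 = solve-∀

-- In real terms: x (1 - (1 - 1/(e+1)) l) ≥ 1 is preserved when y is x rounded down to the grid.
lower-update : ∀ e e₁ J M x y k l → .{{_ : NonZero M}} → e₁ ≡ suc e → J ≡ 4 * e₁
  → y * M ≤ x → x ≤ (y + 1) * M → J ≤ y → l ≤ M → 2 * (y * (e * k)) ≤ M
  → e₁ * J * M * M + e * x * l ≤ x * e₁ * M
  → e₁ * J * M * M + e * (x + y * (y * k)) * (l + J * k) ≤ (x + y * (y * k)) * e₁ * M
lower-update e _ _ M x y k l refl refl yM≤x x≤ J≤y l≤M small ih with m≤n⇒∃[o]m+o≡n l≤M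
... | q , refl = begin
    suc e * J * M′ * M′ + e * (x + y * (y * k)) * (l + J * k) ≡⟨ l1 e J (l + q) x y k l ⟩
    (suc e * J * M′ * M′ + e * x * l) + k * (e * x * J + y * y * e * (l + J * k)) ≤⟨ +-mono-≤ ih (*-monoʳ-≤ k key) ⟩
    x * suc e * M′ + k * (y * y * (suc e * M′)) ≡⟨ l2 x e M′ k y ⟩
    (x + y * (y * k)) * suc e * M′ ∎
  where
  open ≤-Reasoning
  M′ = l + q
  J = 4 * suc e
  l1 : ∀ e J m x y k l → (1 + e) * J * m * m + e * (x + y * (y * k)) * (l + J * k)
     ≡ ((1 + e) * J * m * m + e * x * l) + k * (e * x * J + y * y * e * (l + J * k))
  l1 = solve-∀
  l2 : ∀ x e m k y → x * (1 + e) * m + k * (y * y * ((1 + e) * m)) ≡ (x + y * (y * k)) * (1 + e) * m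
  l2 = solve-∀
  w = e * q + M′
  xw : suc e * J * M′ * M′ ≤ x * w
  xw = +-cancelʳ-≤ (e * x * l) _ _ (≤-trans ih (≤-reflexive (l3 x e l q)))
    where
    l3 : ∀ x e l q → x * (1 + e) * (l + q) ≡ x * (e * q + (l + q)) + e * x * l
    l3 = solve-∀
  Jx≤ : J * x ≤ (J + 1) * (y * M′)
  Jx≤ = begin
    J * x ≤⟨ *-monoʳ-≤ J x≤ ⟩
    J * ((y + 1) * M′) ≡⟨ l3 J y M′ ⟩
    J * (y * M′) + J * M′ ≤⟨ +-monoʳ-≤ (J * (y * M′)) (*-monoˡ-≤ M′ J≤y) ⟩
    J * (y * M′) + y * M′ ≡⟨ l4 J (y * M′) ⟩
    (J + 1) * (y * M′) ∎
    where
    l3 : ∀ J y m → J * ((y + 1) * m) ≡ J * (y * m) + J * m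
    l3 = solve-∀
    l4 : ∀ J a → J * a + a ≡ (J + 1) * a
    l4 = solve-∀
  -- (J - 2) (J + 1)² ≤ J³ with J - 2 = 4 e + 2.
  yyw : x * (suc e * (4 * e + 2)) ≤ y * y * w
  yyw = *-cancelʳ-≤ _ _ ((J + 1) * (J + 1) * (M′ * M′)) {{m*n≢0 ((J + 1) * (J + 1)) (M′ * M′) {{_}} {{m*n≢0 M′ M′}}}} (begin
    x * (suc e * (4 * e + 2)) * ((J + 1) * (J + 1) * (M′ * M′)) ≤⟨ ≤-by (x * suc e * (M′ * M′) * (12 * e + 14)) (l5 x e M′) ⟩
    J * J * x * (suc e * J * M′ * M′) ≤⟨ *-monoʳ-≤ (J * J * x) xw ⟩
    J * J * x * (x * w) ≡⟨ l6 J x w ⟩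
    J * x * (J * x) * w ≤⟨ *-monoˡ-≤ w (*-mono-≤ Jx≤ Jx≤) ⟩
    (J + 1) * (y * M′) * ((J + 1) * (y * M′)) * w ≡⟨ l7 (J + 1) y M′ w ⟩
    y * y * w * ((J + 1) * (J + 1) * (M′ * M′)) ∎)
    where
    l5 : ∀ x e m → x * ((1 + e) * (4 * e + 2)) * ((4 * (1 + e) + 1) * (4 * (1 + e) + 1) * (m * m)) + x * (1 + e) * (m * m) * (12 * e + 14)
       ≡ 4 * (1 + e) * (4 * (1 + e)) * x * ((1 + e) * (4 * (1 + e)) * m * m)
    l5 = solve-∀
    l6 : ∀ J x w → J * J * x * (x * w) ≡ J * x * (J * x) * w
    l6 = solve-∀
    l7 : ∀ a y m w → a * (y * m) * (a * (y * m)) * w ≡ y * y * w * (a * a * (m * m))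
    l7 = solve-∀
  yyk : y * y * e * (J * k) ≤ x * (2 * suc e)
  yyk = *-cancelʳ-≤ _ _ M′ (begin
    y * y * e * (J * k) * M′ ≡⟨ l3 y e k M′ ⟩
    y * M′ * ((2 * suc e) * (2 * (y * (e * k)))) ≤⟨ *-mono-≤ yM≤x (*-monoʳ-≤ (2 * suc e) small) ⟩
    x * ((2 * suc e) * M′) ≡⟨ sym (*-assoc x (2 * suc e) M′) ⟩
    x * (2 * suc e) * M′ ∎)
    where
    l3 : ∀ y e k m → y * y * e * (4 * (1 + e) * k) * m ≡ y * m * ((2 * (1 + e)) * (2 * (y * (e * k))))
    l3 = solve-∀
  key : e * x * J + y * y * e * (l + J * k) ≤ y * y * (suc e * M′)
  key = begin
    e * x * J + y * y * e * (l + J * k) ≡⟨ l3 e x J y l k ⟩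
    y * y * e * l + (e * x * J + y * y * e * (J * k)) ≤⟨ +-monoʳ-≤ (y * y * e * l) (+-monoʳ-≤ (e * x * J) yyk) ⟩
    y * y * e * l + (e * x * J + x * (2 * suc e)) ≡⟨ cong (y * y * e * l +_) (l4 e x) ⟩
    y * y * e * l + x * (suc e * (4 * e + 2)) ≤⟨ +-monoʳ-≤ (y * y * e * l) yyw ⟩
    y * y * e * l + y * y * w ≡⟨ l5 y e l q ⟩
    y * y * (suc e * M′) ∎
    where
    l3 : ∀ e x J y l k → e * x * J + y * y * e * (l + J * k) ≡ y * y * e * l + (e * x * J + y * y * e * (J * k))
    l3 = solve-∀
    l4 : ∀ e x → e * x * (4 * (1 + e)) + x * (2 * (1 + e)) ≡ x * ((1 + e) * (4 * e + 2))
    l4 = solve-∀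
    l5 : ∀ y e l q → y * y * e * l + y * y * (e * q + (l + q)) ≡ y * y * ((1 + e) * (l + q))
    l5 = solve-∀

-- The values are pinned by equations so that the algebra below can treat them as variables. There
-- are D = 16 G² t colours for at most 16 G g t edges at a vertex, and an edge is sampled if N ≥ Dh
-- = D - 16 G t in units of J². The 4 in G leaves 1 - λ ≥ 3/G, of which 1/G is reserved for the
-- discarding threshold 1/E. The deviation allowed in a test is τ, in units of M J.
record Params : Set where
  field
    g t e e₁ J τ M G D E Dh : ℕ
    g>0 : 0 < g
    t>0 : 0 < t
    M>0 : 0 < M
    G≡ : G ≡ g + 4
    E≡ : E ≡ 16 * (G * G)
    D≡ : D ≡ E * t
    e₁≡suc : e₁ ≡ suc e
    J≡ : J ≡ 4 * e₁
    e≡ : e₁ ≡ 16 * (G * (G * G))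
    Dh≡ : Dh ≡ 16 * (G * ((g + 3) * t))
    τ≤ : 8 * (G * G) * τ ≤ t * t
    t≥ : 4 * (G * G * G * G * G) ≤ t

    M-div : ∀ N → 0 < N → N ≤ D * (J * G * (J * G)) → N ∣ M

  B thr Ymax : ℕ
  Ymax = J * G
  B = M * Ymax
  thr = J * J * Dh

  instance
    M≢0 : NonZero M
    M≢0 = >-nonZero M>0

  open Dynamics D J E B thr M public

  G>0 : 0 < G
  G>0 = subst (0 <_) (sym G≡) (≤-trans (s≤s z≤n) (m≤n+m 4 g))

  instance
    G≢0 : NonZero G
    G≢0 = >-nonZero G>0
    t≢0 : NonZero t
    t≢0 = >-nonZero t>0

  E≢0 : NonZero E
  E≢0 = subst NonZero (sym E≡) (m*n≢0 16 (G * G) {{_}} {{m*n≢0 G G}})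

  Dh>0 : 0 < Dh
  Dh>0 = subst (0 <_) (sym Dh≡) (*-mono-≤ {1} {16} (s≤s z≤n) (*-mono-≤ G>0 (*-mono-≤ (≤-trans (s≤s z≤n) (m≤n+m 3 g)) t>0)))

  instance
    Dh≢0 : NonZero Dh
    Dh≢0 = >-nonZero Dh>0

  J>0 : 0 < J
  J>0 = subst (0 <_) (sym (trans J≡ (cong (4 *_) e₁≡suc))) (s≤s z≤n)

  instance
    J≢0 : NonZero J
    J≢0 = >-nonZero J>0

  G≤E : G ≤ E
  G≤E = subst (G ≤_) (sym E≡) (≤-trans (m≤m*n G G) (m≤n*m (G * G) 16))

  private
    16Gt≤Dh : ∀ k → k ≤ 16 * (G * t) → k ≤ Dh
    16Gt≤Dh k h = ≤-trans h (subst (16 * (G * t) ≤_) (sym Dh≡)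
      (*-monoʳ-≤ 16 (*-monoʳ-≤ G (m≤n*m t (g + 3) {{>-nonZero (≤-trans (s≤s z≤n) (m≤n+m 3 g))}}))))

  -- Ensures that the gain of a weight in one step is at most M, a single cell of the grid. This is
  -- the origin of the requirement `t≥`.
  JGGG≤Dh : J * (G * (G * G)) ≤ Dh
  JGGG≤Dh = 16Gt≤Dh _ (begin
    J * (G * (G * G)) ≡⟨ cong (_* (G * (G * G))) (trans J≡ (cong (4 *_) e≡)) ⟩
    4 * (16 * (G * (G * G))) * (G * (G * G)) ≡⟨ lemma G ⟩
    16 * (G * (4 * (G * G * G * G * G))) ≤⟨ *-monoʳ-≤ 16 (*-monoʳ-≤ G t≥) ⟩
    16 * (G * t) ∎)
    where
    open ≤-Reasoning
    lemma : ∀ G → 4 * (16 * (G * (G * G))) * (G * (G * G)) ≡ 16 * (G * (4 * (G * G * G * G * G)))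
    lemma = solve-∀

  2eGG≤Dh : 2 * e * (G * G) ≤ Dh
  2eGG≤Dh = begin
    2 * e * (G * G) ≤⟨ *-mono-≤ (≤-trans (*-mono-≤ {2} {4} (s≤s (s≤s z≤n)) (≤-trans (n≤1+n e) (≤-reflexive (sym e₁≡suc)))) (≤-reflexive (sym J≡))) (m≤n*m (G * G) G) ⟩
    J * (G * (G * G)) ≤⟨ JGGG≤Dh ⟩
    Dh ∎
    where open ≤-Reasoning

  initial : Local
  initial = mkLocal (λ _ → M * J) (λ _ → 0) (λ _ → active) 0

  rate-bound : ∀ N → J * J * Dh * rate N ≤ M
  rate-bound zero = subst (_≤ M) (sym (*-zeroʳ (J * J * Dh))) z≤n
  rate-bound N@(suc _) with N <? thr
  ... | yes _ = subst (_≤ M) (sym (*-zeroʳ (J * J * Dh))) z≤n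
  ... | no N≥ = ≤-trans (*-monoˡ-≤ (M / N) (≮⇒≥ N≥))
                  (subst (_≤ M) (*-comm (M / N) N) (m/n*n≤m M N))

  rate-exact : ∀ N → N ≤ D * (Ymax * Ymax) → 0 < rate N → N * rate N ≡ M
  rate-exact N@(suc _) N≤ pos with N <? thr
  ... | no _ = trans (*-comm N (M / N)) (m/n*n≡m (M-div N (s≤s z≤n) N≤))

  rate-pos : ∀ N → N ≤ D * (Ymax * Ymax) → 0 < N → thr ≤ N → 0 < rate N
  rate-pos N@(suc _) N≤ _ thr≤ with N <? thr
  ... | yes p = contradiction thr≤ (<⇒≱ p)
  ... | no _ = n≢0⇒n>0 λ z → >⇒≢ M>0 (trans (sym (m/n*n≡m (M-div N (s≤s z≤n) N≤))) (cong (_* N) z))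

  initial-bounded : Bounded initial
  initial-bounded c _ = *-monoʳ-≤ M (m≤m*n J G)

  Y≤Ymax : ∀ u → Bounded u → ∀ c → c < D → Y u c ≤ Ymax
  Y≤Ymax u bd c c<D = *-cancelˡ-≤ M (≤-trans (M*Y≤X u c) (bd c c<D))

  common≤ : ∀ u v → Bounded u → Bounded v → common u v ≤ D * (Ymax * Ymax)
  common≤ u v bu bv = subst (common u v ≤_) (∑-const D (Ymax * Ymax))
    (∑-mono D (λ c lt → *-mono-≤ (Y≤Ymax u bu c lt) (Y≤Ymax v bv c lt)))

data Transition {P Q : Set} : Status → Status → Set where
  stay : ∀ s → s ≢ active → Transition s s
  keep : ¬ P → ¬ Q → Transition active active
  use  : P → Transition active used
  kill : ¬ P → Q → Transition active killed

next-view : ∀ s {P Q : Set} (p : Dec P) (q : Dec Q) → Transition {P} {Q} s (next s p q)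
next-view active (yes p) q = use p
next-view active (no ¬p) (yes q) = kill ¬p q
next-view active (no ¬p) (no ¬q) = keep ¬p ¬q
next-view used p q = stay used λ ()
next-view killed p q = stay killed λ ()

-- The run as experienced by one vertex: row i is its i-th edge and z i the state of the partner at
-- that time. The partners are merely bounded, which makes the analysis deterministic; all
-- probability enters later through `TestUp` and `TestDown`.
record Trajectory (p : Params) (n : ℕ) : Set where
  open Params p
  field
    u z : ℕ → Local
    r : ℕ → ℕ
    u-initial : u 0 ≡ initial
    u-step : ∀ i → i < n → u (suc i) ≡ step (u i) (z i) (r i)
    r<M : ∀ i → i < n → r i < M
    z-bounded : ∀ i → i < n → Bounded (z i)
    rows≤ : n ≤ 16 * (G * (g * t))

  m ch : ℕ → ℕ
  m i = rate (common (u i) (z i))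
  ch i = choice (u i) (z i) (r i)

  u-bounded : ∀ i → i ≤ n → Bounded (u i)
  u-bounded zero _ = subst Bounded (sym u-initial) initial-bounded
  u-bounded (suc i) lt = subst Bounded (sym (u-step i lt)) (step-bounded (u i) (z i) (r i) (u-bounded i (<⇒≤ lt)))

  Λ-suc : ∀ i → i < n → Λ (u (suc i)) ≡ Λ (u i) + J * J * m i
  Λ-suc i lt = cong Λ (u-step i lt)

  L-suc : ∀ i c → i < n → L (u (suc i)) c ≡ L (u i) c + J * Y (z i) c * m i
  L-suc i c lt = cong (λ v → L v c) (u-step i lt)

  X-suc : ∀ i c → i < n → X (u (suc i)) c
    ≡ X (u i) c + Y (u i) c * (Y (u i) c * Y (z i) c * m i) ∸ ⟦ c ≟ ch i ⟧ * (M * Y (u i) c)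
  X-suc i c lt = cong (λ v → X v c) (u-step i lt)

  Killing : ℕ → ℕ → Set
  Killing i c = E * (Λ (u i) + J * J * m i) + M < E * (L (u i) c + J * Y (z i) c * m i)

  st-suc : ∀ i c → i < n → Transition {c ≡ ch i} {Killing i c} (st (u i) c) (st (u (suc i)) c)
  st-suc i c lt = subst (Transition (st (u i) c)) (sym (cong (λ v → st v c) (u-step i lt)))
    (next-view (st (u i) c) (c ≟ ch i) (kill? (L (u i) c + J * Y (z i) c * m i) (Λ (u i) + J * J * m i)))

  Λ-sum : ∀ i → i ≤ n → Λ (u i) ≡ ∑ i (λ j → J * J * m j)
  Λ-sum zero _ = cong Λ u-initial
  Λ-sum (suc i) lt = trans (Λ-suc i lt) (cong (_+ J * J * m i) (Λ-sum i (<⇒≤ lt)))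

  L-sum : ∀ i c → i ≤ n → L (u i) c ≡ ∑ i (λ j → J * Y (z j) c * m j)
  L-sum zero c _ = cong (λ v → L v c) u-initial
  L-sum (suc i) c lt = trans (L-suc i c lt) (cong (_+ J * Y (z i) c * m i) (L-sum i c (<⇒≤ lt)))

  m-bound : ∀ i → J * J * Dh * m i ≤ M
  m-bound i = rate-bound (common (u i) (z i))

  Λ-bound : ∀ i → i ≤ n → Λ (u i) * Dh ≤ i * M
  Λ-bound zero _ = subst (λ v → Λ v * Dh ≤ 0) (sym u-initial) z≤n
  Λ-bound (suc i) lt = begin
    Λ (u (suc i)) * Dh ≡⟨ cong (_* Dh) (Λ-suc i lt) ⟩
    (Λ (u i) + J * J * m i) * Dh ≡⟨ lemma (Λ (u i)) J (m i) Dh ⟩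
    J * J * Dh * m i + Λ (u i) * Dh ≤⟨ +-mono-≤ (m-bound i) (Λ-bound i (<⇒≤ lt)) ⟩
    M + i * M ∎
    where
    open ≤-Reasoning
    lemma : ∀ l j m d → (l + j * j * m) * d ≡ j * j * d * m + l * d
    lemma = solve-∀

  -- A sampled row has N ≥ `thr` and adds at most 1 / Dh to λ, so λ is at most the number of rows
  -- over Dh, hence at most g / (g + 3).
  Λ-ratio : ∀ i → i ≤ n → (g + 3) * Λ (u i) ≤ g * M
  Λ-ratio i i≤n = *-cancelʳ-≤ _ _ Dh (begin
    (g + 3) * Λ (u i) * Dh ≡⟨ *-assoc (g + 3) (Λ (u i)) Dh ⟩
    (g + 3) * (Λ (u i) * Dh) ≤⟨ *-monoʳ-≤ (g + 3) (≤-trans (Λ-bound i i≤n) (*-monoˡ-≤ M (≤-trans i≤n rows≤))) ⟩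
    (g + 3) * (16 * (G * (g * t)) * M) ≡⟨ lemma g G t M ⟩
    g * M * (16 * (G * ((g + 3) * t))) ≡⟨ cong (g * M *_) (sym Dh≡) ⟩
    g * M * Dh ∎)
    where
    open ≤-Reasoning
    lemma : ∀ g G t M → (g + 3) * (16 * (G * (g * t)) * M) ≡ g * M * (16 * (G * ((g + 3) * t)))
    lemma = solve-∀

  Λ≤M : ∀ i → i ≤ n → Λ (u i) ≤ M
  Λ≤M i i≤n = *-cancelˡ-≤ (g + 3) {{>-nonZero (≤-trans (s≤s z≤n) (m≤n+m 3 g))}}
    (≤-trans (Λ-ratio i i≤n) (*-monoˡ-≤ M (m≤m+n g 3)))

  -- In real terms: l ≤ λ + 1/E, x (1 - l) ≤ 1, x (1 - (e / e₁) l) ≥ 1 and x ≥ 1. The factor e / e₁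
  -- pays for rounding x down to the grid.
  record Active (i c : ℕ) : Set where
    field
      over  : E * L (u i) c ≤ E * Λ (u i) + M
      upper : X (u i) c * M ≤ J * M * M + X (u i) c * L (u i) c
      lower : e₁ * J * M * M + e * X (u i) c * L (u i) c ≤ X (u i) c * e₁ * M
      floor : M * J ≤ X (u i) c

    GL : i ≤ n → G * L (u i) c + 2 * M ≤ G * M
    GL i≤n = *-cancelˡ-≤ E {{E≢0}} (begin
      E * (G * L (u i) c + 2 * M) ≡⟨ l1 E G (L (u i) c) M ⟩
      G * (E * L (u i) c) + E * (2 * M) ≤⟨ +-monoˡ-≤ _ (*-monoʳ-≤ G over) ⟩
      G * (E * Λ (u i) + M) + E * (2 * M) ≡⟨ l2 G E (Λ (u i)) M ⟩
      E * (G * Λ (u i) + 2 * M) + G * M ≤⟨ +-monoʳ-≤ _ (*-monoˡ-≤ M G≤E) ⟩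
      E * (G * Λ (u i) + 2 * M) + E * M ≡⟨ l3 E (G * Λ (u i)) M ⟩
      E * (G * Λ (u i) + 3 * M) ≤⟨ *-monoʳ-≤ E GΛ ⟩
      E * (G * M) ∎)
      where
      open ≤-Reasoning
      l1 : ∀ E G L M → E * (G * L + 2 * M) ≡ G * (E * L) + E * (2 * M)
      l1 = solve-∀
      l2 : ∀ G E Λ M → G * (E * Λ + M) + E * (2 * M) ≡ E * (G * Λ + 2 * M) + G * M
      l2 = solve-∀
      l3 : ∀ E a M → E * (a + 2 * M) + E * M ≡ E * (a + 3 * M)
      l3 = solve-∀
      GΛ : G * Λ (u i) + 3 * M ≤ G * M
      GΛ = begin
        G * Λ (u i) + 3 * M ≡⟨ cong (λ G → G * Λ (u i) + 3 * M) G≡ ⟩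
        (g + 4) * Λ (u i) + 3 * M ≡⟨ l4 g (Λ (u i)) M ⟩
        (g + 3) * Λ (u i) + (Λ (u i) + 3 * M) ≤⟨ +-mono-≤ (Λ-ratio i i≤n) (+-monoˡ-≤ (3 * M) (Λ≤M i i≤n)) ⟩
        g * M + (M + 3 * M) ≡⟨ l5 g M ⟩
        (g + 4) * M ≡⟨ cong (_* M) (sym G≡) ⟩
        G * M ∎
        where
        l4 : ∀ g l M → (g + 4) * l + 3 * M ≡ (g + 3) * l + (l + 3 * M)
        l4 = solve-∀
        l5 : ∀ g M → g * M + (M + 3 * M) ≡ (g + 4) * M
        l5 = solve-∀

    L≤M : i ≤ n → L (u i) c ≤ M
    L≤M i≤n = *-cancelˡ-≤ G (≤-trans (m≤m+n _ (2 * M)) (GL i≤n))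

    -- By `GL` 1 - l ≥ 2/G, so x ≤ 1 / (1 - l) ≤ G / 2. Thus an active colour takes part in the
    -- sampling with its full rounded weight.
    2X≤B : i ≤ n → 2 * X (u i) c ≤ B
    2X≤B i≤n = halve (m≤n⇒∃[o]m+o≡n (L≤M i≤n))
      where
      open ≤-Reasoning
      x = X (u i) c
      l1 : ∀ x M → 2 * x * M ≡ x * (2 * M)
      l1 = solve-∀
      l2 : ∀ x G q → x * (G * q) ≡ G * (x * q)
      l2 = solve-∀
      l3 : ∀ G J M → G * (J * M * M) ≡ M * (J * G) * M
      l3 = solve-∀
      halve : (∃ λ q → L (u i) c + q ≡ M) → 2 * x ≤ B
      halve (q , l+q≡M) = *-cancelʳ-≤ _ _ M (begin
        2 * x * M ≡⟨ l1 x M ⟩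
        x * (2 * M) ≤⟨ *-monoʳ-≤ x 2M≤Gq ⟩
        x * (G * q) ≡⟨ l2 x G q ⟩
        G * (x * q) ≤⟨ *-monoʳ-≤ G xq ⟩
        G * (J * M * M) ≡⟨ l3 G J M ⟩
        M * (J * G) * M ∎)
        where
        2M≤Gq : 2 * M ≤ G * q
        2M≤Gq = +-cancelˡ-≤ (G * L (u i) c) _ _ (≤-trans (GL i≤n)
          (≤-reflexive (trans (cong (G *_) (sym l+q≡M)) (*-distribˡ-+ G (L (u i) c) q))))
        xq : x * q ≤ J * M * M
        xq = +-cancelʳ-≤ (x * L (u i) c) _ _ (≤-trans (≤-reflexive
          (trans (sym (*-distribˡ-+ x q (L (u i) c))) (cong (x *_) (trans (+-comm q _) l+q≡M)))) upper)

  weight-active : ∀ x → 2 * x ≤ B → weight active x ≡ x / M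
  weight-active x h with 2 * x ≤? B
  ... | yes _ = refl
  ... | no ¬h = contradiction h ¬h

  Y-active : ∀ i c → i ≤ n → st (u i) c ≡ active → Active i c → Y (u i) c ≡ X (u i) c / M
  Y-active i c i≤n s a = trans (cong (λ s → weight s (X (u i) c)) s) (weight-active _ (Active.2X≤B a i≤n))

  Y*M≤X : ∀ i c → Y (u i) c * M ≤ X (u i) c
  Y*M≤X i c = subst (_≤ X (u i) c) (*-comm M _) (M*Y≤X (u i) c)

  X≤Y+1 : ∀ i c → i ≤ n → st (u i) c ≡ active → Active i c → X (u i) c ≤ (Y (u i) c + 1) * M
  X≤Y+1 i c i≤n s a = begin
    X (u i) c ≡⟨ m≡m%n+[m/n]*n (X (u i) c) M ⟩
    X (u i) c % M + X (u i) c / M * M ≤⟨ +-monoˡ-≤ _ (<⇒≤ (m%n<n (X (u i) c) M)) ⟩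
    M + X (u i) c / M * M ≡⟨ lemma M (X (u i) c / M) ⟩
    (X (u i) c / M + 1) * M ≡⟨ cong (λ y → (y + 1) * M) (sym (Y-active i c i≤n s a)) ⟩
    (Y (u i) c + 1) * M ∎
    where
    open ≤-Reasoning
    lemma : ∀ M a → M + a * M ≡ (a + 1) * M
    lemma = solve-∀

  J≤Y : ∀ i c → i ≤ n → st (u i) c ≡ active → Active i c → J ≤ Y (u i) c
  J≤Y i c i≤n s a = subst (J ≤_) (sym (Y-active i c i≤n s a))
    (subst (_≤ X (u i) c / M) (trans (cong (_/ M) (*-comm M J)) (m*n/n≡m J M)) (/-monoˡ-≤ M (Active.floor a)))

  X-keep : ∀ i c → i < n → c ≢ ch i → X (u (suc i)) c ≡ X (u i) c + Y (u i) c * (Y (u i) c * (Y (z i) c * m i))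
  X-keep i c lt c≢ = trans (X-suc i c lt) (trans
    (cong (λ k → X (u i) c + Y (u i) c * (Y (u i) c * Y (z i) c * m i) ∸ k * (M * Y (u i) c)) (⟦⟧-no (c ≟ ch i) c≢))
    (cong (λ k → X (u i) c + Y (u i) c * k) (*-assoc (Y (u i) c) (Y (z i) c) (m i))))

  active-inv : ∀ i c → i ≤ n → c < D → st (u i) c ≡ active → Active i c
  active-inv zero c _ _ _ = base
    where
    base : Active 0 c
    base = record
      { over = ≤-trans (≤-reflexive (trans (cong (λ v → E * L v c) u-initial) (*-zeroʳ E))) z≤n
      ; upper = ≤-trans (≤-reflexive (trans (cong (λ v → X v c * M) u-initial) (cong (_* M) (*-comm M J)))) (m≤m+n _ _)
      ; lower = ≤-reflexive (trans (cong₂ (λ x l → e₁ * J * M * M + e * x * l) X0 (cong (λ v → L v c) u-initial))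
                  (trans (lemma e e₁ J M) (cong (λ x → x * e₁ * M) (sym X0))))
      ; floor = ≤-reflexive (sym X0)
      }
      where
      X0 : X (u 0) c ≡ M * J
      X0 = cong (λ v → X v c) u-initial
      lemma : ∀ e e₁ J M → e₁ * J * M * M + e * (M * J) * 0 ≡ M * J * e₁ * M
      lemma = solve-∀
  active-inv (suc i) c lt c<D s with st (u i) c in eq | st (u (suc i)) c | st-suc i c lt
  active-inv (suc i) c lt c<D refl | active | active | stay _ s≢ = contradiction refl s≢
  active-inv (suc i) c lt c<D refl | active | active | keep c≢ ¬k = record
      { over = subst₂ (λ l λ′ → E * l ≤ E * λ′ + M) (sym (L-suc i c lt)) (sym (Λ-suc i lt)) (≮⇒≥ ¬k)
      ; upper = subst₂ (λ x l → x * M ≤ J * M * M + x * l) (sym X′) (sym L′)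
          (upper-update J M x y k (L (u i) c) (Y*M≤X i c) (A.L≤M i≤n) A.upper)
      ; lower = subst₂ (λ x l → e₁ * J * M * M + e * x * l ≤ x * e₁ * M) (sym X′) (sym L′)
          (lower-update e e₁ J M x y k (L (u i) c) e₁≡suc J≡ (Y*M≤X i c) (X≤Y+1 i c i≤n eq a) (J≤Y i c i≤n eq a)
            (A.L≤M i≤n) small A.lower)
      ; floor = ≤-trans A.floor (subst (X (u i) c ≤_) (sym X′) (m≤m+n _ _))
      }
      where
      i≤n = <⇒≤ lt
      a = active-inv i c i≤n c<D eq
      module A = Active a
      x y k : ℕ
      x = X (u i) c
      y = Y (u i) c
      k = Y (z i) c * m i
      X′ : X (u (suc i)) c ≡ x + y * (y * k)
      X′ = X-keep i c lt c≢
      L′ : L (u (suc i)) c ≡ L (u i) c + J * k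
      L′ = trans (L-suc i c lt) (cong (L (u i) c +_) (*-assoc J (Y (z i) c) (m i)))
      small : 2 * (y * (e * k)) ≤ M
      small = begin
        2 * (y * (e * (Y (z i) c * m i))) ≤⟨ *-monoʳ-≤ 2 (*-mono-≤ (Y≤Ymax (u i) (u-bounded i i≤n) c c<D)
             (*-monoʳ-≤ e (*-monoˡ-≤ (m i) (Y≤Ymax (z i) (z-bounded i lt) c c<D)))) ⟩
        2 * (J * G * (e * (J * G * m i))) ≡⟨ l1 J G e (m i) ⟩
        J * J * (2 * e * (G * G)) * m i ≤⟨ *-monoˡ-≤ (m i) (*-monoʳ-≤ (J * J) 2eGG≤Dh) ⟩
        J * J * Dh * m i ≤⟨ m-bound i ⟩
        M ∎
        where
        open ≤-Reasoning
        l1 : ∀ J G e m → 2 * (J * G * (e * (J * G * m))) ≡ J * J * (2 * e * (G * G)) * m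
        l1 = solve-∀

-- Used and discarded colours, and the weight lost to rounding

isActive isUsed isKilled : Status → ℕ
isActive active = 1
isActive _ = 0
isUsed used = 1
isUsed _ = 0
isKilled killed = 1
isKilled _ = 0

status-total : ∀ s → isActive s + isUsed s + isKilled s ≡ 1
status-total active = refl
status-total used = refl
status-total killed = refl

box : ℕ → ℕ → ℕ → ℕ
box lo hi i = ⟦ lo ≤? i ⟧ * ⟦ i <? hi ⟧

box≤1 : ∀ lo hi i → box lo hi i ≤ 1
box≤1 lo hi i = *-mono-≤ (⟦⟧≤1 (lo ≤? i)) (⟦⟧≤1 (i <? hi))

box-in : ∀ lo hi i → lo ≤ i → i < hi → box lo hi i ≡ 1
box-in lo hi i p q = cong₂ _*_ (⟦⟧-yes (lo ≤? i) p) (⟦⟧-yes (i <? hi) q)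

box-≥ : ∀ lo hi i → hi ≤ i → box lo hi i ≡ 0
box-≥ lo hi i p = trans (cong (⟦ lo ≤? i ⟧ *_) (⟦⟧-no (i <? hi) (≤⇒≯ p))) (*-zeroʳ ⟦ lo ≤? i ⟧)

box-< : ∀ lo hi i → i < lo → box lo hi i ≡ 0
box-< lo hi i p = cong (_* ⟦ i <? hi ⟧) (⟦⟧-no (lo ≤? i) (<⇒≱ p))

∑-prefix : ∀ n j (f : ℕ → ℕ) → j ≤ n → ∑ n (λ i → box 0 j i * f i) ≡ ∑ j f
∑-prefix n j f j≤n with m≤n⇒∃[o]m+o≡n j≤n
... | o , refl = trans (∑-split j o _) (trans (cong₂ _+_
        (∑-cong j (λ i lt → trans (cong (_* f i) (box-in 0 j i z≤n lt)) (*-identityˡ (f i))))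
        (∑-zero o (λ i _ → cong (_* f (j + i)) (box-≥ 0 j (j + i) (m≤m+n j i)))))
      (+-identityʳ _))

-- The rows where f exceeds g form an admissible subset of rows.
∑-excess : ∀ n (f g : ℕ → ℕ) T
  → (∀ S → (∀ i → S i ≤ 1) → ∑ n (λ i → S i * f i) ≤ ∑ n (λ i → S i * g i) + T)
  → ∑ n (λ i → f i ∸ g i) ≤ T
∑-excess n f g T h = +-cancelˡ-≤ (∑ n (λ i → S i * g i)) _ _ (begin
    ∑ n (λ i → S i * g i) + ∑ n (λ i → f i ∸ g i) ≡⟨ sym (∑-+ n _ _) ⟩
    ∑ n (λ i → S i * g i + (f i ∸ g i)) ≡⟨ ∑-cong n (λ i _ → pt i) ⟩
    ∑ n (λ i → S i * f i) ≤⟨ h S (λ i → ⟦⟧≤1 (g i <? f i)) ⟩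
    ∑ n (λ i → S i * g i) + T ∎)
  where
  open ≤-Reasoning
  S : ℕ → ℕ
  S i = ⟦ g i <? f i ⟧
  pt : ∀ i → S i * g i + (f i ∸ g i) ≡ S i * f i
  pt i with g i <? f i
  ... | yes lt = trans (cong (_+ (f i ∸ g i)) (+-identityʳ (g i)))
                   (trans (m+[n∸m]≡n (<⇒≤ lt)) (sym (+-identityʳ (f i))))
  ... | no ≥ = m≤n⇒m∸n≡0 (≮⇒≥ ≥)

∑-weighted : ∀ n (m f g : ℕ → ℕ) → ∑ n (λ i → m i * f i) ≤ ∑ n (λ i → m i * g i) + ∑ n (λ i → m i * (f i ∸ g i))
∑-weighted n m f g = subst (∑ n (λ i → m i * f i) ≤_) (∑-+ n _ _) (∑-mono n (λ i _ →
  ≤-trans (*-monoʳ-≤ (m i) (m≤n+m∸n (f i) (g i))) (≤-reflexive (*-distribˡ-+ (m i) (g i) _))))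

module Residual {p : Params} {n : ℕ} (T : Trajectory p n) where
  open Params p
  open Trajectory T

  Y-used : ∀ i c → st (u i) c ≡ used → Y (u i) c ≡ 0
  Y-used i c s = cong (λ s → weight s (X (u i) c)) s

  YYZm≤M : ∀ i c → i < n → c < D → Y (u i) c * (Y (u i) c * Y (z i) c * m i) ≤ M
  YYZm≤M i c lt c<D = begin
    Y (u i) c * (Y (u i) c * Y (z i) c * m i)
      ≤⟨ *-mono-≤ yu (*-monoˡ-≤ (m i) (*-mono-≤ yu (Y≤Ymax (z i) (z-bounded i lt) c c<D))) ⟩
    J * G * (J * G * (J * G) * m i) ≡⟨ l1 J G (m i) ⟩
    J * J * (J * (G * (G * G))) * m i ≤⟨ *-monoˡ-≤ (m i) (*-monoʳ-≤ (J * J) JGGG≤Dh) ⟩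
    J * J * Dh * m i ≤⟨ m-bound i ⟩
    M ∎
    where
    open ≤-Reasoning
    yu = Y≤Ymax (u i) (u-bounded i (<⇒≤ lt)) c c<D
    l1 : ∀ J G m → J * G * (J * G * (J * G) * m) ≡ J * J * (J * (G * (G * G))) * m
    l1 = solve-∀

  -- The choice removes M Y and leaves the rounding remainder and the last gain, each at most M.
  -- Afterwards Y = 0, so X is frozen.
  X-used : ∀ i c → i ≤ n → c < D → st (u i) c ≡ used → X (u i) c ≤ 2 * M
  X-used zero c _ _ s = contradiction (trans (sym (cong (λ v → st v c) u-initial)) s) λ ()
  X-used (suc i) c lt c<D s with st (u i) c in eq | st (u (suc i)) c | st-suc i c lt
  X-used (suc i) c lt c<D refl | used | used | stay _ _ = begin
    X (u (suc i)) c ≡⟨ X-suc i c lt ⟩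
    X (u i) c + y * (y * Y (z i) c * m i) ∸ ⟦ c ≟ ch i ⟧ * (M * y) ≤⟨ m∸n≤m _ (⟦ c ≟ ch i ⟧ * (M * y)) ⟩
    X (u i) c + y * (y * Y (z i) c * m i) ≡⟨ cong (λ k → X (u i) c + k * (y * Y (z i) c * m i)) (Y-used i c eq) ⟩
    X (u i) c + 0 ≡⟨ +-identityʳ _ ⟩
    X (u i) c ≤⟨ X-used i c (<⇒≤ lt) c<D eq ⟩
    2 * M ∎
    where
    open ≤-Reasoning
    y = Y (u i) c
  X-used (suc i) c lt c<D refl | active | used | use c≡ = begin
    X (u (suc i)) c ≡⟨ X-suc i c lt ⟩
    X (u i) c + y * (y * Y (z i) c * m i) ∸ ⟦ c ≟ ch i ⟧ * (M * y)
      ≡⟨ cong (λ k → X (u i) c + y * (y * Y (z i) c * m i) ∸ k * (M * y)) (⟦⟧-yes (c ≟ ch i) c≡) ⟩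
    X (u i) c + y * (y * Y (z i) c * m i) ∸ 1 * (M * y)
      ≤⟨ ∸-monoˡ-≤ (1 * (M * y)) (+-mono-≤ (X≤Y+1 i c i≤n eq (active-inv i c i≤n c<D eq)) (YYZm≤M i c lt c<D)) ⟩
    (y + 1) * M + M ∸ 1 * (M * y) ≡⟨ cong (_∸ 1 * (M * y)) (l1 y M) ⟩
    1 * (M * y) + 2 * M ∸ 1 * (M * y) ≡⟨ m+n∸m≡n (1 * (M * y)) (2 * M) ⟩
    2 * M ∎
    where
    open ≤-Reasoning
    y = Y (u i) c
    i≤n = <⇒≤ lt
    l1 : ∀ y M → (y + 1) * M + M ≡ 1 * (M * y) + 2 * M
    l1 = solve-∀

  -- The part of the martingale weight that does not take part in sampling: rounding remainders,
  -- leftovers of used colours, and all weight of discarded ones. The tests speak about X, the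
  -- algorithm uses Y, and this is the difference.
  excess : Local → ℕ
  excess v = ∑ D (λ c → X v c ∸ M * Y v c)

  #active #used #killed : ℕ → ℕ
  #active i = ∑ D (λ c → isActive (st (u i) c))
  #used i = ∑ D (λ c → isUsed (st (u i) c))
  #killed i = ∑ D (λ c → isKilled (st (u i) c))

  residual : ∀ i c → i ≤ n → c < D → X (u i) c ∸ M * Y (u i) c ≤ 2 * M + isKilled (st (u i) c) * B
  residual i c i≤n c<D = go (st (u i) c) refl
    where
    open ≤-Reasoning
    go : ∀ s → st (u i) c ≡ s → X (u i) c ∸ M * Y (u i) c ≤ 2 * M + isKilled s * B
    go active s = begin
      X (u i) c ∸ M * Y (u i) c ≤⟨ ∸-monoˡ-≤ (M * Y (u i) c) (X≤Y+1 i c i≤n s (active-inv i c i≤n c<D s)) ⟩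
      (Y (u i) c + 1) * M ∸ M * Y (u i) c ≡⟨ cong (_∸ M * Y (u i) c) (l1 (Y (u i) c) M) ⟩
      M * Y (u i) c + M ∸ M * Y (u i) c ≡⟨ m+n∸m≡n (M * Y (u i) c) M ⟩
      M ≤⟨ ≤-trans (m≤m+n M (1 * M)) (m≤m+n (2 * M) (0 * B)) ⟩
      2 * M + 0 * B ∎
      where
      l1 : ∀ y M → (y + 1) * M ≡ M * y + M
      l1 = solve-∀
    go used s = ≤-trans (m∸n≤m _ (M * Y (u i) c)) (≤-trans (X-used i c i≤n c<D s) (m≤m+n (2 * M) (0 * B)))
    go killed s = ≤-trans (m∸n≤m _ (M * Y (u i) c)) (≤-trans (u-bounded i i≤n c c<D)
      (≤-trans (≤-reflexive (sym (*-identityˡ B))) (m≤n+m (1 * B) (2 * M))))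

  excess-bound : ∀ i → i ≤ n → excess (u i) ≤ D * (2 * M) + #killed i * B
  excess-bound i i≤n = begin
    excess (u i) ≤⟨ ∑-mono D (λ c lt → residual i c i≤n lt) ⟩
    ∑ D (λ c → 2 * M + isKilled (st (u i) c) * B) ≡⟨ ∑-+ D _ _ ⟩
    ∑ D (λ _ → 2 * M) + ∑ D (λ c → isKilled (st (u i) c) * B) ≡⟨ cong₂ _+_ (∑-const D (2 * M)) (∑-*ʳ D B _) ⟩
    D * (2 * M) + #killed i * B ∎
    where open ≤-Reasoning

  count-total : ∀ i → #active i + #used i + #killed i ≡ D
  count-total i = begin
    #active i + #used i + #killed i ≡⟨ cong (_+ #killed i) (sym (∑-+ D _ _)) ⟩
    ∑ D (λ c → isActive (st (u i) c) + isUsed (st (u i) c)) + #killed i ≡⟨ sym (∑-+ D _ _) ⟩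
    ∑ D (λ c → isActive (st (u i) c) + isUsed (st (u i) c) + isKilled (st (u i) c))
      ≡⟨ ∑-cong D (λ c _ → status-total (st (u i) c)) ⟩
    ∑ D (λ _ → 1) ≡⟨ trans (∑-const D 1) (*-identityʳ D) ⟩
    D ∎
    where open ≡-Reasoning

  common-fits : ∀ i → i < n → common (u i) (z i) ≤ D * (Ymax * Ymax)
  common-fits i lt = common≤ (u i) (z i) (u-bounded i (<⇒≤ lt)) (z-bounded i lt)

  ch-coloured : ∀ i → i < n → 0 < m i → r i < ∑ D (probs (u i) (z i))
  ch-coloured i lt pos = subst (r i <_)
    (sym (trans (probs-sum (u i) (z i)) (rate-exact _ (common-fits i lt) pos))) (r<M i lt)

  ch-uncoloured : ∀ i → m i ≡ 0 → ch i ≡ D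
  ch-uncoloured i m≡0 = pick-≥ (probs (u i) (z i)) D (r i)
    (≤-trans (≤-reflexive (trans (probs-sum (u i) (z i)) (trans (cong (common (u i) (z i) *_) m≡0) (*-zeroʳ (common (u i) (z i)))))) z≤n)

  ch-active : ∀ i → i < n → 0 < m i → st (u i) (ch i) ≡ active
  ch-active i lt pos = go (st (u i) (ch i)) refl
    where
    prob>0 = pick-pos (probs (u i) (z i)) D (r i) (ch-coloured i lt pos)
    go : ∀ s → st (u i) (ch i) ≡ s → s ≡ active
    go active _ = refl
    go used eq = contradiction (subst (λ s → 0 < weight s (X (u i) (ch i)) * Y (z i) (ch i) * m i) eq prob>0) λ ()
    go killed eq = contradiction (subst (λ s → 0 < weight s (X (u i) (ch i)) * Y (z i) (ch i) * m i) eq prob>0) λ ()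

  -- With a positive rate the probabilities fill all M digits exactly, so some colour is drawn, and
  -- it was active before.
  #used-suc : ∀ i → i < n → #used (suc i) ≡ #used i + ⟦ 0 <? m i ⟧
  #used-suc i lt with 0 <? m i
  ... | yes pos = trans (∑-cong D (λ c c<D → pt c)) (trans (∑-+ D _ _) (cong (#used i +_)
      (trans (∑-cong D (λ c _ → sym (*-identityʳ ⟦ c ≟ ch i ⟧))) (∑-single D (λ _ → 1) (ch i) (pick-< (probs (u i) (z i)) D (r i) (ch-coloured i lt pos))))))
    where
    pt : ∀ c → isUsed (st (u (suc i)) c) ≡ isUsed (st (u i) c) + ⟦ c ≟ ch i ⟧
    pt c with st (u i) c in eq | st (u (suc i)) c | st-suc i c lt
    ... | active | _ | use c≡ = sym (⟦⟧-yes (c ≟ ch i) c≡)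
    ... | active | _ | keep c≢ _ = sym (⟦⟧-no (c ≟ ch i) c≢)
    ... | active | _ | kill c≢ _ = sym (⟦⟧-no (c ≟ ch i) c≢)
    ... | s | _ | stay _ s≢ = trans (sym (+-identityʳ (isUsed s))) (cong (isUsed s +_) (sym (⟦⟧-no (c ≟ ch i)
            λ c≡ → s≢ (trans (sym eq) (trans (cong (st (u i)) c≡) (ch-active i lt pos))))))
  ... | no m≯0 = trans (∑-cong D (λ c c<D → pt c c<D)) (sym (+-identityʳ (#used i)))
    where
    pt : ∀ c → c < D → isUsed (st (u (suc i)) c) ≡ isUsed (st (u i) c)
    pt c c<D with st (u i) c | st (u (suc i)) c | st-suc i c lt
    ... | active | _ | use c≡ = contradiction (trans c≡ (ch-uncoloured i (n≤0⇒n≡0 (≮⇒≥ m≯0)))) (<⇒≢ c<D)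
    ... | active | _ | keep _ _ = refl
    ... | active | _ | kill _ _ = refl
    ... | s | _ | stay _ _ = refl

  #used≤ : ∀ i → i ≤ n → #used i ≤ i
  #used≤ zero _ = ≤-reflexive (trans (cong (λ v → ∑ D (λ c → isUsed (st v c))) u-initial) (∑-zero D (λ _ _ → refl)))
  #used≤ (suc i) lt = subst₂ _≤_ (sym (#used-suc i lt)) (+-comm i 1)
    (+-mono-≤ (#used≤ i (<⇒≤ lt)) (⟦⟧≤1 (0 <? m i)))

  death : ∀ i c → i ≤ n → st (u i) c ≡ killed → ∃ λ j → j ≤ i × E * Λ (u j) + M ≤ E * L (u j) c
  death zero c _ s = contradiction (trans (sym (cong (λ v → st v c) u-initial)) s) λ ()
  death (suc i) c lt s with st (u i) c in eq | st (u (suc i)) c | st-suc i c lt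
  death (suc i) c lt refl | killed | killed | stay _ _ with death i c (<⇒≤ lt) eq
  ... | j , j≤i , h = j , m≤n⇒m≤1+n j≤i , h
  death (suc i) c lt refl | active | killed | kill _ k = suc i , ≤-refl ,
    subst₂ (λ λ′ l → E * λ′ + M ≤ E * l) (sym (Λ-suc i lt)) (sym (L-suc i c lt)) (<⇒≤ k)

  -- S selects rows, and lo and hi give one interval of rows per colour. The quantifiers range over
  -- all selections, so the tests may be applied to selections that depend on the run itself.
  TestUp TestDown : Set
  TestUp = ∀ (S lo hi : ℕ → ℕ) → (∀ i → S i ≤ 1) → (∀ c → lo c ≤ n) → (∀ c → hi c ≤ n)
    → ∑ n (λ i → S i * ∑ D (λ c → box (lo c) (hi c) i * X (z i) c))
      ≤ ∑ n (λ i → S i * ∑ D (λ c → box (lo c) (hi c) i * (M * J))) + M * J * τ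
  TestDown = ∀ (S lo hi : ℕ → ℕ) → (∀ i → S i ≤ 1) → (∀ c → lo c ≤ n) → (∀ c → hi c ≤ n)
    → ∑ n (λ i → S i * ∑ D (λ c → box (lo c) (hi c) i * (M * J)))
      ≤ ∑ n (λ i → S i * ∑ D (λ c → box (lo c) (hi c) i * X (z i) c)) + M * J * τ

  ∑m-bound : ∀ k (f : ℕ → ℕ) → J * J * Dh * ∑ k (λ i → m i * f i) ≤ M * ∑ k f
  ∑m-bound k f = begin
    J * J * Dh * ∑ k (λ i → m i * f i) ≡⟨ sym (∑-*ˡ k (J * J * Dh) _) ⟩
    ∑ k (λ i → J * J * Dh * (m i * f i))
      ≤⟨ ∑-mono k (λ i _ → ≤-trans (≤-reflexive (sym (*-assoc (J * J * Dh) (m i) (f i)))) (*-monoˡ-≤ (f i) (m-bound i))) ⟩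
    ∑ k (λ i → M * f i) ≡⟨ ∑-*ˡ k M f ⟩
    M * ∑ k f ∎
    where open ≤-Reasoning

  -- By its death a discarded colour has collected 1/E more than λ. Test the rectangle of all
  -- discarded colours, each up to its own death: together they exceed the expected weight by an
  -- amount proportional to their number. `∑-excess` allows the row weights m i, as only their upper
  -- bound enters.
  kills : TestUp → ∀ i → i ≤ n → #killed i * Dh ≤ E * τ
  kills up i₀ i₀≤n = *-cancelʳ-≤ _ _ (J * J * (M * M)) {{m*n≢0 (J * J) (M * M) {{m*n≢0 J J}} {{m*n≢0 M M}}}} (begin
      κ * Dh * (J * J * (M * M)) ≡⟨ l1 κ Dh J M ⟩
      J * J * Dh * (κ * (M * M)) ≤⟨ *-monoʳ-≤ (J * J * Dh) κ-bound ⟩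
      J * J * Dh * (E * J * ∑ n (λ i → m i * (rowX i ∸ rowN i))) ≡⟨ l2 (J * J * Dh) (E * J) _ ⟩
      E * J * (J * J * Dh * ∑ n (λ i → m i * (rowX i ∸ rowN i))) ≤⟨ *-monoʳ-≤ (E * J) (∑m-bound n _) ⟩
      E * J * (M * ∑ n (λ i → rowX i ∸ rowN i)) ≤⟨ *-monoʳ-≤ (E * J) (*-monoʳ-≤ M (∑-excess n rowX rowN _ (λ S S≤1 → up S (λ _ → 0) hi S≤1 (λ _ → z≤n) hi≤))) ⟩
      E * J * (M * (M * J * τ)) ≡⟨ l3 E J M τ ⟩
      E * τ * (J * J * (M * M)) ∎)
    where
    open ≤-Reasoning
    κ = #killed i₀
    killed? : ∀ c → st (u i₀) c ≡ killed ⊎ isKilled (st (u i₀) c) ≡ 0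
    killed? c with st (u i₀) c
    ... | active = inj₂ refl
    ... | used = inj₂ refl
    ... | killed = inj₁ refl
    deathTime : ∀ {c} → st (u i₀) c ≡ killed ⊎ isKilled (st (u i₀) c) ≡ 0 → ℕ
    deathTime {c} (inj₁ s) = proj₁ (death i₀ c i₀≤n s)
    -- A colour that is not discarded gets the empty interval and contributes to neither side.
    deathTime (inj₂ _) = 0
    hi : ℕ → ℕ
    hi c = deathTime (killed? c)
    hi≤ : ∀ c → hi c ≤ n
    hi≤ c with killed? c
    ... | inj₁ s = ≤-trans (proj₁ (proj₂ (death i₀ c i₀≤n s))) i₀≤n
    ... | inj₂ _ = z≤n
    rowX rowN : ℕ → ℕ
    rowX i = ∑ D (λ c → box 0 (hi c) i * X (z i) c)
    rowN i = ∑ D (λ c → box 0 (hi c) i * (M * J))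
    l1 : ∀ k d J M → k * d * (J * J * (M * M)) ≡ J * J * d * (k * (M * M))
    l1 = solve-∀
    l2 : ∀ a b c → a * (b * c) ≡ b * (a * c)
    l2 = solve-∀
    l3 : ∀ E J M τ → E * J * (M * (M * J * τ)) ≡ E * τ * (J * J * (M * M))
    l3 = solve-∀
    colX colN : ℕ → ℕ
    colX c = ∑ n (λ i → box 0 (hi c) i * (m i * X (z i) c))
    colN c = ∑ n (λ i → box 0 (hi c) i * (m i * (M * J)))
    pt : ∀ c → isKilled (st (u i₀) c) * (M * M) + E * J * colN c ≤ E * J * colX c
    pt c with killed? c | hi≤ c
    ... | inj₂ z | _ = ≤-trans (≤-reflexive (trans (cong₂ (λ a b → a * (M * M) + E * J * b) z
            (∑-zero n (λ i _ → cong (_* (m i * (M * J))) (box-≥ 0 0 i z≤n)))) (*-zeroʳ (E * J)))) z≤n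
    ... | inj₁ s | j≤n = begin
        isKilled (st (u i₀) c) * (M * M) + E * J * ∑ n (λ i → box 0 j i * (m i * (M * J)))
          ≡⟨ cong₂ (λ a b → isKilled a * (M * M) + E * J * b) s (∑-prefix n j _ j≤n) ⟩
        1 * (M * M) + E * J * ∑ j (λ i → m i * (M * J))
          ≡⟨ cong (λ b → 1 * (M * M) + E * J * b) (trans (∑-cong j (λ i _ → l4 (m i) M J)) (∑-*ˡ j (M * J) m)) ⟩
        1 * (M * M) + E * J * (M * J * ∑ j m) ≡⟨ l5 M E J (∑ j m) ⟩
        M * (E * (J * J * ∑ j m) + M) ≡⟨ cong (λ b → M * (E * b + M)) (trans (sym (∑-*ˡ j (J * J) m)) (sym (Λ-sum j j≤n))) ⟩
        M * (E * Λ (u j) + M) ≤⟨ *-monoʳ-≤ M (proj₂ (proj₂ (death i₀ c i₀≤n s))) ⟩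
        M * (E * L (u j) c) ≡⟨ cong (λ b → M * (E * b)) (L-sum j c j≤n) ⟩
        M * (E * ∑ j (λ i → J * Y (z i) c * m i)) ≡⟨ l6 M E _ ⟩
        E * (M * ∑ j (λ i → J * Y (z i) c * m i)) ≡⟨ cong (E *_) (sym (∑-*ˡ j M _)) ⟩
        E * ∑ j (λ i → M * (J * Y (z i) c * m i))
          ≤⟨ *-monoʳ-≤ E (∑-mono j (λ i _ → ≤-trans (≤-reflexive (l7 M J (Y (z i) c) (m i)))
               (*-monoʳ-≤ J (*-monoʳ-≤ (m i) (M*Y≤X (z i) c))))) ⟩
        E * ∑ j (λ i → J * (m i * X (z i) c)) ≡⟨ cong (E *_) (∑-*ˡ j J _) ⟩
        E * (J * ∑ j (λ i → m i * X (z i) c)) ≡⟨ sym (*-assoc E J _) ⟩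
        E * J * ∑ j (λ i → m i * X (z i) c) ≡⟨ cong (E * J *_) (sym (∑-prefix n j _ j≤n)) ⟩
        E * J * ∑ n (λ i → box 0 j i * (m i * X (z i) c)) ∎
      where
      j = proj₁ (death i₀ c i₀≤n s)
      l4 : ∀ m M J → m * (M * J) ≡ M * J * m
      l4 = solve-∀
      l5 : ∀ M E J s → 1 * (M * M) + E * J * (M * J * s) ≡ M * (E * (J * J * s) + M)
      l5 = solve-∀
      l6 : ∀ M E s → M * (E * s) ≡ E * (M * s)
      l6 = solve-∀
      l7 : ∀ M J y m → M * (J * y * m) ≡ J * (m * (M * y))
      l7 = solve-∀
    swapped : ∀ (f : ℕ → ℕ → ℕ) → ∑ D (λ c → ∑ n (λ i → box 0 (hi c) i * (m i * f i c)))
      ≡ ∑ n (λ i → m i * ∑ D (λ c → box 0 (hi c) i * f i c))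
    swapped f = trans (∑-swap D n _) (∑-cong n (λ i _ → trans (∑-cong D (λ c _ → l2 (box 0 (hi c) i) (m i) (f i c))) (∑-*ˡ D (m i) _)))
    κ-bound : κ * (M * M) ≤ E * J * ∑ n (λ i → m i * (rowX i ∸ rowN i))
    κ-bound = +-cancelʳ-≤ (E * J * ∑ n (λ i → m i * rowN i)) _ _ (begin
      κ * (M * M) + E * J * ∑ n (λ i → m i * rowN i)
        ≡⟨ cong₂ _+_ (sym (∑-*ʳ D (M * M) _)) (trans (cong (E * J *_) (sym (swapped (λ _ _ → M * J)))) (sym (∑-*ˡ D (E * J) colN))) ⟩
      ∑ D (λ c → isKilled (st (u i₀) c) * (M * M)) + ∑ D (λ c → E * J * colN c) ≡⟨ sym (∑-+ D _ _) ⟩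
      ∑ D (λ c → isKilled (st (u i₀) c) * (M * M) + E * J * colN c) ≤⟨ ∑-mono D (λ c _ → pt c) ⟩
      ∑ D (λ c → E * J * colX c) ≡⟨ trans (∑-*ˡ D (E * J) colX) (cong (E * J *_) (swapped (λ i c → X (z i) c))) ⟩
      E * J * ∑ n (λ i → m i * rowX i) ≤⟨ *-monoʳ-≤ (E * J) (∑-weighted n m rowX rowN) ⟩
      E * J * (∑ n (λ i → m i * rowN i) + ∑ n (λ i → m i * (rowX i ∸ rowN i))) ≡⟨ l8 (E * J) _ _ ⟩
      E * J * ∑ n (λ i → m i * (rowX i ∸ rowN i)) + E * J * ∑ n (λ i → m i * rowN i) ∎)
      where
      l8 : ∀ a b c → a * (b + c) ≡ a * c + a * b
      l8 = solve-∀

-- The value n means that the property does not occur before n, which makes an interval ending or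
-- starting there come out right.
first : ∀ n {P : ℕ → Set} → (∀ i → Dec (P i)) → ∃ λ f → f ≤ n × (∀ i → i < f → ¬ P i) × (f < n → P f)
first zero P? = 0 , z≤n , (λ _ ()) , λ ()
first (suc n) P? with first n P?
... | f , f≤n , before , at with f ≟ n | P? f
...   | no f≢n | _ = f , m≤n⇒m≤1+n f≤n , before , λ _ → at (≤∧≢⇒< f≤n f≢n)
...   | yes refl | yes p = f , m≤n⇒m≤1+n f≤n , before , λ _ → p
...   | yes refl | no ¬p = suc f , ≤-refl , below , λ lt → contradiction lt (<-irrefl refl)
  where
  below : ∀ i → i < suc f → ¬ _
  below i lt with i ≟ f
  ... | yes refl = ¬p
  ... | no i≢f = before i (≤∧≢⇒< (s≤s⁻¹ lt) i≢f)

∑-levels : ∀ K y → y ≤ K → ∑ K (λ j → ⟦ j <? y ⟧) ≡ y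
∑-levels K y y≤K with m≤n⇒∃[o]m+o≡n y≤K
... | o , refl = trans (∑-split y o _) (trans (cong₂ _+_
      (trans (∑-cong y (λ j lt → ⟦⟧-yes (j <? y) lt)) (trans (∑-const y 1) (*-identityʳ y)))
      (∑-zero o (λ j _ → ⟦⟧-no (y + j <? y) (m+n≮m y j)))) (+-identityʳ y))

∑-∸ : ∀ n (f g : ℕ → ℕ) → ∑ n f ∸ ∑ n g ≤ ∑ n (λ i → f i ∸ g i)
∑-∸ n f g = m≤n+o⇒m∸n≤o (∑ n f) (∑ n g) (subst (∑ n f ≤_) (∑-+ n _ _) (∑-mono n (λ i _ → m≤n+m∸n (f i) (g i))))

∑-markov : ∀ n (f : ℕ → ℕ) h → ∑ n (λ i → ⟦ h <? f i ⟧) * h ≤ ∑ n f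
∑-markov n f h = subst (_≤ ∑ n f) (∑-*ʳ n h _) (∑-mono n (λ i _ → pt i))
  where
  pt : ∀ i → ⟦ h <? f i ⟧ * h ≤ f i
  pt i with h <? f i
  ... | yes lt = ≤-trans (≤-reflexive (+-identityʳ h)) (<⇒≤ lt)
  ... | no _ = z≤n

-- V² ≥ (V + b)(V - b)
tangent : ∀ x V b K → K ≤ x * (V + b) → K * V ≤ x * V * V + K * b
tangent x V b K h with ≤-total V b
... | inj₁ V≤b = ≤-trans (*-monoʳ-≤ K V≤b) (m≤n+m (K * b) (x * V * V))
... | inj₂ b≤V with m≤n⇒∃[o]m+o≡n b≤V
...   | w , refl = begin
    K * (b + w) ≡⟨ l1 K b w ⟩
    K * w + K * b ≤⟨ +-monoˡ-≤ (K * b) (*-monoˡ-≤ w h) ⟩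
    x * (b + w + b) * w + K * b ≤⟨ +-monoˡ-≤ (K * b) (≤-by (x * b * b) (l2 x b w)) ⟩
    x * (b + w) * (b + w) + K * b ∎
  where
  open ≤-Reasoning
  l1 : ∀ K b w → K * (b + w) ≡ K * w + K * b
  l1 = solve-∀
  l2 : ∀ x b w → x * (b + w + b) * w + x * b * b ≡ x * (b + w) * (b + w)
  l2 = solve-∀

module ParamFacts (p : Params) where
  open Params p

  4GG≢0 : NonZero (4 * (G * G))
  4GG≢0 = m*n≢0 4 (G * G) {{_}} {{m*n≢0 G G}}

  τ≤tt : τ ≤ t * t
  τ≤tt = ≤-trans (m≤n*m τ (8 * (G * G)) {{m*n≢0 8 (G * G) {{_}} {{m*n≢0 G G}}}}) τ≤

  Gτ≤tt : G * τ ≤ t * t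
  Gτ≤tt = ≤-trans (*-monoˡ-≤ τ (≤-trans (m≤m*n G G) (m≤n*m (G * G) 8))) τ≤

  16Gt : ℕ
  16Gt = 16 * (G * t)

  Dh+ : Dh + 16Gt ≡ D
  Dh+ = begin
    Dh + 16 * (G * t) ≡⟨ cong (_+ 16 * (G * t)) Dh≡ ⟩
    16 * (G * ((g + 3) * t)) + 16 * (G * t) ≡⟨ lemma G g t ⟩
    16 * (G * (g + 4)) * t ≡⟨ cong (λ x → 16 * (G * x) * t) (sym G≡) ⟩
    16 * (G * G) * t ≡⟨ cong (_* t) (sym E≡) ⟩
    E * t ≡⟨ sym D≡ ⟩
    D ∎
    where
    open ≡-Reasoning
    lemma : ∀ G g t → 16 * (G * ((g + 3) * t)) + 16 * (G * t) ≡ 16 * (G * (g + 4)) * t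
    lemma = solve-∀

  D≡GGt : D ≡ 16 * (G * G * t)
  D≡GGt = trans D≡ (trans (cong (_* t) E≡) (*-assoc 16 (G * G) t))

  t≤Gt : t ≤ G * t
  t≤Gt = m≤n*m t G

  16Gt≤Dh : 16Gt ≤ Dh
  16Gt≤Dh = subst (16Gt ≤_) (sym Dh≡)
    (*-monoʳ-≤ 16 (*-monoʳ-≤ G (m≤n*m t (g + 3) {{>-nonZero (≤-trans (s≤s z≤n) (m≤n+m 3 g))}})))

  t≤Dh : t ≤ Dh
  t≤Dh = ≤-trans t≤Gt (≤-trans (m≤n*m (G * t) 16) 16Gt≤Dh)

  Dh≤D : Dh ≤ D
  Dh≤D = subst (Dh ≤_) Dh+ (m≤m+n Dh 16Gt)

  2t≤D : 2 * t ≤ D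
  2t≤D = ≤-trans (*-mono-≤ {2} {16} (s≤s (s≤s z≤n)) t≤Gt) (≤-trans 16Gt≤Dh Dh≤D)

  D≤e₁t : D ≤ e₁ * t
  D≤e₁t = begin
    D ≡⟨ D≡ ⟩
    E * t ≡⟨ cong (_* t) E≡ ⟩
    16 * (G * G) * t ≤⟨ *-monoˡ-≤ t (*-monoʳ-≤ 16 (m≤n*m (G * G) G)) ⟩
    16 * (G * (G * G)) * t ≡⟨ cong (_* t) (sym e≡) ⟩
    e₁ * t ∎
    where open ≤-Reasoning

  D≤Jt : D ≤ J * t
  D≤Jt = ≤-trans D≤e₁t (*-monoˡ-≤ t (subst (e₁ ≤_) (sym J≡) (m≤n*m e₁ 4)))

  -- This fixes J: losing one grid cell in each of D colours amounts to a weight of D / J = t / (4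
  -- G).
  4GD≡Jt : 4 * (G * D) ≡ J * t
  4GD≡Jt = begin
    4 * (G * D) ≡⟨ cong (λ x → 4 * (G * x)) D≡GGt ⟩
    4 * (G * (16 * (G * G * t))) ≡⟨ lemma G t ⟩
    4 * (16 * (G * (G * G))) * t ≡⟨ cong (λ x → 4 * x * t) (sym e≡) ⟩
    4 * e₁ * t ≡⟨ cong (_* t) (sym J≡) ⟩
    J * t ∎
    where
    open ≡-Reasoning
    lemma : ∀ G t → 4 * (G * (16 * (G * G * t))) ≡ 4 * (16 * (G * (G * G))) * t
    lemma = solve-∀

  few-kills : ∀ κ → κ * Dh ≤ E * τ → 4 * (G * G) * κ ≤ t
  few-kills κ h = *-cancelʳ-≤ _ _ t (begin
    4 * (G * G) * κ * t ≡⟨ l1 (G * G) κ t ⟩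
    4 * (G * G) * (κ * t) ≤⟨ *-monoʳ-≤ (4 * (G * G)) κt≤ ⟩
    4 * (G * G) * (2 * τ) ≡⟨ l2 (G * G) τ ⟩
    8 * (G * G) * τ ≤⟨ τ≤ ⟩
    t * t ∎)
    where
    open ≤-Reasoning
    l1 : ∀ a k t → 4 * a * k * t ≡ 4 * a * (k * t)
    l1 = solve-∀
    l2 : ∀ a τ → 4 * a * (2 * τ) ≡ 8 * a * τ
    l2 = solve-∀
    κt≤ : κ * t ≤ 2 * τ
    κt≤ = *-cancelˡ-≤ (16 * (G * (g + 3))) {{m*n≢0 16 (G * (g + 3)) {{_}} {{m*n≢0 G (g + 3) {{G≢0}} {{>-nonZero (≤-trans (s≤s z≤n) (m≤n+m 3 g))}}}}}} (begin
      16 * (G * (g + 3)) * (κ * t) ≡⟨ l3 G g κ t ⟩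
      κ * (16 * (G * ((g + 3) * t))) ≡⟨ cong (κ *_) (sym Dh≡) ⟩
      κ * Dh ≤⟨ h ⟩
      E * τ ≡⟨ cong (_* τ) E≡ ⟩
      16 * (G * G) * τ ≡⟨ cong (λ x → 16 * (G * x) * τ) G≡ ⟩
      16 * (G * (g + 4)) * τ ≤⟨ ≤-by (16 * (G * (g + 2)) * τ) (l4 G g τ) ⟩
      16 * (G * (g + 3)) * (2 * τ) ∎)
      where
      l3 : ∀ G g k t → 16 * (G * (g + 3)) * (k * t) ≡ k * (16 * (G * ((g + 3) * t)))
      l3 = solve-∀
      l4 : ∀ G g τ → 16 * (G * (g + 4)) * τ + 16 * (G * (g + 2)) * τ ≡ 16 * (G * (g + 3)) * (2 * τ)
      l4 = solve-∀

module Smallness {p : Params} {n : ℕ} (T : Trajectory p n) where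
  open Params p
  open ParamFacts p
  open Trajectory T
  open Residual T

  module _ (up : TestUp) where

    killed-small : ∀ i → i ≤ n → 4 * (G * G) * #killed i ≤ t
    killed-small i i≤n = few-kills (#killed i) (kills up i i≤n)

    -- Rounding contributes 2 M per colour and each discarded colour at most B. Only `TestUp` of the
    -- vertex itself is used, so this is available for all vertices before the finer analysis of any
    -- of them, and no circularity arises when it is applied to partners.
    excess-small : ∀ i → i ≤ n → G * excess (u i) ≤ M * J * t
    excess-small i i≤n = *-cancelˡ-≤ 4 (begin
      4 * (G * excess (u i)) ≤⟨ *-monoʳ-≤ 4 (*-monoʳ-≤ G (excess-bound i i≤n)) ⟩
      4 * (G * (D * (2 * M) + κ * (M * (J * G)))) ≡⟨ l1 G D M κ J ⟩
      M * (2 * (4 * (G * D)) + J * (4 * (G * G) * κ)) ≡⟨ cong (λ x → M * (2 * x + J * (4 * (G * G) * κ))) 4GD≡Jt ⟩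
      M * (2 * (J * t) + J * (4 * (G * G) * κ)) ≤⟨ *-monoʳ-≤ M (+-monoʳ-≤ (2 * (J * t)) (*-monoʳ-≤ J (killed-small i i≤n))) ⟩
      M * (2 * (J * t) + J * t) ≤⟨ ≤-by (M * J * t) (l2 M J t) ⟩
      4 * (M * J * t) ∎)
      where
      open ≤-Reasoning
      κ = #killed i
      l1 : ∀ G D M κ J → 4 * (G * (D * (2 * M) + κ * (M * (J * G)))) ≡ M * (2 * (4 * (G * D)) + J * (4 * (G * G) * κ))
      l1 = solve-∀
      l2 : ∀ M J t → M * (2 * (J * t) + J * t) + M * J * t ≡ 4 * (M * J * t)
      l2 = solve-∀

-- Colours lagging behind, and sums weighted by the vertex's own weights

module Balanced {p : Params} {n : ℕ} (T : Trajectory p n)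
  (up : Residual.TestUp T) (down : Residual.TestDown T)
  (z-excess : ∀ i → i < n → Params.G p * Residual.excess T (Trajectory.z T i) ≤ Params.M p * Params.J p * Params.t p) where
  open Params p
  open ParamFacts p
  open Trajectory T
  open Residual T
  open Smallness T

  private
    mul-swap : ∀ a b c → a * (b * c) ≡ b * (a * c)
    mul-swap = solve-∀

  gap : ℕ → ℕ → ℕ
  gap i c = isActive (st (u i) c) * (Λ (u i) ∸ L (u i) c)

  gaps : ℕ → ℕ
  gaps i = ∑ D (gap i)

  module LowGap (i₀ : ℕ) (i₀≤n : i₀ ≤ n) where
    open ≤-Reasoning

    low? : ∀ c → (st (u i₀) c ≡ active × L (u i₀) c ≤ Λ (u i₀)) ⊎ gap i₀ c ≡ 0
    low? c with st (u i₀) c | ≤-total (L (u i₀) c) (Λ (u i₀))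
    ... | active | inj₁ l = inj₁ (refl , l)
    ... | active | inj₂ l = inj₂ (trans (+-identityʳ _) (m≤n⇒m∸n≡0 l))
    ... | used | _ = inj₂ refl
    ... | killed | _ = inj₂ refl

    bound : ∀ {A B : Set} → A ⊎ B → ℕ
    bound (inj₁ _) = i₀
    bound (inj₂ _) = 0

    hi : ℕ → ℕ
    hi c = bound (low? c)

    hi≤ : ∀ c → hi c ≤ n
    hi≤ c with low? c
    ... | inj₁ _ = i₀≤n
    ... | inj₂ _ = z≤n

    rowX rowN rowY W : ℕ → ℕ
    rowX i = ∑ D (λ c → box 0 (hi c) i * X (z i) c)
    rowN i = ∑ D (λ c → box 0 (hi c) i * (M * J))
    rowY i = ∑ D (λ c → box 0 (hi c) i * (M * Y (z i) c))
    W i = excess (z i)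

    rowX≤ : ∀ i → rowX i ≤ rowY i + W i
    rowX≤ i = subst (rowX i ≤_) (∑-+ D _ _) (∑-mono D (λ c _ → begin
      box 0 (hi c) i * X (z i) c ≤⟨ *-monoʳ-≤ (box 0 (hi c) i) (m≤n+m∸n (X (z i) c) (M * Y (z i) c)) ⟩
      box 0 (hi c) i * (M * Y (z i) c + (X (z i) c ∸ M * Y (z i) c)) ≡⟨ *-distribˡ-+ (box 0 (hi c) i) _ _ ⟩
      box 0 (hi c) i * (M * Y (z i) c) + box 0 (hi c) i * (X (z i) c ∸ M * Y (z i) c)
        ≤⟨ +-monoʳ-≤ _ (≤-trans (*-monoˡ-≤ _ (box≤1 0 (hi c) i)) (≤-reflexive (*-identityˡ _))) ⟩
      box 0 (hi c) i * (M * Y (z i) c) + (X (z i) c ∸ M * Y (z i) c) ∎))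

    colY colN : ℕ → ℕ
    colY c = ∑ n (λ i → box 0 (hi c) i * (m i * (M * Y (z i) c)))
    colN c = ∑ n (λ i → box 0 (hi c) i * (m i * (M * J)))

    pt : ∀ c → M * gap i₀ c + J * colY c ≤ J * colN c
    pt c with low? c
    ... | inj₂ gap0 = ≤-trans (≤-reflexive (trans (cong₂ (λ a b → M * a + J * b) gap0
            (∑-zero n (λ i _ → cong (_* (m i * (M * Y (z i) c))) (box-≥ 0 0 i z≤n)))) (trans (cong₂ _+_ (*-zeroʳ M) (*-zeroʳ J)) refl))) z≤n
    ... | inj₁ (s , l) = ≤-reflexive (begin-equality
        M * gap i₀ c + J * ∑ n (λ i → box 0 i₀ i * (m i * (M * Y (z i) c)))
          ≡⟨ cong₂ (λ a b → M * (isActive a * (Λ (u i₀) ∸ L (u i₀) c)) + J * b) s (∑-prefix n i₀ _ i₀≤n) ⟩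
        M * (1 * (Λ (u i₀) ∸ L (u i₀) c)) + J * ∑ i₀ (λ i → m i * (M * Y (z i) c))
          ≡⟨ cong (M * (1 * (Λ (u i₀) ∸ L (u i₀) c)) +_) (trans (sym (∑-*ˡ i₀ J _))
               (trans (∑-cong i₀ (λ i _ → l1 J (m i) M (Y (z i) c))) (trans (∑-*ˡ i₀ M _) (cong (M *_) (sym (L-sum i₀ c i₀≤n)))))) ⟩
        M * (1 * (Λ (u i₀) ∸ L (u i₀) c)) + M * L (u i₀) c ≡⟨ l2 M (Λ (u i₀) ∸ L (u i₀) c) (L (u i₀) c) ⟩
        M * ((Λ (u i₀) ∸ L (u i₀) c) + L (u i₀) c) ≡⟨ cong (M *_) (m∸n+n≡m l) ⟩
        M * Λ (u i₀) ≡⟨ cong (M *_) (Λ-sum i₀ i₀≤n) ⟩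
        M * ∑ i₀ (λ j → J * J * m j) ≡⟨ sym (∑-*ˡ i₀ M _) ⟩
        ∑ i₀ (λ j → M * (J * J * m j)) ≡⟨ ∑-cong i₀ (λ i _ → l3 M J (m i)) ⟩
        ∑ i₀ (λ j → J * (m j * (M * J))) ≡⟨ ∑-*ˡ i₀ J _ ⟩
        J * ∑ i₀ (λ j → m j * (M * J)) ≡⟨ cong (J *_) (sym (∑-prefix n i₀ _ i₀≤n)) ⟩
        J * ∑ n (λ i → box 0 i₀ i * (m i * (M * J))) ∎)
      where
      l1 : ∀ J m M y → J * (m * (M * y)) ≡ M * (J * y * m)
      l1 = solve-∀
      l2 : ∀ M a b → M * (1 * a) + M * b ≡ M * (a + b)
      l2 = solve-∀
      l3 : ∀ M J m → M * (J * J * m) ≡ J * (m * (M * J))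
      l3 = solve-∀

    swapped : ∀ (f : ℕ → ℕ → ℕ) → ∑ D (λ c → ∑ n (λ i → box 0 (hi c) i * (m i * f i c)))
      ≡ ∑ n (λ i → m i * ∑ D (λ c → box 0 (hi c) i * f i c))
    swapped f = trans (∑-swap D n _) (∑-cong n (λ i _ →
      trans (∑-cong D (λ c _ → mul-swap (box 0 (hi c) i) (m i) (f i c))) (∑-*ˡ D (m i) _)))

    dev : ℕ → ℕ
    dev i = rowN i ∸ rowX i

    M-gaps : M * gaps i₀ ≤ J * ∑ n (λ i → m i * (W i + dev i))
    M-gaps = +-cancelʳ-≤ (J * ∑ n (λ i → m i * rowY i)) _ _ (begin
      M * gaps i₀ + J * ∑ n (λ i → m i * rowY i)
        ≡⟨ cong₂ _+_ (sym (∑-*ˡ D M (gap i₀))) (trans (cong (J *_) (sym (swapped (λ i c → M * Y (z i) c)))) (sym (∑-*ˡ D J colY))) ⟩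
      ∑ D (λ c → M * gap i₀ c) + ∑ D (λ c → J * colY c) ≡⟨ sym (∑-+ D _ _) ⟩
      ∑ D (λ c → M * gap i₀ c + J * colY c) ≤⟨ ∑-mono D (λ c _ → pt c) ⟩
      ∑ D (λ c → J * colN c) ≡⟨ trans (∑-*ˡ D J colN) (cong (J *_) (swapped (λ _ _ → M * J))) ⟩
      J * ∑ n (λ i → m i * rowN i) ≤⟨ *-monoʳ-≤ J (∑-mono n (λ i _ → *-monoʳ-≤ (m i) (rowN≤ i))) ⟩
      J * ∑ n (λ i → m i * (W i + dev i + rowY i))
        ≡⟨ cong (J *_) (trans (∑-cong n (λ i _ → *-distribˡ-+ (m i) (W i + dev i) (rowY i))) (∑-+ n _ _)) ⟩
      J * (∑ n (λ i → m i * (W i + dev i)) + ∑ n (λ i → m i * rowY i)) ≡⟨ *-distribˡ-+ J _ _ ⟩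
      J * ∑ n (λ i → m i * (W i + dev i)) + J * ∑ n (λ i → m i * rowY i) ∎)
      where
      rowN≤ : ∀ i → rowN i ≤ W i + dev i + rowY i
      rowN≤ i = begin
        rowN i ≤⟨ m≤n+m∸n (rowN i) (rowX i) ⟩
        rowX i + dev i ≤⟨ +-monoˡ-≤ (dev i) (rowX≤ i) ⟩
        rowY i + W i + dev i ≡⟨ l (rowY i) (W i) (dev i) ⟩
        W i + dev i + rowY i ∎
        where
        l : ∀ a b c → a + b + c ≡ b + c + a
        l = solve-∀

    G∑W : G * ∑ n W ≤ n * (M * J * t)
    G∑W = subst₂ _≤_ (∑-*ˡ n G W) (∑-const n (M * J * t)) (∑-mono n z-excess)

    -- The counterpart of `kills`: the colours with l < λ have met too little weight in the rows
    -- before i₀, so the lower test on these rows bounds their total gap. The partners' excess W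
    -- enters because l accumulates Y, not X.
    gaps-small : G * gaps i₀ ≤ 2 * t * M
    gaps-small = *-cancelˡ-≤ Dh (*-cancelˡ-≤ (J * J * M) {{m*n≢0 (J * J) M {{m*n≢0 J J}}}} (begin
      J * J * M * (Dh * (G * gaps i₀)) ≡⟨ l1 J M Dh G (gaps i₀) ⟩
      G * (J * J * Dh * (M * gaps i₀)) ≤⟨ *-monoʳ-≤ G (*-monoʳ-≤ (J * J * Dh) M-gaps) ⟩
      G * (J * J * Dh * (J * ∑ n (λ i → m i * (W i + dev i)))) ≡⟨ cong (G *_) (mul-swap (J * J * Dh) J _) ⟩
      G * (J * (J * J * Dh * ∑ n (λ i → m i * (W i + dev i)))) ≤⟨ *-monoʳ-≤ G (*-monoʳ-≤ J (∑m-bound n _)) ⟩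
      G * (J * (M * ∑ n (λ i → W i + dev i))) ≡⟨ cong (λ x → G * (J * (M * x))) (∑-+ n W dev) ⟩
      G * (J * (M * (∑ n W + ∑ n dev))) ≡⟨ l2 G J M (∑ n W) (∑ n dev) ⟩
      J * M * (G * ∑ n W + G * ∑ n dev) ≤⟨ *-monoʳ-≤ (J * M) (+-mono-≤ G∑W
          (*-monoʳ-≤ G (∑-excess n rowN rowX _ (λ S S≤1 → down S (λ _ → 0) hi S≤1 (λ _ → z≤n) hi≤)))) ⟩
      J * M * (n * (M * J * t) + G * (M * J * τ)) ≡⟨ l3 J M n t G τ ⟩
      J * J * M * (M * (n * t + G * τ)) ≤⟨ *-monoʳ-≤ (J * J * M) (*-monoʳ-≤ M (+-mono-≤ (*-monoˡ-≤ t n≤Dh) (≤-trans Gτ≤tt (*-monoˡ-≤ t t≤Dh)))) ⟩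
      J * J * M * (M * (Dh * t + Dh * t)) ≡⟨ cong (J * J * M *_) (l4 M Dh t) ⟩
      J * J * M * (Dh * (2 * t * M)) ∎))
      where
      n≤Dh : n ≤ Dh
      n≤Dh = ≤-trans rows≤ (subst (16 * (G * (g * t)) ≤_) (sym Dh≡) (*-monoʳ-≤ 16 (*-monoʳ-≤ G (*-monoˡ-≤ t (m≤m+n g 3)))))
      l1 : ∀ J M Dh G a → J * J * M * (Dh * (G * a)) ≡ G * (J * J * Dh * (M * a))
      l1 = solve-∀
      l2 : ∀ G J M a b → G * (J * (M * (a + b))) ≡ J * M * (G * a + G * b)
      l2 = solve-∀
      l3 : ∀ J M n t G τ → J * M * (n * (M * J * t) + G * (M * J * τ)) ≡ J * J * M * (M * (n * t + G * τ))
      l3 = solve-∀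
      l4 : ∀ M d t → M * (d * t + d * t) ≡ d * (2 * t * M)
      l4 = solve-∀

  X-mono-suc : ∀ i c → i < n → st (u (suc i)) c ≡ active → st (u i) c ≡ active × X (u i) c ≤ X (u (suc i)) c
  X-mono-suc i c lt s with st (u i) c in eq | st (u (suc i)) c | st-suc i c lt
  X-mono-suc i c lt refl | active | active | keep c≢ _ = refl , subst (X (u i) c ≤_) (sym (X-keep i c lt c≢)) (m≤m+n _ _)
  X-mono-suc i c lt refl | active | active | stay _ s≢ = contradiction refl s≢

  X-mono : ∀ i k c → i + k ≤ n → st (u (i + k)) c ≡ active → st (u i) c ≡ active × X (u i) c ≤ X (u (i + k)) c
  X-mono i zero c le s = trans (cong (λ j → st (u j) c) (sym (+-identityʳ i))) s
    , ≤-reflexive (cong (λ j → X (u j) c) (sym (+-identityʳ i)))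
  X-mono i (suc k) c le s with X-mono-suc (i + k) c (subst (_≤ n) (+-suc i k) le) (subst (λ j → st (u j) c ≡ active) (+-suc i k) s)
  ... | s′ , x≤ with X-mono i k c (<⇒≤ (subst (_≤ n) (+-suc i k) le)) s′
  ...   | s″ , x≤′ = s″ , ≤-trans x≤′ (subst (λ j → X (u (i + k)) c ≤ X (u j) c) (sym (+-suc i k)) x≤)

  Y-mono : ∀ i k c → c < D → i + k ≤ n → st (u (i + k)) c ≡ active → Y (u i) c ≤ Y (u (i + k)) c
  Y-mono i k c c<D le s = subst₂ _≤_
    (sym (Y-active i c i≤n (proj₁ xm) (active-inv i c i≤n c<D (proj₁ xm))))
    (sym (Y-active (i + k) c le s (active-inv (i + k) c le c<D s))) (/-monoˡ-≤ M (proj₂ xm))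
    where
    xm = X-mono i k c le s
    i≤n = ≤-trans (m≤m+n i k) le

  active-of-Y : ∀ i c j → j < Y (u i) c → st (u i) c ≡ active
  active-of-Y i c j lt = go (st (u i) c) refl
    where
    go : ∀ s → st (u i) c ≡ s → s ≡ active
    go active _ = refl
    go used eq = contradiction (subst (λ s → j < weight s (X (u i) c)) eq lt) λ ()
    go killed eq = contradiction (subst (λ s → j < weight s (X (u i) c)) eq lt) λ ()

  active? : ∀ s → Dec (s ≡ active)
  active? active = yes refl
  active? used = no λ ()
  active? killed = no λ ()

  inactive? : ∀ s → Dec (s ≢ active)
  inactive? active = no λ h → h refl
  inactive? used = yes λ ()
  inactive? killed = yes λ ()

  level : ∀ j c → ∃ λ lo → lo ≤ n × (∀ i → i < lo → ¬ (j < Y (u i) c)) × (lo < n → j < Y (u lo) c)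
  level j c = first n (λ i → j <? Y (u i) c)

  deadline : ∀ c → ∃ λ hi → hi ≤ n × (∀ i → i < hi → ¬ (st (u i) c ≢ active)) × (hi < n → st (u hi) c ≢ active)
  deadline c = first n (λ i → inactive? (st (u i) c))

  lo′ : ℕ → ℕ → ℕ
  lo′ j c = proj₁ (level j c)

  hi′ : ℕ → ℕ
  hi′ c = proj₁ (deadline c)

  -- While c is active X never decreases, and once c is inactive Y vanishes forever. So Y exceeds j
  -- exactly from the first time it does so until c becomes inactive.
  level-box : ∀ j c i → c < D → i < n → ⟦ j <? Y (u i) c ⟧ ≡ box (lo′ j c) (hi′ c) i
  level-box j c i c<D i<n = go (j <? Y (u i) c) (i <? lo) (i <? hi)
    where
    lo hi : ℕ
    lo = lo′ j c
    hi = hi′ c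
    inactive : hi ≤ i → st (u i) c ≢ active
    inactive hi≤i s with m≤n⇒∃[o]m+o≡n hi≤i
    ... | k , eq = proj₂ (proj₂ (proj₂ (deadline c))) (≤-<-trans hi≤i i<n)
          (proj₁ (X-mono hi k c (subst (_≤ n) (sym eq) (<⇒≤ i<n)) (subst (λ x → st (u x) c ≡ active) (sym eq) s)))
    alive-active : i < hi → st (u i) c ≡ active
    alive-active alive = dne (active? (st (u i) c))
      where
      dne : Dec (st (u i) c ≡ active) → st (u i) c ≡ active
      dne (yes s) = s
      dne (no ¬s) = contradiction ¬s (proj₁ (proj₂ (proj₂ (deadline c))) i alive)
    reached : lo ≤ i → i < hi → j < Y (u i) c
    reached lo≤i alive with m≤n⇒∃[o]m+o≡n lo≤i
    ... | k , eq = ≤-trans (proj₂ (proj₂ (proj₂ (level j c))) (≤-<-trans lo≤i i<n))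
          (subst (λ x → Y (u lo) c ≤ Y (u x) c) eq (Y-mono lo k c c<D (subst (_≤ n) (sym eq) (<⇒≤ i<n))
            (subst (λ x → st (u x) c ≡ active) (sym eq) (alive-active alive))))
    go : Dec (j < Y (u i) c) → Dec (i < lo) → Dec (i < hi) → ⟦ j <? Y (u i) c ⟧ ≡ box lo hi i
    go (yes y) (yes before) _ = contradiction y (proj₁ (proj₂ (proj₂ (level j c))) i before)
    go (yes y) (no _) (no ¬alive) = contradiction (active-of-Y i c j y) (inactive (≮⇒≥ ¬alive))
    go (yes y) (no ¬before) (yes alive) = trans (⟦⟧-yes (j <? Y (u i) c) y) (sym (box-in lo hi i (≮⇒≥ ¬before) alive))
    go (no ¬y) (yes before) _ = trans (⟦⟧-no (j <? Y (u i) c) ¬y) (sym (box-< lo hi i before))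
    go (no ¬y) (no _) (no ¬alive) = trans (⟦⟧-no (j <? Y (u i) c) ¬y) (sym (box-≥ lo hi i (≮⇒≥ ¬alive)))
    go (no ¬y) (no ¬before) (yes alive) = contradiction (reached (≮⇒≥ ¬before) alive) ¬y

  rowYX rowYN devUp devDown : ℕ → ℕ
  rowYX i = ∑ D (λ c → Y (u i) c * X (z i) c)
  rowYN i = ∑ D (λ c → Y (u i) c * (M * J))
  devUp i = rowYX i ∸ rowYN i
  devDown i = rowYN i ∸ rowYX i

  private
    slice : (ℕ → ℕ → ℕ) → ℕ → ℕ → ℕ
    slice f j i = ∑ D (λ c → box (lo′ j c) (hi′ c) i * f i c)

    sliced : ∀ (f : ℕ → ℕ → ℕ) i → i < n → ∑ D (λ c → Y (u i) c * f i c) ≡ ∑ Ymax (λ j → slice f j i)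
    sliced f i i<n = trans (∑-cong D (λ c c<D → trans (cong (_* f i c) (sym (∑-levels Ymax (Y (u i) c) (Y≤Ymax (u i) (u-bounded i (<⇒≤ i<n)) c c<D))))
        (trans (sym (∑-*ʳ Ymax (f i c) _)) (∑-cong Ymax (λ j _ → cong (_* f i c) (level-box j c i c<D i<n))))))
      (∑-swap D Ymax _)

    -- Layer-cake decomposition: Y is the sum of the indicators of its level sets, and each of the
    -- `Ymax` levels is a family of intervals, hence an admissible test. This is how the tests reach
    -- the sampling total N, although its weights Y depend on the run.
    by-slices : ∀ (f h : ℕ → ℕ → ℕ) K
      → (∀ j S → (∀ i → S i ≤ 1) → ∑ n (λ i → S i * slice f j i) ≤ ∑ n (λ i → S i * slice h j i) + K)
      → ∑ n (λ i → ∑ D (λ c → Y (u i) c * f i c) ∸ ∑ D (λ c → Y (u i) c * h i c)) ≤ Ymax * K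
    by-slices f h K test = begin
      ∑ n (λ i → ∑ D (λ c → Y (u i) c * f i c) ∸ ∑ D (λ c → Y (u i) c * h i c))
        ≤⟨ ∑-mono n (λ i lt → ≤-trans (≤-reflexive (cong₂ _∸_ (sliced f i lt) (sliced h i lt))) (∑-∸ Ymax (λ j → slice f j i) (λ j → slice h j i))) ⟩
      ∑ n (λ i → ∑ Ymax (λ j → slice f j i ∸ slice h j i)) ≡⟨ ∑-swap n Ymax _ ⟩
      ∑ Ymax (λ j → ∑ n (λ i → slice f j i ∸ slice h j i)) ≤⟨ ∑-mono Ymax (λ j _ → ∑-excess n (slice f j) (slice h j) K (test j)) ⟩
      ∑ Ymax (λ _ → K) ≡⟨ ∑-const Ymax K ⟩
      Ymax * K ∎
      where open ≤-Reasoning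

  ∑devUp : ∑ n devUp ≤ Ymax * (M * J * τ)
  ∑devUp = by-slices (λ i c → X (z i) c) (λ _ _ → M * J) (M * J * τ)
    (λ j S S≤1 → up S (lo′ j) hi′ S≤1 (λ c → proj₁ (proj₂ (level j c))) (λ c → proj₁ (proj₂ (deadline c))))

  ∑devDown : ∑ n devDown ≤ Ymax * (M * J * τ)
  ∑devDown = by-slices (λ _ _ → M * J) (λ i c → X (z i) c) (M * J * τ)
    (λ j S S≤1 → down S (lo′ j) hi′ S≤1 (λ c → proj₁ (proj₂ (level j c))) (λ c → proj₁ (proj₂ (deadline c))))

-- The sampling total N from above, and the growth of λ

module Conclusion {p : Params} {n : ℕ} (T : Trajectory p n)
  (up : Residual.TestUp T) (down : Residual.TestDown T)
  (z-excess : ∀ i → i < n → Params.G p * Residual.excess T (Trajectory.z T i) ≤ Params.M p * Params.J p * Params.t p) where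
  open Params p
  open ParamFacts p
  open Trajectory T
  open Residual T
  open Smallness T
  open Balanced T up down z-excess

  Ysum N : ℕ → ℕ
  Ysum i = ∑ D (λ c → Y (u i) c)
  N i = common (u i) (z i)

  rowYN≡ : ∀ i → rowYN i ≡ M * J * Ysum i
  rowYN≡ i = trans (∑-*ʳ D (M * J) _) (*-comm (Ysum i) (M * J))

  N≤ : ∀ i → M * N i ≤ M * J * Ysum i + devUp i
  N≤ i = begin
    M * N i ≡⟨ sym (∑-*ˡ D M _) ⟩
    ∑ D (λ c → M * (Y (u i) c * Y (z i) c)) ≤⟨ ∑-mono D (λ c _ → ≤-trans (≤-reflexive (l1 M (Y (u i) c) (Y (z i) c)))
        (*-monoʳ-≤ (Y (u i) c) (M*Y≤X (z i) c))) ⟩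
    rowYX i ≤⟨ m≤n+m∸n (rowYX i) (rowYN i) ⟩
    rowYN i + devUp i ≡⟨ cong (_+ devUp i) (rowYN≡ i) ⟩
    M * J * Ysum i + devUp i ∎
    where
    open ≤-Reasoning
    l1 : ∀ M a b → M * (a * b) ≡ a * (M * b)
    l1 = solve-∀

  -- Passing from X z back to Y z loses the partner's excess, magnified by at most `Ymax` = J G; the
  -- factor G is what `z-excess` cancels.
  ≤N : ∀ i → i < n → M * J * Ysum i ≤ M * N i + M * J * J * t + devDown i
  ≤N i lt = begin
    M * J * Ysum i ≡⟨ sym (rowYN≡ i) ⟩
    rowYN i ≤⟨ m≤n+m∸n (rowYN i) (rowYX i) ⟩
    rowYX i + devDown i ≤⟨ +-monoˡ-≤ (devDown i) YX≤ ⟩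
    M * N i + M * J * J * t + devDown i ∎
    where
    open ≤-Reasoning
    l1 : ∀ M a b → a * (M * b) ≡ M * (a * b)
    l1 = solve-∀
    l2 : ∀ J G W → J * G * W ≡ J * (G * W)
    l2 = solve-∀
    l3 : ∀ J M t → J * (M * J * t) ≡ M * J * J * t
    l3 = solve-∀
    YX≤ : rowYX i ≤ M * N i + M * J * J * t
    YX≤ = begin
      rowYX i ≤⟨ ∑-mono D (λ c _ → *-monoʳ-≤ (Y (u i) c) (m≤n+m∸n (X (z i) c) (M * Y (z i) c))) ⟩
      ∑ D (λ c → Y (u i) c * (M * Y (z i) c + (X (z i) c ∸ M * Y (z i) c)))
        ≤⟨ ∑-mono D (λ c c<D → ≤-trans (≤-reflexive (*-distribˡ-+ (Y (u i) c) _ _))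
             (+-mono-≤ (≤-reflexive (l1 M (Y (u i) c) (Y (z i) c))) (*-monoˡ-≤ _ (Y≤Ymax (u i) (u-bounded i (<⇒≤ lt)) c c<D)))) ⟩
      ∑ D (λ c → M * (Y (u i) c * Y (z i) c) + Ymax * (X (z i) c ∸ M * Y (z i) c)) ≡⟨ ∑-+ D _ _ ⟩
      ∑ D (λ c → M * (Y (u i) c * Y (z i) c)) + ∑ D (λ c → Ymax * (X (z i) c ∸ M * Y (z i) c))
        ≡⟨ cong₂ _+_ (∑-*ˡ D M _) (∑-*ˡ D Ymax _) ⟩
      M * N i + J * G * excess (z i) ≡⟨ cong (M * N i +_) (l2 J G (excess (z i))) ⟩
      M * N i + J * (G * excess (z i)) ≤⟨ +-monoʳ-≤ (M * N i) (*-monoʳ-≤ J (z-excess i lt)) ⟩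
      M * N i + J * (M * J * t) ≡⟨ cong (M * N i +_) (l3 J M t) ⟩
      M * N i + M * J * J * t ∎

  bad⁺ : ℕ → ℕ
  bad⁺ i = ⟦ M * J * J * t <? devUp i ⟧

  bads : ℕ → ℕ
  bads i = ∑ i bad⁺

  bads≤t : ∀ i → i ≤ n → bads i ≤ t
  bads≤t i i≤n = ≤-trans (∑-≤-range bad⁺ i≤n) (*-cancelʳ-≤ _ _ t (≤-trans
    (*-cancelˡ-≤ (M * J * J) {{m*n≢0 (M * J) J {{m*n≢0 M J}}}} (begin
      M * J * J * (bads n * t) ≡⟨ l1 (M * J * J) (bads n) t ⟩
      bads n * (M * J * J * t) ≤⟨ ∑-markov n devUp (M * J * J * t) ⟩
      ∑ n devUp ≤⟨ ∑devUp ⟩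
      J * G * (M * J * τ) ≡⟨ l2 J G M τ ⟩
      M * J * J * (G * τ) ∎)) Gτ≤tt))
    where
    open ≤-Reasoning
    l1 : ∀ a b t → a * (b * t) ≡ b * (a * t)
    l1 = solve-∀
    l2 : ∀ J G M τ → J * G * (M * J * τ) ≡ M * J * J * (G * τ)
    l2 = solve-∀

  n≤16Ggt : ∀ i → i ≤ n → #used i + 64 * (G * t) ≤ D
  n≤16Ggt i i≤n = begin
    #used i + 64 * (G * t) ≤⟨ +-monoˡ-≤ (64 * (G * t)) (≤-trans (#used≤ i i≤n) (≤-trans i≤n rows≤)) ⟩
    16 * (G * (g * t)) + 64 * (G * t) ≡⟨ l1 G g t ⟩
    16 * (G * (g + 4) * t) ≡⟨ cong (λ x → 16 * (G * x * t)) (sym G≡) ⟩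
    16 * (G * G * t) ≡⟨ sym D≡GGt ⟩
    D ∎
    where
    open ≤-Reasoning
    l1 : ∀ G g t → 16 * (G * (g * t)) + 64 * (G * t) ≡ 16 * (G * (g + 4) * t)
    l1 = solve-∀

  module At (i : ℕ) (i≤n : i ≤ n) where
    open ≤-Reasoning

    U F Q l : ℕ
    U = #used i
    F = D ∸ U
    Q = M ∸ Λ (u i)
    l = Λ (u i)

    U≤D : U ≤ D
    U≤D = ≤-trans (m≤m+n U _) (n≤16Ggt i i≤n)

    F+U : F + U ≡ D
    F+U = m∸n+n≡m U≤D

    Q+l : Q + l ≡ M
    Q+l = m∸n+n≡m (Λ≤M i i≤n)

    64Gt≤F : 64 * (G * t) ≤ F
    64Gt≤F = m+n≤o⇒m≤o∸n (64 * (G * t)) (subst (_≤ D) (+-comm U (64 * (G * t))) (n≤16Ggt i i≤n))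

    active+killed : #active i + #killed i ≡ F
    active+killed = +-cancelʳ-≡ U _ _ (trans (l1 (#active i) (#killed i) U) (trans (count-total i) (sym F+U)))
      where
      l1 : ∀ a k u → a + k + u ≡ a + u + k
      l1 = solve-∀

    -- For an active colour 1 - λ ≤ (1 - l) + 1/E; multiply by y and use y (1 - l) ≤ 1.
    yq : ∀ c → c < D → Y (u i) c * (E * Q) ≤ Y (u i) c * M + isActive (st (u i) c) * (E * J * M)
    yq c c<D = go (st (u i) c) refl
      where
      y = Y (u i) c
      go : ∀ s → st (u i) c ≡ s → y * (E * Q) ≤ y * M + isActive s * (E * J * M)
      go used s = subst (λ s → weight s (X (u i) c) * (E * Q) ≤ weight s (X (u i) c) * M + 0) (sym s) z≤n
      go killed s = subst (λ s → weight s (X (u i) c) * (E * Q) ≤ weight s (X (u i) c) * M + 0) (sym s) z≤n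
      go active s = begin
        y * (E * Q) ≤⟨ *-monoʳ-≤ y EQ≤ ⟩
        y * (E * q + M) ≡⟨ l1 y E q M ⟩
        y * M + E * (y * q) ≤⟨ +-monoʳ-≤ (y * M) (*-monoʳ-≤ E yq≤) ⟩
        y * M + E * (J * M) ≡⟨ l2 (y * M) E J M ⟩
        y * M + 1 * (E * J * M) ∎
        where
        module A = Active (active-inv i c i≤n c<D s)
        ℓ q : ℕ
        ℓ = L (u i) c
        q = M ∸ ℓ
        q+ℓ : q + ℓ ≡ M
        q+ℓ = m∸n+n≡m (A.L≤M i≤n)
        l1 : ∀ y E q M → y * (E * q + M) ≡ y * M + E * (y * q)
        l1 = solve-∀
        l2 : ∀ a E J M → a + E * (J * M) ≡ a + 1 * (E * J * M)
        l2 = solve-∀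
        EQ≤ : E * Q ≤ E * q + M
        EQ≤ = +-cancelʳ-≤ (E * l) _ _ (begin
          E * Q + E * l ≡⟨ sym (*-distribˡ-+ E Q l) ⟩
          E * (Q + l) ≡⟨ cong (E *_) (trans Q+l (sym q+ℓ)) ⟩
          E * (q + ℓ) ≡⟨ *-distribˡ-+ E q ℓ ⟩
          E * q + E * ℓ ≤⟨ +-monoʳ-≤ (E * q) A.over ⟩
          E * q + (E * l + M) ≡⟨ l3 (E * q) (E * l) M ⟩
          E * q + M + E * l ∎)
          where
          l3 : ∀ a b c → a + (b + c) ≡ a + c + b
          l3 = solve-∀
        yq≤ : y * q ≤ J * M
        yq≤ = *-cancelʳ-≤ _ _ M (begin
          y * q * M ≡⟨ l3 y q M ⟩
          y * M * q ≤⟨ *-monoˡ-≤ q (Y*M≤X i c) ⟩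
          X (u i) c * q ≤⟨ +-cancelʳ-≤ (X (u i) c * ℓ) _ _ (≤-trans (≤-reflexive
             (trans (sym (*-distribˡ-+ (X (u i) c) q ℓ)) (cong (X (u i) c *_) q+ℓ))) A.upper) ⟩
          J * M * M ∎)
          where
          l3 : ∀ y q M → y * q * M ≡ y * M * q
          l3 = solve-∀

    DQ+Dl : D * Q + D * l ≡ D * M
    DQ+Dl = trans (sym (*-distribˡ-+ D Q l)) (cong (D *_) Q+l)

    -- Summing `yq` gives y-total · (1 - λ - 1/E) ≤ F. As D / E = t, the hypothesis yields D (1 - λ
    -- - 1/E) ≥ F + 2 t, so the total is at most D F / (F + 2 t), and this is at most D - t because
    -- F + 2 t ≤ 2 D.
    Ysum-upper : D * l + 3 * t * M ≤ U * M → Ysum i + J * t ≤ J * D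
    Ysum-upper hU = *-cancelʳ-≤ _ _ (F + 2 * t) {{>-nonZero F+2t>0}} (begin
      (Ysum i + J * t) * (F + 2 * t) ≡⟨ *-distribʳ-+ (F + 2 * t) (Ysum i) (J * t) ⟩
      Ysum i * (F + 2 * t) + J * t * (F + 2 * t) ≤⟨ +-mono-≤ main (*-monoʳ-≤ (J * t) F+2t≤2D) ⟩
      F * D * J + J * t * (2 * D) ≡⟨ l1 F D J t ⟩
      J * D * (F + 2 * t) ∎)
      where
      l1 : ∀ F D J t → F * D * J + J * t * (2 * D) ≡ J * D * (F + 2 * t)
      l1 = solve-∀
      F+2t>0 : 0 < F + 2 * t
      F+2t>0 = ≤-trans t>0 (≤-trans (m≤m+n t (1 * t)) (m≤n+m (2 * t) F))
      F+2t≤2D : F + 2 * t ≤ 2 * D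
      F+2t≤2D = ≤-trans (+-mono-≤ (m∸n≤m D U) 2t≤D) (≤-reflexive (cong (D +_) (sym (+-identityʳ D))))
      total : Ysum i * (E * Q) ≤ Ysum i * M + #active i * (E * J * M)
      total = subst₂ _≤_ (∑-*ʳ D (E * Q) _) (trans (∑-+ D _ _) (cong₂ _+_ (∑-*ʳ D M _) (∑-*ʳ D (E * J * M) _)))
                (∑-mono D yq)
      DQ≥ : F * M + 3 * t * M ≤ D * Q
      DQ≥ = +-cancelʳ-≤ (D * l) _ _ (begin
        F * M + 3 * t * M + D * l ≡⟨ l2 (F * M) (3 * t * M) (D * l) ⟩
        F * M + (D * l + 3 * t * M) ≤⟨ +-monoʳ-≤ (F * M) hU ⟩
        F * M + U * M ≡⟨ trans (sym (*-distribʳ-+ M F U)) (cong (_* M) F+U) ⟩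
        D * M ≡⟨ sym DQ+Dl ⟩
        D * Q + D * l ∎)
        where
        l2 : ∀ a b c → a + b + c ≡ a + (c + b)
        l2 = solve-∀
      main : Ysum i * (F + 2 * t) ≤ F * D * J
      main = *-cancelʳ-≤ _ _ M (+-cancelʳ-≤ (t * (Ysum i * M)) _ _ (begin
        Ysum i * (F + 2 * t) * M + t * (Ysum i * M) ≡⟨ l2 (Ysum i) F t M ⟩
        Ysum i * (F * M + 3 * t * M) ≤⟨ *-monoʳ-≤ (Ysum i) DQ≥ ⟩
        Ysum i * (D * Q) ≡⟨ cong (λ x → Ysum i * (x * Q)) D≡ ⟩
        Ysum i * (E * t * Q) ≡⟨ l3 (Ysum i) E t Q ⟩
        t * (Ysum i * (E * Q)) ≤⟨ *-monoʳ-≤ t total ⟩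
        t * (Ysum i * M + #active i * (E * J * M)) ≤⟨ *-monoʳ-≤ t (+-monoʳ-≤ (Ysum i * M) (*-monoˡ-≤ (E * J * M)
            (subst (#active i ≤_) active+killed (m≤m+n _ _)))) ⟩
        t * (Ysum i * M + F * (E * J * M)) ≡⟨ l4 t (Ysum i * M) F E J M ⟩
        F * (E * t) * J * M + t * (Ysum i * M) ≡⟨ cong (λ x → F * x * J * M + t * (Ysum i * M)) (sym D≡) ⟩
        F * D * J * M + t * (Ysum i * M) ∎))
        where
        l2 : ∀ y F t M → y * (F + 2 * t) * M + t * (y * M) ≡ y * (F * M + 3 * t * M)
        l2 = solve-∀
        l3 : ∀ y E t Q → y * (E * t * Q) ≡ t * (y * (E * Q))
        l3 = solve-∀
        l4 : ∀ t a F E J M → t * (a + F * (E * J * M)) ≡ F * (E * t) * J * M + t * a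
        l4 = solve-∀

  -- Barrier: once M #used exceeds D Λ by 3 t M, only rows with a large upward deviation can push the difference further.
  barrier : ∀ i → i ≤ n → #used i * M ≤ D * Λ (u i) + M * (3 * t + 1 + bads i)
  barrier zero _ = ≤-trans (*-monoˡ-≤ M (#used≤ 0 z≤n)) z≤n
  barrier (suc i) lt = subst₂ (λ a b → a * M ≤ D * b + M * (3 * t + 1 + bads (suc i)))
      (sym (#used-suc i lt)) (sym (Λ-suc i lt)) (go (0 <? m i) (#used i * M + M ≤? D * Λ (u i) + M * (3 * t + 1 + bads i)) (M * J * J * t <? devUp i))
    where
    open ≤-Reasoning
    i≤n = <⇒≤ lt
    module A = At i i≤n
    U l b k : ℕ
    U = #used i
    l = Λ (u i)
    b = bads i
    k = 3 * t + 1
    ih : U * M ≤ D * l + M * (k + b)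
    ih = barrier i i≤n
    weaken : ∀ {x} b′ → x ≤ D * l + M * (k + b) → b ≤ b′ → x ≤ D * (l + J * J * m i) + M * (k + b′)
    weaken b′ h bb = ≤-trans h (+-mono-≤ (*-monoʳ-≤ D (m≤m+n l _)) (*-monoʳ-≤ M (+-monoʳ-≤ k bb)))
    U+1 : (U + 1) * M ≡ U * M + M
    U+1 = trans (*-distribʳ-+ M U 1) (cong (U * M +_) (*-identityˡ M))
    hU : ¬ (U * M + M ≤ D * l + M * (k + b)) → D * l + 3 * t * M ≤ U * M
    hU ¬h = +-cancelʳ-≤ M _ _ (≤-trans (≤-by (M * b) (l1 (D * l) t M b)) (<⇒≤ (≰⇒> ¬h)))
      where
      l1 : ∀ a t M b → a + 3 * t * M + M + M * b ≡ a + M * (3 * t + 1 + b)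
      l1 = solve-∀
    go : (d : Dec (0 < m i)) → Dec (U * M + M ≤ D * l + M * (k + b)) → (e : Dec (M * J * J * t < devUp i))
      → (U + ⟦ d ⟧) * M ≤ D * (l + J * J * m i) + M * (k + (b + bad⁺ i))
    go (no _) _ _ = subst (λ x → x * M ≤ D * (l + J * J * m i) + M * (k + (b + bad⁺ i))) (sym (+-identityʳ U)) (weaken (b + bad⁺ i) ih (m≤m+n b (bad⁺ i)))
    go (yes _) (yes slack) _ = subst (_≤ D * (l + J * J * m i) + M * (k + (b + bad⁺ i))) (sym U+1) (weaken (b + bad⁺ i) slack (m≤m+n b (bad⁺ i)))
    go (yes _) (no _) (yes bad) = begin
      (U + 1) * M ≡⟨ U+1 ⟩
      U * M + M ≤⟨ +-monoˡ-≤ M ih ⟩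
      D * l + M * (k + b) + M ≡⟨ l1 (D * l) M k b ⟩
      D * l + M * (k + (b + 1)) ≤⟨ +-monoˡ-≤ _ (*-monoʳ-≤ D (m≤m+n l _)) ⟩
      D * (l + J * J * m i) + M * (k + (b + 1)) ≡⟨ cong (λ x → D * (l + J * J * m i) + M * (k + (b + x))) (sym (⟦⟧-yes (M * J * J * t <? devUp i) bad)) ⟩
      D * (l + J * J * m i) + M * (k + (b + bad⁺ i)) ∎
      where
      l1 : ∀ a M k b → a + M * (k + b) + M ≡ a + M * (k + (b + 1))
      l1 = solve-∀
    go (yes pos) (no ¬slack) (no good) = begin
      (U + 1) * M ≡⟨ U+1 ⟩
      U * M + M ≤⟨ +-mono-≤ ih M≤ ⟩
      D * l + M * (k + b) + D * (J * J * m i) ≡⟨ l1 D l (M * (k + b)) (J * J * m i) ⟩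
      D * (l + J * J * m i) + M * (k + b) ≤⟨ +-monoʳ-≤ _ (*-monoʳ-≤ M (+-monoʳ-≤ k (m≤m+n b (bad⁺ i)))) ⟩
      D * (l + J * J * m i) + M * (k + (b + bad⁺ i)) ∎
      where
      l1 : ∀ D l a x → D * l + a + D * x ≡ D * (l + x) + a
      l1 = solve-∀
      -- The surplus J t in `Ysum-upper` absorbs the tolerated deviation M J J t of this row.
      N≤JJD : N i ≤ J * J * D
      N≤JJD = *-cancelˡ-≤ M (begin
        M * N i ≤⟨ N≤ i ⟩
        M * J * Ysum i + devUp i ≤⟨ +-monoʳ-≤ (M * J * Ysum i) (≮⇒≥ good) ⟩
        M * J * Ysum i + M * J * J * t ≡⟨ l2 M J (Ysum i) t ⟩
        M * J * (Ysum i + J * t) ≤⟨ *-monoʳ-≤ (M * J) (A.Ysum-upper (hU ¬slack)) ⟩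
        M * J * (J * D) ≡⟨ l3 M J D ⟩
        M * (J * J * D) ∎)
        where
        l2 : ∀ M J y t → M * J * y + M * J * J * t ≡ M * J * (y + J * t)
        l2 = solve-∀
        l3 : ∀ M J D → M * J * (J * D) ≡ M * (J * J * D)
        l3 = solve-∀
      M≤ : M ≤ D * (J * J * m i)
      M≤ = begin
        M ≡⟨ sym (rate-exact _ (common-fits i lt) pos) ⟩
        N i * m i ≤⟨ *-monoˡ-≤ (m i) N≤JJD ⟩
        J * J * D * m i ≡⟨ l2 J D (m i) ⟩
        D * (J * J * m i) ∎
        where
        l2 : ∀ J D m → J * J * D * m ≡ D * (J * J * m)
        l2 = solve-∀

-- The sampling total N from below, and the rows that fail to be sampled

module FewFailures {p : Params} {n : ℕ} (T : Trajectory p n)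
  (up : Residual.TestUp T) (down : Residual.TestDown T)
  (z-excess : ∀ i → i < n → Params.G p * Residual.excess T (Trajectory.z T i) ≤ Params.M p * Params.J p * Params.t p) where
  open Params p
  open ParamFacts p
  open Trajectory T
  open Residual T
  open Smallness T
  open Balanced T up down z-excess
  open Conclusion T up down z-excess

  module Lower (i : ℕ) (i≤n : i ≤ n) where
    open At i i≤n
    open ≤-Reasoning

    -- In real terms V / (e₁ M) = (1 - λ) + 1/e₁, where 1/e₁ accounts for the factor e / e₁ in the
    -- lower invariant.
    V : ℕ
    V = e₁ * Q + M

    DQ≤ : D * Q ≤ (F + 5 * t) * M
    DQ≤ = +-cancelʳ-≤ (U * M) _ _ (begin
      D * Q + U * M ≤⟨ +-monoʳ-≤ (D * Q) (barrier i i≤n) ⟩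
      D * Q + (D * l + M * (3 * t + 1 + bads i)) ≡⟨ sym (+-assoc (D * Q) _ _) ⟩
      D * Q + D * l + M * (3 * t + 1 + bads i) ≤⟨ +-mono-≤ (≤-reflexive DQ+Dl) (*-monoʳ-≤ M (+-mono-≤ (+-monoʳ-≤ (3 * t) t>0) (bads≤t i i≤n))) ⟩
      D * M + M * (3 * t + t + t) ≡⟨ cong (λ x → x * M + M * (3 * t + t + t)) (sym F+U) ⟩
      (F + U) * M + M * (3 * t + t + t) ≡⟨ l1 F U M t ⟩
      (F + 5 * t) * M + U * M ∎)
      where
      l1 : ∀ F U M t → (F + U) * M + M * (3 * t + t + t) ≡ (F + 5 * t) * M + U * M
      l1 = solve-∀

    DV≤ : D * V ≤ e₁ * M * (F + 6 * t)
    DV≤ = begin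
      D * (e₁ * Q + M) ≡⟨ l1 D e₁ Q M ⟩
      e₁ * (D * Q) + D * M ≤⟨ +-mono-≤ (*-monoʳ-≤ e₁ DQ≤) (*-monoˡ-≤ M D≤e₁t) ⟩
      e₁ * ((F + 5 * t) * M) + e₁ * t * M ≡⟨ l2 e₁ F t M ⟩
      e₁ * M * (F + 6 * t) ∎
      where
      l1 : ∀ D e Q M → D * (e * Q + M) ≡ e * (D * Q) + D * M
      l1 = solve-∀
      l2 : ∀ e F t M → e * ((F + 5 * t) * M) + e * t * M ≡ e * M * (F + 6 * t)
      l2 = solve-∀

    V>0 : 0 < V
    V>0 = ≤-trans M>0 (m≤n+m M (e₁ * Q))

    GV≥ : 2 * (e₁ * M) ≤ G * V
    GV≥ = begin
      2 * (e₁ * M) ≤⟨ ≤-by (e₁ * M) (l1 e₁ M) ⟩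
      e₁ * (3 * M) ≤⟨ *-monoʳ-≤ e₁ 3M≤GQ ⟩
      e₁ * (G * Q) ≤⟨ ≤-by (G * M) (l2 e₁ G Q M) ⟩
      G * (e₁ * Q + M) ∎
      where
      l1 : ∀ e M → 2 * (e * M) + e * M ≡ e * (3 * M)
      l1 = solve-∀
      l2 : ∀ e G Q M → e * (G * Q) + G * M ≡ G * (e * Q + M)
      l2 = solve-∀
      3M≤GQ : 3 * M ≤ G * Q
      3M≤GQ = +-cancelʳ-≤ (G * l) _ _ (begin
        3 * M + G * l ≡⟨ cong (λ x → 3 * M + x * l) G≡ ⟩
        3 * M + (g + 4) * l ≡⟨ l3 M g l ⟩
        (g + 3) * l + (l + 3 * M) ≤⟨ +-mono-≤ (Λ-ratio i i≤n) (+-monoˡ-≤ (3 * M) (Λ≤M i i≤n)) ⟩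
        g * M + (M + 3 * M) ≡⟨ l4 g M ⟩
        (g + 4) * M ≡⟨ cong₂ _*_ (sym G≡) (sym Q+l) ⟩
        G * (Q + l) ≡⟨ *-distribˡ-+ G Q l ⟩
        G * Q + G * l ∎)
        where
        l3 : ∀ M g l → 3 * M + (g + 4) * l ≡ (g + 3) * l + (l + 3 * M)
        l3 = solve-∀
        l4 : ∀ g M → g * M + (M + 3 * M) ≡ (g + 4) * M
        l4 = solve-∀

    K : ℕ
    K = e₁ * J * M * M

    -- The lower invariant bounds x below by K / (V + e₁ h) with h the gap of c. Replacing this
    -- convex function of h by its tangent makes the bound linear in h, so after summation only the
    -- total gap matters.
    column : ∀ c → c < D → isActive (st (u i) c) * (K * V) ≤ (Y (u i) c * M + M) * (V * V) + K * e₁ * gap i c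
    column c c<D = go (st (u i) c) refl
      where
      x = X (u i) c
      hc = Λ (u i) ∸ L (u i) c
      go : ∀ s → st (u i) c ≡ s → isActive s * (K * V) ≤ (Y (u i) c * M + M) * (V * V) + K * e₁ * (isActive (st (u i) c) * hc)
      go used _ = z≤n
      go killed _ = z≤n
      go active s = begin
        1 * (K * V) ≡⟨ *-identityˡ (K * V) ⟩
        K * V ≤⟨ tangent x V (e₁ * hc) K K≤ ⟩
        x * V * V + K * (e₁ * hc) ≡⟨ l1 x V K e₁ hc ⟩
        x * (V * V) + K * e₁ * (1 * hc) ≤⟨ +-monoˡ-≤ _ (*-monoˡ-≤ (V * V) (≤-trans (X≤Y+1 i c i≤n s a) (≤-reflexive (l2 (Y (u i) c) M)))) ⟩
        (Y (u i) c * M + M) * (V * V) + K * e₁ * (1 * hc)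
          ≡⟨ cong (λ s → (Y (u i) c * M + M) * (V * V) + K * e₁ * (isActive s * hc)) (sym s) ⟩
        (Y (u i) c * M + M) * (V * V) + K * e₁ * (isActive (st (u i) c) * hc) ∎
        where
        a = active-inv i c i≤n c<D s
        module A = Active a
        l1 : ∀ x V K e h → x * V * V + K * (e * h) ≡ x * (V * V) + K * e * (1 * h)
        l1 = solve-∀
        l2 : ∀ y M → (y + 1) * M ≡ y * M + M
        l2 = solve-∀
        ℓ q : ℕ
        ℓ = L (u i) c
        q = M ∸ ℓ
        q+ℓ : q + ℓ ≡ M
        q+ℓ = m∸n+n≡m (A.L≤M i≤n)
        q≤ : q ≤ Q + hc
        q≤ = +-cancelʳ-≤ ℓ _ _ (begin
          q + ℓ ≡⟨ trans q+ℓ (sym Q+l) ⟩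
          Q + l ≤⟨ +-monoʳ-≤ Q (m≤n+m∸n l ℓ) ⟩
          Q + (ℓ + hc) ≡⟨ l3 Q ℓ hc ⟩
          Q + hc + ℓ ∎)
          where
          l3 : ∀ a b c → a + (b + c) ≡ a + c + b
          l3 = solve-∀
        K≤ : K ≤ x * (V + e₁ * hc)
        K≤ = begin
          K ≤⟨ +-cancelʳ-≤ (e * x * ℓ) _ _ (≤-trans A.lower (≤-reflexive eq)) ⟩
          x * (e * q + M) ≤⟨ *-monoʳ-≤ x (+-monoˡ-≤ M (*-mono-≤ (≤-trans (n≤1+n e) (≤-reflexive (sym e₁≡suc))) q≤)) ⟩
          x * (e₁ * (Q + hc) + M) ≡⟨ cong (x *_) (l4 e₁ Q hc M) ⟩
          x * (V + e₁ * hc) ∎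
          where
          l4 : ∀ e Q h M → e * (Q + h) + M ≡ e * Q + M + e * h
          l4 = solve-∀
          l5 : ∀ x e q l → x * (1 + e) * (q + l) ≡ x * (e * q + (q + l)) + e * x * l
          l5 = solve-∀
          eq : x * e₁ * M ≡ x * (e * q + M) + e * x * ℓ
          eq = trans (cong₂ (λ a b → x * a * b) e₁≡suc (sym q+ℓ)) (trans (l5 x e q ℓ) (cong (λ b → x * (e * q + b) + e * x * ℓ) q+ℓ))

    summed : #active i * (K * V) ≤ (Ysum i + D) * M * (V * V) + K * e₁ * gaps i
    summed = begin
      #active i * (K * V) ≡⟨ sym (∑-*ʳ D (K * V) _) ⟩
      ∑ D (λ c → isActive (st (u i) c) * (K * V)) ≤⟨ ∑-mono D column ⟩
      ∑ D (λ c → (Y (u i) c * M + M) * (V * V) + K * e₁ * gap i c) ≡⟨ ∑-+ D _ _ ⟩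
      ∑ D (λ c → (Y (u i) c * M + M) * (V * V)) + ∑ D (λ c → K * e₁ * gap i c)
        ≡⟨ cong₂ _+_ (trans (∑-*ʳ D (V * V) _) (cong (_* (V * V)) (trans (∑-+ D _ _) (cong₂ _+_ (∑-*ʳ D M _) (∑-const D M)))))
                     (∑-*ˡ D (K * e₁) (gap i)) ⟩
      (Ysum i * M + D * M) * (V * V) + K * e₁ * gaps i ≡⟨ cong (λ a → a * (V * V) + K * e₁ * gaps i) (sym (*-distribʳ-+ M (Ysum i) D)) ⟩
      (Ysum i + D) * M * (V * V) + K * e₁ * gaps i ∎

    open LowGap i i≤n using (gaps-small)

    e₁gaps : e₁ * gaps i ≤ t * V
    e₁gaps = *-cancelˡ-≤ G (begin
      G * (e₁ * gaps i) ≡⟨ l1 G e₁ (gaps i) ⟩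
      e₁ * (G * gaps i) ≤⟨ *-monoʳ-≤ e₁ gaps-small ⟩
      e₁ * (2 * t * M) ≡⟨ l2 e₁ t M ⟩
      t * (2 * (e₁ * M)) ≤⟨ *-monoʳ-≤ t GV≥ ⟩
      t * (G * V) ≡⟨ l1 t G V ⟩
      G * (t * V) ∎)
      where
      l1 : ∀ a b c → a * (b * c) ≡ b * (a * c)
      l1 = solve-∀
      l2 : ∀ e t M → e * (2 * t * M) ≡ t * (2 * (e * M))
      l2 = solve-∀

    free≤ : ∀ Z → Ysum i + D ≤ J * Z → D * F ≤ Z * (F + 6 * t) + 2 * t * D
    free≤ Z hZ = *-cancelˡ-≤ (e₁ * M) {{m*n≢0 e₁ M {{subst NonZero (sym e₁≡suc) _}}}} (begin
        e₁ * M * (D * F) ≡⟨ l1 (e₁ * M) D F ⟩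
        D * (e₁ * M * F) ≤⟨ *-monoʳ-≤ D eMF≤ ⟩
        D * (Z * V + e₁ * M * (2 * t)) ≡⟨ l2 D Z V (e₁ * M) t ⟩
        Z * (D * V) + e₁ * M * (2 * t * D) ≤⟨ +-monoˡ-≤ _ (*-monoʳ-≤ Z DV≤) ⟩
        Z * (e₁ * M * (F + 6 * t)) + e₁ * M * (2 * t * D) ≡⟨ l3 Z (e₁ * M) (F + 6 * t) (2 * t * D) ⟩
        e₁ * M * (Z * (F + 6 * t) + 2 * t * D) ∎)
      where
      l1 : ∀ a D F → a * (D * F) ≡ D * (a * F)
      l1 = solve-∀
      l2 : ∀ D Z V a t → D * (Z * V + a * (2 * t)) ≡ Z * (D * V) + a * (2 * t * D)
      l2 = solve-∀
      l3 : ∀ Z a b c → Z * (a * b) + a * c ≡ a * (Z * b + c)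
      l3 = solve-∀
      active≤ : #active i * (e₁ * M) ≤ Z * V + e₁ * M * t
      active≤ = *-cancelˡ-≤ (J * M * V) {{m*n≢0 (J * M) V {{m*n≢0 J M}} {{>-nonZero V>0}}}} (begin
        J * M * V * (#active i * (e₁ * M)) ≡⟨ l4 J M V (#active i) e₁ ⟩
        #active i * (K * V) ≤⟨ summed ⟩
        (Ysum i + D) * M * (V * V) + K * e₁ * gaps i ≤⟨ +-mono-≤ (*-monoˡ-≤ (V * V) (*-monoˡ-≤ M hZ))
            (≤-trans (≤-reflexive (*-assoc K e₁ (gaps i))) (*-monoʳ-≤ K e₁gaps)) ⟩
        J * Z * M * (V * V) + e₁ * J * M * M * (t * V) ≡⟨ l5 J Z M V e₁ t ⟩
        J * M * V * (Z * V + e₁ * M * t) ∎)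
        where
        l4 : ∀ J M V a e → J * M * V * (a * (e * M)) ≡ a * (e * J * M * M * V)
        l4 = solve-∀
        l5 : ∀ J Z M V e t → J * Z * M * (V * V) + e * J * M * M * (t * V) ≡ J * M * V * (Z * V + e * M * t)
        l5 = solve-∀
      eMF≤ : e₁ * M * F ≤ Z * V + e₁ * M * (2 * t)
      eMF≤ = begin
        e₁ * M * F ≡⟨ cong (e₁ * M *_) (sym active+killed) ⟩
        e₁ * M * (#active i + #killed i) ≡⟨ trans (*-distribˡ-+ (e₁ * M) _ _) (cong (_+ e₁ * M * #killed i) (*-comm (e₁ * M) (#active i))) ⟩
        #active i * (e₁ * M) + e₁ * M * #killed i ≤⟨ +-mono-≤ active≤ (*-monoʳ-≤ (e₁ * M)
            (≤-trans (m≤n*m (#killed i) (4 * (G * G)) {{4GG≢0}}) (killed-small up i i≤n))) ⟩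
        Z * V + e₁ * M * t + e₁ * M * t ≡⟨ l4 (Z * V) (e₁ * M) t ⟩
        Z * V + e₁ * M * (2 * t) ∎
        where
        l4 : ∀ a b t → a + b * t + b * t ≡ a + b * (2 * t)
        l4 = solve-∀

    -- Almost every free colour has x of at least about 1 / (1 - λ), and by the barrier D (1 - λ) is
    -- at most F + 5 t, so the total is close to D. The errors are of order t relative to F, and F ≥
    -- 64 G t keeps them below 8 G t.
    Ysum-lower : J * D ≤ Ysum i + 8 * (G * t) * J
    Ysum-lower with J * D ≤? Ysum i + 8 * (G * t) * J
    ... | yes h = h
    ... | no ¬h = contradiction impossible (<⇒≱ small)
      where
      8Gt = 8 * (G * t)
      -- The largest total allowed by the negated claim; the extra t covers the rounding of D
      -- colours, since D ≤ J t.
      Z = D + t ∸ 8Gt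
      8Gt≤D : 8Gt ≤ D
      8Gt≤D = ≤-trans (*-monoˡ-≤ (G * t) {8} {16} (≤ᵇ⇒≤ 8 16 _)) (≤-trans 16Gt≤Dh Dh≤D)
      Z+ : Z + 8Gt ≡ D + t
      Z+ = m∸n+n≡m (≤-trans 8Gt≤D (m≤m+n D t))
      Ysum+D≤ : Ysum i + D ≤ J * Z
      Ysum+D≤ = +-cancelʳ-≤ (J * 8Gt) _ _ (begin
        Ysum i + D + J * 8Gt ≡⟨ l1 (Ysum i) D J 8Gt ⟩
        Ysum i + 8Gt * J + D ≤⟨ +-mono-≤ (<⇒≤ (≰⇒> ¬h)) D≤Jt ⟩
        J * D + J * t ≡⟨ sym (*-distribˡ-+ J D t) ⟩
        J * (D + t) ≡⟨ cong (J *_) (sym Z+) ⟩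
        J * (Z + 8Gt) ≡⟨ *-distribˡ-+ J Z 8Gt ⟩
        J * Z + J * 8Gt ∎)
        where
        l1 : ∀ y D J a → y + D + J * a ≡ y + a * J + D
        l1 = solve-∀
      S : ℕ
      S = F + 6 * t
      impossible : 8 * (G * t) * S ≤ t * (8 * D + S)
      impossible = +-cancelˡ-≤ (D * F + Z * S) _ _ (begin
        D * F + Z * S + 8Gt * S ≤⟨ +-monoˡ-≤ (8Gt * S) (+-monoˡ-≤ (Z * S) (free≤ Z Ysum+D≤)) ⟩
        Z * S + 2 * t * D + Z * S + 8Gt * S ≡⟨ l1 Z S t D 8Gt ⟩
        (Z + 8Gt) * S + (Z * S + 2 * t * D) ≡⟨ cong (λ a → a * S + (Z * S + 2 * t * D)) Z+ ⟩
        (D + t) * (F + 6 * t) + (Z * S + 2 * t * D) ≡⟨ l2 D t F (Z * S) ⟩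
        D * F + Z * S + t * (8 * D + S) ∎)
        where
        l1 : ∀ Z S t D a → Z * S + 2 * t * D + Z * S + a * S ≡ (Z + a) * S + (Z * S + 2 * t * D)
        l1 = solve-∀
        l2 : ∀ D t F a → (D + t) * (F + 6 * t) + (a + 2 * t * D) ≡ D * F + a + t * (8 * D + (F + 6 * t))
        l2 = solve-∀
      small : t * (8 * D + S) < 8 * (G * t) * S
      small = begin-strict
        t * (8 * D + S) <⟨ *-monoʳ-< t (+-monoˡ-< S 8D<) ⟩
        t * (7 * G * S + S) ≤⟨ *-monoʳ-≤ t (+-monoʳ-≤ (7 * G * S) (m≤n*m S G)) ⟩
        t * (7 * G * S + G * S) ≡⟨ l1 t G S ⟩
        8 * (G * t) * S ∎
        where
        l1 : ∀ t G S → t * (7 * G * S + G * S) ≡ 8 * (G * t) * S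
        l1 = solve-∀
        l2 : ∀ G t → 8 * (16 * (G * G * t)) + 320 * (G * G * t) ≡ 7 * G * (64 * (G * t))
        l2 = solve-∀
        8D< : 8 * D < 7 * G * S
        8D< = begin-strict
          8 * D ≡⟨ cong (8 *_) D≡GGt ⟩
          8 * (16 * (G * G * t)) <⟨ m<m+n _ (>-nonZero⁻¹ (320 * (G * G * t)) {{m*n≢0 320 (G * G * t) {{_}} {{m*n≢0 (G * G) t {{m*n≢0 G G}}}}}}) ⟩
          8 * (16 * (G * G * t)) + 320 * (G * G * t) ≡⟨ l2 G t ⟩
          7 * G * (64 * (G * t)) ≤⟨ *-monoʳ-≤ (7 * G) (≤-trans 64Gt≤F (m≤m+n F (6 * t))) ⟩
          7 * G * S ∎

  -- The margin D - Dh = 16 G t is spent as follows: 8 G t on `Ysum-lower`, 4 G t on the deviation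
  -- of the row, and t ≤ 4 G t on the excess of the partner.
  coloured : ∀ i → i < n → devDown i ≤ M * J * J * (4 * (G * t)) → 0 < m i
  coloured i lt h = rate-pos (N i) (common-fits i lt) (≤-trans thr>0 thr≤N) thr≤N
    where
    open ≤-Reasoning
    open Lower i (<⇒≤ lt)
    thr>0 : 0 < thr
    thr>0 = *-mono-≤ (*-mono-≤ J>0 J>0) Dh>0
    JY≤ : J * Ysum i ≤ N i + J * J * (t + 4 * (G * t))
    JY≤ = *-cancelˡ-≤ M (begin
      M * (J * Ysum i) ≡⟨ sym (*-assoc M J (Ysum i)) ⟩
      M * J * Ysum i ≤⟨ ≤N i lt ⟩
      M * N i + M * J * J * t + devDown i ≤⟨ +-monoʳ-≤ (M * N i + M * J * J * t) h ⟩
      M * N i + M * J * J * t + M * J * J * (4 * (G * t)) ≡⟨ l1 M (N i) J t (4 * (G * t)) ⟩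
      M * (N i + J * J * (t + 4 * (G * t))) ∎)
      where
      l1 : ∀ M N J t a → M * N + M * J * J * t + M * J * J * a ≡ M * (N + J * J * (t + a))
      l1 = solve-∀
    thr≤N : thr ≤ N i
    thr≤N = +-cancelʳ-≤ (J * J * 16Gt) _ _ (begin
      J * J * Dh + J * J * 16Gt ≡⟨ trans (sym (*-distribˡ-+ (J * J) Dh 16Gt)) (trans (cong (J * J *_) Dh+) (*-assoc J J D)) ⟩
      J * (J * D) ≤⟨ *-monoʳ-≤ J Ysum-lower ⟩
      J * (Ysum i + 8 * (G * t) * J) ≡⟨ l1 J (Ysum i) (G * t) ⟩
      J * Ysum i + J * J * (8 * (G * t)) ≤⟨ +-monoˡ-≤ _ JY≤ ⟩
      N i + J * J * (t + 4 * (G * t)) + J * J * (8 * (G * t)) ≤⟨ +-monoˡ-≤ (J * J * (8 * (G * t)))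
          (+-monoʳ-≤ (N i) (*-monoʳ-≤ (J * J) (+-monoˡ-≤ (4 * (G * t)) (≤-trans t≤Gt (m≤n*m (G * t) 4))))) ⟩
      N i + J * J * (4 * (G * t) + 4 * (G * t)) + J * J * (8 * (G * t)) ≡⟨ l2 (N i) (J * J) (G * t) ⟩
      N i + J * J * 16Gt ∎)
      where
      l1 : ∀ J y a → J * (y + 8 * a * J) ≡ J * y + J * J * (8 * a)
      l1 = solve-∀
      l2 : ∀ N j a → N + j * (4 * a + 4 * a) + j * (8 * a) ≡ N + j * (16 * a)
      l2 = solve-∀

  -- By `coloured` every row without a colour has a large downward deviation, and Markov's
  -- inequality bounds the number of such rows by means of `∑devDown`.
  few-failures : ∑ n (λ i → ⟦ m i ≟ 0 ⟧) ≤ t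
  few-failures = *-cancelʳ-≤ _ _ t (*-cancelˡ-≤ (M * J * J) {{m*n≢0 (M * J) J {{m*n≢0 M J}}}} (*-cancelˡ-≤ (4 * G) {{m*n≢0 4 G}} (begin
      4 * G * (M * J * J * (f * t)) ≡⟨ l1 G (M * J * J) f t ⟩
      f * h ≤⟨ *-monoˡ-≤ h (∑-mono n (λ i lt → ⟦⟧-⇒ (m i ≟ 0) (h <? devDown i) (bad i lt))) ⟩
      ∑ n (λ i → ⟦ h <? devDown i ⟧) * h ≤⟨ ∑-markov n devDown h ⟩
      ∑ n devDown ≤⟨ ∑devDown ⟩
      J * G * (M * J * τ) ≤⟨ *-monoʳ-≤ (J * G) (*-monoʳ-≤ (M * J) τ≤tt) ⟩
      J * G * (M * J * (t * t)) ≤⟨ ≤-by (3 * (J * G * (M * J * (t * t)))) (l2 J G M t) ⟩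
      4 * G * (M * J * J * (t * t)) ∎)))
    where
    open ≤-Reasoning
    f h : ℕ
    f = ∑ n (λ i → ⟦ m i ≟ 0 ⟧)
    h = M * J * J * (4 * (G * t))
    l1 : ∀ G a f t → 4 * G * (a * (f * t)) ≡ f * (a * (4 * (G * t)))
    l1 = solve-∀
    l2 : ∀ J G M t → J * G * (M * J * (t * t)) + 3 * (J * G * (M * J * (t * t))) ≡ 4 * G * (M * J * J * (t * t))
    l2 = solve-∀
    bad : ∀ i → i < n → m i ≡ 0 → h < devDown i
    bad i lt m≡0 with h <? devDown i
    ... | yes b = b
    ... | no ¬b = contradiction m≡0 (λ e → <⇒≢ (coloured i lt (≮⇒≥ ¬b)) (sym e))

-- Rows and links in a simple graph

deg-cons : ∀ {n} (w : Fin n) e es → deg w (e ∷ es) ≡ inc w e + deg w es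
deg-cons w e es with incident? w e in eq
... | yes i = cong length (filter-accept (incident? w) {e} {es} i)
... | no ¬i = cong length (filter-reject (incident? w) {e} {es} ¬i)

rowsum : ∀ {n} → Fin n → (Fin n → ℕ) → List (Edge n) → ℕ
rowsum w g [] = 0
rowsum w g (e ∷ es) = inc w e * g (other w e) + rowsum w g es

rowsum-+ : ∀ {n} (w : Fin n) f g es → rowsum w (λ v → f v + g v) es ≡ rowsum w f es + rowsum w g es
rowsum-+ w f g [] = refl
rowsum-+ w f g (e ∷ es) = trans (cong (inc w e * (f (other w e) + g (other w e)) +_) (rowsum-+ w f g es))
  (lemma (inc w e) (f (other w e)) (g (other w e)) (rowsum w f es) (rowsum w g es))
  where
  lemma : ∀ k a b c d → k * (a + b) + (c + d) ≡ k * a + c + (k * b + d)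
  lemma = solve-∀

rowsum-mono : ∀ {n} (w : Fin n) {f g} es → (∀ v → f v ≤ g v) → rowsum w f es ≤ rowsum w g es
rowsum-mono w [] h = z≤n
rowsum-mono w (e ∷ es) h = +-mono-≤ (*-monoʳ-≤ (inc w e) (h (other w e))) (rowsum-mono w es h)

rowsum-const : ∀ {n} (w : Fin n) k es → rowsum w (λ _ → k) es ≡ deg w es * k
rowsum-const w k [] = refl
rowsum-const w k (e ∷ es) = trans (cong (inc w e * k +_) (rowsum-const w k es))
  (trans (sym (*-distribʳ-+ k (inc w e) (deg w es))) (cong (_* k) (sym (deg-cons w e es))))

occ-rowsum : ∀ {n} (w x : Fin n) es → occ w x es ≡ rowsum w (λ v → ⟦ v FinP.≟ x ⟧) es
occ-rowsum w x [] = refl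
occ-rowsum w x (e ∷ es) = cong (inc w e * ⟦ other w e FinP.≟ x ⟧ +_) (occ-rowsum w x es)

ends≤inc : ∀ {n} (v : Fin n) e → proj₁ e ≢ proj₂ e → ⟦ v FinP.≟ proj₁ e ⟧ + ⟦ v FinP.≟ proj₂ e ⟧ ≤ inc v e
ends≤inc v (x , y) x≢y = go (v FinP.≟ x) (v FinP.≟ y)
  where
  go : (p : Dec (v ≡ x)) (q : Dec (v ≡ y)) → ⟦ p ⟧ + ⟦ q ⟧ ≤ inc v (x , y)
  go (yes p) (yes q) = contradiction (trans (sym p) q) x≢y
  go (yes p) (no _) = ≤-reflexive (sym (⟦⟧-yes (incident? v (x , y)) (inj₁ p)))
  go (no _) (yes q) = ≤-reflexive (sym (⟦⟧-yes (incident? v (x , y)) (inj₂ q)))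
  go (no _) (no _) = z≤n

-- Double counting of the pairs of an edge e and a later row of w whose partner v is an endpoint of
-- e: for fixed v there are at most `deg v es` choices of e.
links≤rowsum : ∀ {n} (w : Fin n) es → All (λ e → proj₁ e ≢ proj₂ e) es → links w es ≤ rowsum w (λ v → deg v es) es
links≤rowsum w [] _ = z≤n
links≤rowsum w (e ∷ es) (x≢y ∷ ls) = begin
  hits w e es + links w es
    ≤⟨ +-mono-≤ (≤-reflexive (trans (cong₂ _+_ (occ-rowsum w (proj₁ e) es) (occ-rowsum w (proj₂ e) es)) (sym (rowsum-+ w _ _ es)))) (links≤rowsum w es ls) ⟩
  rowsum w (λ v → ⟦ v FinP.≟ proj₁ e ⟧ + ⟦ v FinP.≟ proj₂ e ⟧) es + rowsum w (λ v → deg v es) es ≡⟨ sym (rowsum-+ w _ _ es) ⟩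
  rowsum w (λ v → ⟦ v FinP.≟ proj₁ e ⟧ + ⟦ v FinP.≟ proj₂ e ⟧ + deg v es) es
    ≤⟨ rowsum-mono w es (λ v → ≤-trans (+-monoˡ-≤ (deg v es) (ends≤inc v e x≢y)) (≤-reflexive (sym (deg-cons v e es)))) ⟩
  rowsum w (λ v → deg v (e ∷ es)) es ≤⟨ m≤n+m _ _ ⟩
  rowsum w (λ v → deg v (e ∷ es)) (e ∷ es) ∎
  where open ≤-Reasoning

links≤ : ∀ {n} (w : Fin n) es Δ → All (λ e → proj₁ e ≢ proj₂ e) es → (∀ v → deg v es ≤ Δ) → links w es ≤ Δ * Δ
links≤ w es Δ ls h = ≤-trans (links≤rowsum w es ls) (≤-trans (rowsum-mono w es h)
  (≤-trans (≤-reflexive (rowsum-const w Δ es)) (*-monoˡ-≤ Δ (h w))))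

edge-to : ∀ {n} (w : Fin n) e → Incident w e → (proj₁ e ≡ w × proj₂ e ≡ other w e) ⊎ (proj₂ e ≡ w × proj₁ e ≡ other w e)
edge-to w (x , y) i with w FinP.≟ x
edge-to w (x , y) i | yes p = inj₁ (sym p , refl)
edge-to w (x , y) (inj₁ p) | no ¬p = contradiction p ¬p
edge-to w (x , y) (inj₂ q) | no ¬p = inj₂ (sym q , refl)

same-edge : ∀ {n} (w x : Fin n) e f → Incident w e → Incident w f → other w e ≡ x → other w f ≡ x → SameEdge e f
same-edge w x e f ie if p q with edge-to w e ie | edge-to w f if
... | inj₁ (a , b) | inj₁ (c , d) = inj₁ (trans a (sym c) , trans (trans b p) (sym (trans d q)))
... | inj₁ (a , b) | inj₂ (c , d) = inj₂ (trans a (sym c) , trans (trans b p) (sym (trans d q)))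
... | inj₂ (a , b) | inj₁ (c , d) = inj₂ (trans (trans b p) (sym (trans d q)) , trans a (sym c))
... | inj₂ (a , b) | inj₂ (c , d) = inj₁ (trans (trans b p) (sym (trans d q)) , trans a (sym c))

occ-step : ∀ {n} (w x : Fin n) e → (Incident w e × other w e ≡ x) ⊎ inc w e * ⟦ other w e FinP.≟ x ⟧ ≡ 0
occ-step w x e with incident? w e | other w e FinP.≟ x
... | yes i | yes p = inj₁ (i , p)
... | yes i | no _ = inj₂ refl
... | no _ | _ = inj₂ refl

occ-none : ∀ {n} (w x : Fin n) e es → Incident w e → other w e ≡ x → All (λ f → ¬ SameEdge e f) es → occ w x es ≡ 0
occ-none w x e [] i p _ = refl
occ-none w x e (f ∷ es) i p (¬s ∷ ss) with occ-step w x f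
... | inj₁ (j , q) = contradiction (same-edge w x e f i j p q) ¬s
... | inj₂ z = cong₂ _+_ z (occ-none w x e es i p ss)

occ≤1 : ∀ {n} (w x : Fin n) es → AllPairs (λ e f → ¬ SameEdge e f) es → occ w x es ≤ 1
occ≤1 w x [] _ = z≤n
occ≤1 w x (e ∷ es) (s ∷ ss) with occ-step w x e
... | inj₁ (i , p) = subst (λ k → inc w e * ⟦ other w e FinP.≟ x ⟧ + k ≤ 1) (sym (occ-none w x e es i p s))
        (subst (_≤ 1) (sym (+-identityʳ _)) (*-mono-≤ (⟦⟧≤1 (incident? w e)) (⟦⟧≤1 (other w e FinP.≟ x))))
... | inj₂ z = subst (λ k → k + occ w x es ≤ 1) (sym z) (occ≤1 w x es ss)

sparse : ∀ {n} (w : Fin n) es → AllPairs (λ e f → ¬ SameEdge e f) es → Sparse w es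
sparse w [] _ = refl
sparse w (e ∷ es) (_ ∷ ss) = +-mono-≤ (occ≤1 w (proj₁ e) es ss) (occ≤1 w (proj₂ e) es ss) , sparse w es ss

module Observables (D J E B thr M : ℕ) {{M≢0 : NonZero M}} (n : ℕ) where
  open Global D J E B thr M {{M≢0}} n

  private
    pull : ∀ q (a f : ℕ → ℕ) → ∑ D (λ c → a c * (q * f c)) ≡ q * ∑ D (λ c → a c * f c)
    pull q a f = trans (∑-cong D (λ c _ → lemma (a c) q (f c))) (∑-*ˡ D q _)
      where
      lemma : ∀ x y z → x * (y * z) ≡ y * (x * z)
      lemma = solve-∀

    scaled : ∀ q (a f g : ℕ → ℕ) β → ∑ D (λ c → a c * f c) ≤ ∑ D (λ c → a c * g c) + β
      → ∑ D (λ c → a c * (q * f c)) ≤ ∑ D (λ c → a c * (q * g c)) + q * β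
    scaled q a f g β h = subst₂ _≤_ (sym (pull q a f)) (trans (*-distribˡ-+ q _ β) (cong (_+ q * β) (sym (pull q a g))))
      (*-monoʳ-≤ q h)

    scaled-mart : ∀ q (f : ℕ → ℕ) x → ∑ M f ≡ M * x → ∑ M (λ r → q * f r) ≡ M * (q * x)
    scaled-mart q f x h = trans (∑-*ˡ M q f) (trans (cong (q *_) h) (lemma q M x))
      where
      lemma : ∀ a b c → a * (b * c) ≡ b * (a * c)
      lemma = solve-∀

  direct : ℕ → Observable
  direct q = record
    { val = λ u c → q * X u c
    ; β = q * B
    ; val-mart = λ u z c c<D bd → scaled-mart q _ _ (martingale u z c c<D)
    ; val-up = λ u z r a bd a≤1 → scaled q a _ _ B (step-up u z r a bd a≤1)
    ; val-down = λ u z r a bd a≤1 → scaled q a _ _ B (step-down u z r a bd a≤1)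
    }

  private
    total : ∀ u (a : ℕ → ℕ) → Bounded u → ∑ D (λ c → a c * (B ∸ X u c)) + ∑ D (λ c → a c * X u c) ≡ ∑ D (λ c → a c * B)
    total u a bd = trans (sym (∑-+ D _ _)) (∑-cong D (λ c c<D →
      trans (sym (*-distribˡ-+ (a c) (B ∸ X u c) (X u c))) (cong (a c *_) (m∸n+n≡m (bd c c<D)))))

    flip : ∀ u v (a : ℕ → ℕ) → Bounded u → Bounded v
      → ∑ D (λ c → a c * X u c) ≤ ∑ D (λ c → a c * X v c) + B
      → ∑ D (λ c → a c * (B ∸ X v c)) ≤ ∑ D (λ c → a c * (B ∸ X u c)) + B
    flip u v a bu bv h = +-cancelʳ-≤ (∑ D (λ c → a c * X v c)) _ _ (begin
      ∑ D (λ c → a c * (B ∸ X v c)) + ∑ D (λ c → a c * X v c) ≡⟨ trans (total v a bv) (sym (total u a bu)) ⟩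
      ∑ D (λ c → a c * (B ∸ X u c)) + ∑ D (λ c → a c * X u c) ≤⟨ +-monoʳ-≤ _ h ⟩
      ∑ D (λ c → a c * (B ∸ X u c)) + (∑ D (λ c → a c * X v c) + B) ≡⟨ lemma (∑ D (λ c → a c * (B ∸ X u c))) (∑ D (λ c → a c * X v c)) B ⟩
      ∑ D (λ c → a c * (B ∸ X u c)) + B + ∑ D (λ c → a c * X v c) ∎)
      where
      open ≤-Reasoning
      lemma : ∀ x y z → x + (y + z) ≡ x + z + y
      lemma = solve-∀

  -- Reflection X ↦ B - X turns a lower deviation into an upper one; `step-up` and `step-down`
  -- exchange their roles.
  complement : ℕ → Observable
  complement q = record
    { val = λ u c → q * (B ∸ X u c)
    ; β = q * B
    ; val-mart = λ u z c c<D bd → scaled-mart q _ _ (+-cancelʳ-≡ (M * X u c) _ _ (mart u z c c<D bd))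
    ; val-up = λ u z r a bd a≤1 → scaled q a _ _ B (flip u (step u z r) a bd (step-bounded u z r bd) (step-down u z r a bd a≤1))
    ; val-down = λ u z r a bd a≤1 → scaled q a _ _ B (flip (step u z r) u a (step-bounded u z r bd) bd (step-up u z r a bd a≤1))
    }
    where
    open ≡-Reasoning
    mart : ∀ u z c → c < D → Bounded u → ∑ M (λ r → B ∸ X (step u z r) c) + M * X u c ≡ M * (B ∸ X u c) + M * X u c
    mart u z c c<D bd = begin
      ∑ M (λ r → B ∸ X (step u z r) c) + M * X u c ≡⟨ cong (∑ M (λ r → B ∸ X (step u z r) c) +_) (sym (martingale u z c c<D)) ⟩
      ∑ M (λ r → B ∸ X (step u z r) c) + ∑ M (λ r → X (step u z r) c) ≡⟨ sym (∑-+ M _ _) ⟩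
      ∑ M (λ r → B ∸ X (step u z r) c + X (step u z r) c) ≡⟨ ∑-cong M (λ r _ → m∸n+n≡m (step-bounded u z r bd c c<D)) ⟩
      ∑ M (λ r → B) ≡⟨ ∑-const M B ⟩
      M * B ≡⟨ cong (M *_) (sym (m∸n+n≡m (bd c c<D))) ⟩
      M * (B ∸ X u c + X u c) ≡⟨ *-distribˡ-+ M _ _ ⟩
      M * (B ∸ X u c) + M * X u c ∎

-- The run as seen from one vertex

consIf : ∀ {a} {A : Set a} {P : Set} → Dec P → A → (ℕ → A) → ℕ → A
consIf (yes _) x f zero = x
consIf (yes _) x f (suc i) = f i
consIf (no _) x f i = f i

consIf-skip : ∀ {a} {A : Set a} {P : Set} (d : Dec P) (x : A) f i → consIf d x f (⟦ d ⟧ + i) ≡ f i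
consIf-skip (yes _) x f i = refl
consIf-skip (no _) x f i = refl

∑-consIf : ∀ {a} {A : Set a} {P : Set} (d : Dec P) (x : A) f k l (h : ℕ → A → ℕ)
  → ∑ (⟦ d ⟧ + l) (λ i → h (k + i) (consIf d x f i)) ≡ ⟦ d ⟧ * h k x + ∑ l (λ i → h (⟦ d ⟧ + k + i) (f i))
∑-consIf (no _) x f k l h = refl
∑-consIf (yes _) x f k l h = trans (∑-head l _) (cong₂ _+_
  (trans (cong (λ j → h j x) (+-identityʳ k)) (sym (+-identityʳ _)))
  (∑-cong l (λ i _ → cong (λ j → h j (f i)) (+-suc k i))))

module Run (p : Params) (n : ℕ) where
  open Params p
  open Global D J E B thr M n using (Conf; BoundedConf; gstep; gstep-bounded; Observable; module Potential)

  stateAt otherAt : Fin n → Conf → ℕ → List (Edge n) → ℕ → Local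
  stateAt w σ s [] i = σ w
  stateAt w σ s (e ∷ es) = consIf (incident? w e) (σ w) (stateAt w (gstep σ e (s % M)) (s / M) es)
  otherAt w σ s [] i = σ w
  otherAt w σ s (e ∷ es) = consIf (incident? w e) (σ (other w e)) (otherAt w (gstep σ e (s % M)) (s / M) es)

  digitAt : Fin n → ℕ → List (Edge n) → ℕ → ℕ
  digitAt w s [] i = 0
  digitAt w s (e ∷ es) = consIf (incident? w e) (s % M) (digitAt w (s / M) es)

  gstep-other : ∀ σ e r w → ¬ Incident w e → gstep σ e r w ≡ σ w
  gstep-other σ (x , y) r w ¬i with w FinP.≟ x | w FinP.≟ y
  ... | yes p | _ = contradiction (inj₁ p) ¬i
  ... | no _ | yes q = contradiction (inj₂ q) ¬i
  ... | no _ | no _ = refl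

  gstep-incident : ∀ σ e r w → Incident w e → gstep σ e r w ≡ step (σ w) (σ (other w e)) r
  gstep-incident σ (x , y) r w i with w FinP.≟ x | w FinP.≟ y
  ... | yes refl | _ = refl
  ... | no _ | yes refl = refl
  gstep-incident σ (x , y) r w (inj₁ p) | no ¬p | no _ = contradiction p ¬p
  gstep-incident σ (x , y) r w (inj₂ q) | no _ | no ¬q = contradiction q ¬q

  stateAt-0 : ∀ w σ s es → stateAt w σ s es 0 ≡ σ w
  stateAt-0 w σ s [] = refl
  stateAt-0 w σ s (e ∷ es) with incident? w e
  ... | yes _ = refl
  ... | no ¬i = trans (stateAt-0 w _ (s / M) es) (gstep-other σ e (s % M) w ¬i)

  stateAt-suc : ∀ w σ s es i → i < deg w es
    → stateAt w σ s es (suc i) ≡ step (stateAt w σ s es i) (otherAt w σ s es i) (digitAt w s es i)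
  stateAt-suc w σ s (e ∷ es) i lt = go (incident? w e) i (subst (i <_) (deg-cons w e es) lt)
    where
    σ′ = gstep σ e (s % M)
    F G′ : ℕ → Local
    F = stateAt w σ′ (s / M) es
    G′ = otherAt w σ′ (s / M) es
    H = digitAt w (s / M) es
    go : (d : Dec (Incident w e)) → ∀ i → i < ⟦ d ⟧ + deg w es
      → consIf d (σ w) F (suc i) ≡ step (consIf d (σ w) F i) (consIf d (σ (other w e)) G′ i) (consIf d (s % M) H i)
    go (yes i) zero _ = trans (stateAt-0 w σ′ (s / M) es) (gstep-incident σ e (s % M) w i)
    go (yes _) (suc i) (s≤s lt) = stateAt-suc w σ′ (s / M) es i lt
    go (no _) i lt = stateAt-suc w σ′ (s / M) es i lt

  digitAt<M : ∀ w s es i → digitAt w s es i < M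
  digitAt<M w s [] i = M>0
  digitAt<M w s (e ∷ es) i = go (incident? w e) i
    where
    go : (d : Dec (Incident w e)) → ∀ i → consIf d (s % M) (digitAt w (s / M) es) i < M
    go (yes _) zero = m%n<n s M
    go (yes _) (suc i) = digitAt<M w (s / M) es i
    go (no _) i = digitAt<M w (s / M) es i

  otherAt-bounded : ∀ w σ s es i → BoundedConf σ → Bounded (otherAt w σ s es i)
  otherAt-bounded w σ s [] i bd = bd w
  otherAt-bounded w σ s (e ∷ es) i bd = go (incident? w e) i
    where
    bd′ = gstep-bounded σ e (s % M) bd
    go : (d : Dec (Incident w e)) → ∀ i → Bounded (consIf d (σ (other w e)) (otherAt w (gstep σ e (s % M)) (s / M) es) i)
    go (yes _) zero = bd (other w e)
    go (yes _) (suc i) = otherAt-bounded w _ (s / M) es i bd′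
    go (no _) i = otherAt-bounded w _ (s / M) es i bd′

  -- Makes bounds proved along a vertex's own trajectory available when that vertex acts as a
  -- partner.
  otherAt-state : ∀ w σ s es i → i < deg w es → ∃ λ v → ∃ λ j → j ≤ deg v es × otherAt w σ s es i ≡ stateAt v σ s es j
  otherAt-state w σ s (e ∷ es) i lt = go (incident? w e) i (subst (i <_) (deg-cons w e es) lt)
    where
    σ′ = gstep σ e (s % M)
    later : ∀ {i} → (∃ λ v → ∃ λ j → j ≤ deg v es × otherAt w σ′ (s / M) es i ≡ stateAt v σ′ (s / M) es j)
      → ∃ λ v → ∃ λ j → j ≤ deg v (e ∷ es) × otherAt w σ′ (s / M) es i ≡ stateAt v σ s (e ∷ es) j
    later (v , j , j≤ , eq) = v , inc v e + j , subst (inc v e + j ≤_) (sym (deg-cons v e es)) (+-monoʳ-≤ (inc v e) j≤)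
      , trans eq (sym (consIf-skip (incident? v e) (σ v) _ j))
    go : (d : Dec (Incident w e)) → ∀ i → i < ⟦ d ⟧ + deg w es
      → ∃ λ v → ∃ λ j → j ≤ deg v (e ∷ es) × consIf d (σ (other w e)) (otherAt w σ′ (s / M) es) i ≡ stateAt v σ s (e ∷ es) j
    go (yes _) zero _ = other w e , 0 , z≤n , sym (stateAt-0 (other w e) σ s (e ∷ es))
    go (yes _) (suc i) (s≤s lt) = later (otherAt-state w σ′ (s / M) es i lt)
    go (no _) i lt = later (otherAt-state w σ′ (s / M) es i lt)

  initially : Conf
  initially _ = initial

  initially-bounded : BoundedConf initially
  initially-bounded _ = initial-bounded

  trajectory : ∀ w s es → deg w es ≤ 16 * (G * (g * t)) → Trajectory p (deg w es)
  trajectory w s es d≤ = record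
    { u = stateAt w initially s es
    ; z = otherAt w initially s es
    ; r = digitAt w s es
    ; u-initial = stateAt-0 w initially s es
    ; u-step = λ i lt → stateAt-suc w initially s es i lt
    ; r<M = λ i _ → digitAt<M w s es i
    ; z-bounded = λ i _ → otherAt-bounded w initially s es i initially-bounded
    ; rows≤ = d≤
    }

  module Rows (O : Observable) (w : Fin n) (a : ℕ → ℕ → ℕ) (a≤1 : ∀ i c → a i c ≤ 1) where
    open Potential O w a a≤1 using (rowVal; row; realised; expected)

    realised-∑ : ∀ k σ s es → realised k σ s es ≡ ∑ (deg w es) (λ i → rowVal (k + i) (otherAt w σ s es i))
    realised-∑ k σ s [] = refl
    realised-∑ k σ s (e ∷ es) = trans (cong (row k σ e +_) (realised-∑ (adv w k e) _ (s / M) es))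
      (sym (trans (cong (λ l → ∑ l (λ i → rowVal (k + i) (otherAt w σ s (e ∷ es) i))) (deg-cons w e es))
        (∑-consIf (incident? w e) (σ (other w e)) _ k (deg w es) rowVal)))

    expected-∑ : ∀ k es → expected k initially es ≡ ∑ (deg w es) (λ i → rowVal (k + i) initial)
    expected-∑ k [] = refl
    expected-∑ k (e ∷ es) = trans (cong (row k initially e +_) (expected-∑ (adv w k e) es))
      (sym (trans (cong (λ l → ∑ l (λ i → rowVal (k + i) initial)) (deg-cons w e es))
        (trans (∑-cong (inc w e + deg w es) (λ i _ → cong (rowVal (k + i)) (sym (const-consIf (incident? w e) i))))
          (∑-consIf (incident? w e) initial (λ _ → initial) k (deg w es) rowVal))))
      where
      const-consIf : ∀ {P : Set} (d : Dec P) i → consIf d initial (λ _ → initial) i ≡ initial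
      const-consIf (yes _) zero = refl
      const-consIf (yes _) (suc i) = refl
      const-consIf (no _) i = refl

sumL : ∀ {a} {A : Set a} → (A → ℕ) → List A → ℕ
sumL f [] = 0
sumL f (x ∷ xs) = f x + sumL f xs

sumL-swap : ∀ {a} {A : Set a} n (f : A → ℕ → ℕ) xs → ∑ n (λ s → sumL (λ x → f x s) xs) ≡ sumL (λ x → ∑ n (f x)) xs
sumL-swap n f [] = ∑-zero n (λ _ _ → refl)
sumL-swap n f (x ∷ xs) = trans (∑-+ n _ _) (cong (∑ n (f x) +_) (sumL-swap n f xs))

sumL-mul : ∀ {a} {A : Set a} (f : A → ℕ) k b xs → (∀ x → f x * k ≤ b) → sumL f xs * k ≤ length xs * b
sumL-mul f k b [] h = z≤n
sumL-mul f k b (x ∷ xs) h = ≤-trans (≤-reflexive (*-distribʳ-+ k (f x) _)) (+-mono-≤ (h x) (sumL-mul f k b xs h))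

any≤sumL : ∀ {a} {A : Set a} {P : A → Set} (P? : ∀ x → Dec (P x)) xs → ⟦ any? P? xs ⟧ ≤ sumL (λ x → ⟦ P? x ⟧) xs
any≤sumL P? [] = z≤n
any≤sumL P? (x ∷ xs) = go (any? P? (x ∷ xs))
  where
  go : (d : Dec _) → ⟦ d ⟧ ≤ ⟦ P? x ⟧ + sumL (λ x → ⟦ P? x ⟧) xs
  go (no _) = z≤n
  go (yes (here px)) = ≤-trans (≤-reflexive (sym (⟦⟧-yes (P? x) px))) (m≤m+n _ _)
  go (yes (there ps)) = ≤-trans (≤-reflexive (sym (⟦⟧-yes (any? P? xs) ps))) (≤-trans (any≤sumL P? xs) (m≤n+m _ _))

⊎≤ : ∀ {P Q : Set} (d : Dec P) (e : Dec Q) → ⟦ d ⊎-dec e ⟧ ≤ ⟦ d ⟧ + ⟦ e ⟧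
⊎≤ (yes _) e = s≤s z≤n
⊎≤ (no _) (yes _) = ≤-refl
⊎≤ (no _) (no _) = ≤-refl

-- Enumeration of the tests and union bound

extend : ℕ → (ℕ → ℕ) → ℕ → ℕ → ℕ
extend n f v i with i ≟ n
... | yes _ = v
... | no _ = f i

funs : ℕ → ℕ → List (ℕ → ℕ)
funs k zero = (λ _ → 0) ∷ []
funs k (suc n) = cartesianProductWith (extend n) (funs k n) (upTo k)

length-product : ∀ {a b c} {A : Set a} {B : Set b} {C : Set c} (f : A → B → C) xs ys
  → length (cartesianProductWith f xs ys) ≡ length xs * length ys
length-product f [] ys = refl
length-product f (x ∷ xs) ys = trans (length-++ (map (f x) ys)) (cong₂ _+_ (length-map (f x) ys) (length-product f xs ys))

length-funs : ∀ k n → length (funs k n) ≡ k ^ n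
length-funs k zero = refl
length-funs k (suc n) = trans (length-product (extend n) (funs k n) (upTo k))
  (trans (cong₂ _*_ (length-funs k n) (length-upTo k)) (*-comm (k ^ n) k))

funs-cover : ∀ k n (f : ℕ → ℕ) → (∀ i → f i < k) → ∃ λ f′ → f′ ∈ funs k n × (∀ i → i < n → f′ i ≡ f i)
funs-cover k zero f h = (λ _ → 0) , here refl , λ _ ()
funs-cover k (suc n) f h with funs-cover k n f h
... | f′ , mem , eq = extend n f′ (f n) , ∈-cartesianProductWith⁺ (extend n) mem (∈-upTo⁺ (h n)) , agree
  where
  agree : ∀ i → i < suc n → extend n f′ (f n) i ≡ f i
  agree i lt with i ≟ n
  ... | yes refl = refl
  ... | no i≢n = eq i (≤∧≢⇒< (s≤s⁻¹ lt) i≢n)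

module Tests (p : Params) (n Δ : ℕ) (Δ≤ : Δ ≤ 16 * (Params.G p * (Params.g p * Params.t p))) (q : ℕ) (q>0 : 0 < q) where
  open Params p
  open ParamFacts p
  open Run p n
  open Global D J E B thr M n using (Observable; module Potential)
  open Observables D J E B thr M n using (direct; complement)

  Test : Set
  Test = Fin n × ((ℕ → ℕ) × ((ℕ → ℕ) × (ℕ → ℕ)))

  -- Truncation by `⊓ 1` makes every triple of functions a legitimate test, so that members of the
  -- enumeration need no side conditions.
  weightOf : (ℕ → ℕ) → (ℕ → ℕ) → (ℕ → ℕ) → ℕ → ℕ → ℕ
  weightOf S lo hi i c = (S i ⊓ 1) * box (lo c) (hi c) i

  weightOf≤1 : ∀ S lo hi i c → weightOf S lo hi i c ≤ 1
  weightOf≤1 S lo hi i c = *-mono-≤ (m⊓n≤n (S i) 1) (box≤1 (lo c) (hi c) i)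

  tests : List Test
  tests = cartesianProduct (allFin n) (cartesianProduct (funs 2 Δ) (cartesianProduct (funs (suc Δ) D) (funs (suc Δ) D)))

  length-tests : length tests ≡ n * (2 ^ Δ * (suc Δ ^ D * suc Δ ^ D))
  length-tests = trans (length-product _,_ (allFin n) _) (cong₂ _*_ (length-tabulate {n = n} (λ i → i))
    (trans (length-product _,_ (funs 2 Δ) _) (cong₂ _*_ (length-funs 2 Δ)
      (trans (length-product _,_ (funs (suc Δ) D) _) (cong₂ _*_ (length-funs (suc Δ) D) (length-funs (suc Δ) D))))))

  -- The unit U is the weight M J of a fresh colour, but all observed weights are multiplied by q.
  -- Two units lost per link, at most 2 Δ² in total, then become small against the threshold q τ.
  pp U : ℕ
  pp = 2 * q * G
  U = M * J

  pp>0 : 0 < pp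
  pp>0 = *-mono-≤ (*-mono-≤ {1} {2} (s≤s z≤n) q>0) G>0

  instance
    q≢0 : NonZero q
    q≢0 = >-nonZero q>0
    U≢0 : NonZero U
    U≢0 = m*n≢0 M J

  fits : 2 * (q * B) ≤ pp * U
  fits = ≤-reflexive (lemma q M J G)
    where
    lemma : ∀ q M J G → 2 * (q * (M * (J * G))) ≡ 2 * q * G * (M * J)
    lemma = solve-∀

  module Check (O : Observable) (β≤ : 2 * Observable.β O ≤ pp * U) (T : Test) where
    w = proj₁ T
    S lo hi : ℕ → ℕ
    S = proj₁ (proj₂ T)
    lo = proj₁ (proj₂ (proj₂ T))
    hi = proj₂ (proj₂ (proj₂ T))
    open Potential O w (weightOf S lo hi) (weightOf≤1 S lo hi) public
    open Exponential pp U pp>0 β≤ public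
    fails? : ∀ s es → Dec (expected 0 initially es + q * τ * U < realised 0 initially s es)
    fails? s es = exceeds initially (q * τ) s es

  module Up = Check (direct q) fits
  module Down = Check (complement q) fits

  Fails : ℕ → List (Edge n) → Test → Set
  Fails s es T = (Up.expected T 0 initially es + q * τ * U < Up.realised T 0 initially s es)
    ⊎ (Down.expected T 0 initially es + q * τ * U < Down.realised T 0 initially s es)

  fails? : ∀ s es T → Dec (Fails s es T)
  fails? s es T = Up.fails? T s es ⊎-dec Down.fails? T s es

  bad? : ∀ s es → Dec (Any (Fails s es) tests)
  bad? s es = any? (fails? s es) tests

  module Union (es : List (Edge n)) (simple : Simple es) (deg≤ : ∀ v → deg v es ≤ Δ)
    (b : ℕ) (enough : pp * suc pp * b + 2 * (Δ * Δ) ≤ q * τ) (k : ℕ) (len : length es ≤ k) where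

    one-test : ∀ T → ∑ (M ^ k) (λ s → ⟦ fails? s es T ⟧) * 2 ^ b ≤ 2 * M ^ k
    one-test T = begin
      ∑ (M ^ k) (λ s → ⟦ fails? s es T ⟧) * 2 ^ b
        ≤⟨ *-monoˡ-≤ (2 ^ b) (≤-trans (∑-mono (M ^ k) (λ s _ → ⊎≤ (Up.fails? T s es) (Down.fails? T s es))) (≤-reflexive (∑-+ (M ^ k) _ _))) ⟩
      (∑ (M ^ k) (λ s → ⟦ Up.fails? T s es ⟧) + ∑ (M ^ k) (λ s → ⟦ Down.fails? T s es ⟧)) * 2 ^ b ≡⟨ *-distribʳ-+ (2 ^ b) (∑ (M ^ k) (λ s → ⟦ Up.fails? T s es ⟧)) (∑ (M ^ k) (λ s → ⟦ Down.fails? T s es ⟧)) ⟩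
      ∑ (M ^ k) (λ s → ⟦ Up.fails? T s es ⟧) * 2 ^ b + ∑ (M ^ k) (λ s → ⟦ Down.fails? T s es ⟧) * 2 ^ b
        ≤⟨ +-mono-≤ (Up.tail-bound T k initially es (q * τ) b len initially-bounded sp en) (Down.tail-bound T k initially es (q * τ) b len initially-bounded sp en) ⟩
      M ^ k + M ^ k ≡⟨ cong (M ^ k +_) (sym (+-identityʳ (M ^ k))) ⟩
      2 * M ^ k ∎
      where
      open ≤-Reasoning
      sp = sparse (proj₁ T) es (proj₂ simple)
      en : pp * suc pp * b + 2 * links (proj₁ T) es ≤ q * τ
      en = ≤-trans (+-monoʳ-≤ (pp * suc pp * b) (*-monoʳ-≤ 2 (links≤ (proj₁ T) es Δ (proj₁ simple) deg≤))) enough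

    union : ∑ (M ^ k) (λ s → ⟦ bad? s es ⟧) * 2 ^ b ≤ length tests * (2 * M ^ k)
    union = ≤-trans (*-monoˡ-≤ (2 ^ b) (≤-trans (∑-mono (M ^ k) (λ s _ → any≤sumL (fails? s es) tests))
      (≤-reflexive (sumL-swap (M ^ k) (λ T s → ⟦ fails? s es T ⟧) tests))))
      (sumL-mul (λ T → ∑ (M ^ k) (λ s → ⟦ fails? s es T ⟧)) (2 ^ b) (2 * M ^ k) tests one-test)

  module Outcome (es : List (Edge n)) (deg≤ : ∀ v → deg v es ≤ Δ) (s : ℕ) (good : ¬ Any (Fails s es) tests) where

    traj : ∀ w → Trajectory p (deg w es)
    traj w = trajectory w s es (≤-trans (deg≤ w) Δ≤)

    passes : ∀ {T} → T ∈ tests → ¬ Fails s es T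
    passes mem f = good (Any.map (λ { refl → f }) mem)

    module AtVertex (w : Fin n) where
      open Trajectory (traj w) using (z; z-bounded)
      l : ℕ
      l = deg w es

      weighted : (ℕ → ℕ) → (ℕ → ℕ) → (ℕ → ℕ) → (ℕ → ℕ → ℕ) → ℕ
      weighted S lo hi f = ∑ l (λ i → ∑ D (λ c → weightOf S lo hi i c * f i c))

      weighted-q : ∀ S lo hi f → ∑ l (λ i → ∑ D (λ c → weightOf S lo hi i c * (q * f i c))) ≡ q * weighted S lo hi f
      weighted-q S lo hi f = trans (∑-cong l (λ i _ → trans (∑-cong D (λ c _ → lemma (weightOf S lo hi i c) q (f i c))) (∑-*ˡ D q _))) (∑-*ˡ l q _)
        where
        lemma : ∀ x y z → x * (y * z) ≡ y * (x * z)
        lemma = solve-∀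

      weighted-+ : ∀ S lo hi f h → weighted S lo hi (λ i c → f i c + h i c) ≡ weighted S lo hi f + weighted S lo hi h
      weighted-+ S lo hi f h = trans (∑-cong l (λ i _ → trans (∑-cong D (λ c _ → *-distribˡ-+ (weightOf S lo hi i c) (f i c) (h i c))) (∑-+ D _ _))) (∑-+ l _ _)

      weighted-cong : ∀ S lo hi {f h} → (∀ i c → i < l → c < D → f i c ≡ h i c) → weighted S lo hi f ≡ weighted S lo hi h
      weighted-cong S lo hi eq = ∑-cong l (λ i lt → ∑-cong D (λ c c<D → cong (weightOf S lo hi i c *_) (eq i c lt c<D)))

      unscale : ∀ S lo hi f h → ∑ l (λ i → ∑ D (λ c → weightOf S lo hi i c * (q * f i c)))
          ≤ ∑ l (λ i → ∑ D (λ c → weightOf S lo hi i c * (q * h i c))) + q * τ * U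
        → weighted S lo hi f ≤ weighted S lo hi h + τ * U
      unscale S lo hi f h le = *-cancelˡ-≤ q (begin
        q * weighted S lo hi f ≡⟨ sym (weighted-q S lo hi f) ⟩
        ∑ l (λ i → ∑ D (λ c → weightOf S lo hi i c * (q * f i c))) ≤⟨ le ⟩
        ∑ l (λ i → ∑ D (λ c → weightOf S lo hi i c * (q * h i c))) + q * τ * U ≡⟨ cong₂ _+_ (weighted-q S lo hi h) (*-assoc q τ U) ⟩
        q * weighted S lo hi h + q * (τ * U) ≡⟨ sym (*-distribˡ-+ q _ _) ⟩
        q * (weighted S lo hi h + τ * U) ∎)
        where open ≤-Reasoning

      coded-up : ∀ S lo hi → (w , S , lo , hi) ∈ tests
        → weighted S lo hi (λ i c → X (z i) c) ≤ weighted S lo hi (λ _ _ → M * J) + τ * U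
      coded-up S lo hi mem = unscale S lo hi _ _ (subst₂ (λ a b → a ≤ b + q * τ * U)
          (Rows.realised-∑ (direct q) w (weightOf S lo hi) (weightOf≤1 S lo hi) 0 initially s es)
          (Rows.expected-∑ (direct q) w (weightOf S lo hi) (weightOf≤1 S lo hi) 0 es)
          (≮⇒≥ (λ lt → passes mem (inj₁ lt))))

      -- The test for B - X bounds its upward deviation; the identity (B - X) + X = B, for the
      -- realised and for the initial weights, converts it.
      coded-down : ∀ S lo hi → (w , S , lo , hi) ∈ tests
        → weighted S lo hi (λ _ _ → M * J) ≤ weighted S lo hi (λ i c → X (z i) c) + τ * U
      coded-down S lo hi mem = +-cancelˡ-≤ (weighted S lo hi (λ _ _ → B)) _ _ (begin
          W (λ _ _ → B) + W (λ _ _ → M * J) ≡⟨ cong (_+ W (λ _ _ → M * J)) (sym totalX) ⟩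
          W (λ i c → B ∸ X (z i) c) + W (λ i c → X (z i) c) + W (λ _ _ → M * J)
            ≤⟨ +-monoˡ-≤ _ (+-monoˡ-≤ _ (unscale S lo hi _ _ (subst₂ (λ a b → a ≤ b + q * τ * U)
               (Rows.realised-∑ (complement q) w (weightOf S lo hi) (weightOf≤1 S lo hi) 0 initially s es)
               (Rows.expected-∑ (complement q) w (weightOf S lo hi) (weightOf≤1 S lo hi) 0 es)
               (≮⇒≥ (λ lt → passes mem (inj₂ lt)))))) ⟩
          W (λ _ _ → B ∸ M * J) + τ * U + W (λ i c → X (z i) c) + W (λ _ _ → M * J) ≡⟨ lemma (W (λ _ _ → B ∸ M * J)) (τ * U) (W (λ i c → X (z i) c)) (W (λ _ _ → M * J)) ⟩
          W (λ _ _ → B ∸ M * J) + W (λ _ _ → M * J) + (W (λ i c → X (z i) c) + τ * U) ≡⟨ cong (_+ (W (λ i c → X (z i) c) + τ * U)) totalN ⟩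
          W (λ _ _ → B) + (W (λ i c → X (z i) c) + τ * U) ∎)
        where
        open ≤-Reasoning
        W = weighted S lo hi
        lemma : ∀ a b c d → a + b + c + d ≡ a + d + (c + b)
        lemma = solve-∀
        totalX : W (λ i c → B ∸ X (z i) c) + W (λ i c → X (z i) c) ≡ W (λ _ _ → B)
        totalX = trans (sym (weighted-+ S lo hi _ _)) (weighted-cong S lo hi (λ i c lt c<D → m∸n+n≡m (z-bounded i lt c c<D)))
        totalN : W (λ _ _ → B ∸ M * J) + W (λ _ _ → M * J) ≡ W (λ _ _ → B)
        totalN = trans (sym (weighted-+ S lo hi _ _)) (weighted-cong S lo hi (λ i c lt c<D → m∸n+n≡m (initial-bounded c c<D)))

      -- Only the values of S on rows and of lo and hi on colours matter, so some member of the
      -- finite list acts identically.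
      enumerated : ∀ (S lo hi : ℕ → ℕ) → (∀ i → S i ≤ 1) → (∀ c → lo c ≤ l) → (∀ c → hi c ≤ l)
        → ∃ λ S′ → ∃ λ lo′ → ∃ λ hi′ → (w , S′ , lo′ , hi′) ∈ tests
          × (∀ f → ∑ l (λ i → S i * ∑ D (λ c → box (lo c) (hi c) i * f i c)) ≡ weighted S′ lo′ hi′ f)
      enumerated S lo hi S≤1 lo≤ hi≤
        with funs-cover 2 Δ S (λ i → s≤s (S≤1 i))
           | funs-cover (suc Δ) D lo (λ c → s≤s (≤-trans (lo≤ c) (deg≤ w)))
           | funs-cover (suc Δ) D hi (λ c → s≤s (≤-trans (hi≤ c) (deg≤ w)))
      ... | S′ , mS , eS | lo′ , ml , el | hi′ , mh , eh = S′ , lo′ , hi′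
          , ∈-cartesianProduct⁺ (∈-allFin w) (∈-cartesianProduct⁺ mS (∈-cartesianProduct⁺ ml mh))
          , λ f → ∑-cong l (λ i lt → trans (sym (∑-*ˡ D (S i) _)) (∑-cong D (λ c c<D →
              trans (sym (*-assoc (S i) _ (f i c))) (cong (_* f i c) (cong₂ _*_
                (sym (trans (cong (_⊓ 1) (eS i (≤-trans lt (deg≤ w)))) (m≤n⇒m⊓n≡m (S≤1 i))))
                (cong₂ (λ a b → box a b i) (sym (el c c<D)) (sym (eh c c<D))))))))

      commuted : ∀ {a x} → a ≤ x + τ * U → a ≤ x + M * J * τ
      commuted {a} {x} = subst (λ y → a ≤ x + y) (*-comm τ U)

      test-up : Residual.TestUp (traj w)
      test-up S lo hi S≤1 lo≤ hi≤ with enumerated S lo hi S≤1 lo≤ hi≤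
      ... | S′ , lo′ , hi′ , mem , eq = subst₂ (λ a b → a ≤ b + M * J * τ) (sym (eq _)) (sym (eq _))
            (commuted (coded-up S′ lo′ hi′ mem))

      test-down : Residual.TestDown (traj w)
      test-down S lo hi S≤1 lo≤ hi≤ with enumerated S lo hi S≤1 lo≤ hi≤
      ... | S′ , lo′ , hi′ , mem , eq = subst₂ (λ a b → a ≤ b + M * J * τ) (sym (eq _)) (sym (eq _))
            (commuted (coded-down S′ lo′ hi′ mem))

    z-excess : ∀ w i → i < deg w es → G * Residual.excess (traj w) (Trajectory.z (traj w) i) ≤ M * J * t
    z-excess w i lt with otherAt-state w initially s es i lt
    ... | v , j , j≤ , eq = subst (λ x → G * Residual.excess (traj w) x ≤ M * J * t) (sym eq)
          (Smallness.excess-small (traj v) (AtVertex.test-up v) j j≤)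

    failures : ∀ w → ∑ (deg w es) (λ i → ⟦ Trajectory.m (traj w) i ≟ 0 ⟧) ≤ t
    failures w = FewFailures.few-failures (traj w) (AtVertex.test-up w) (AtVertex.test-down w) (z-excess w)

-- Counting distinct colours

multiplicity≤1 : ∀ c xs → Unique xs → sumL (λ x → ⟦ c ≟ x ⟧) xs ≤ 1
multiplicity≤1 c [] _ = z≤n
multiplicity≤1 c (x ∷ xs) (x∉ ∷ uq) = go (c ≟ x)
  where
  absent : ∀ ys → All (λ y → c ≢ y) ys → sumL (λ y → ⟦ c ≟ y ⟧) ys ≡ 0
  absent [] _ = refl
  absent (y ∷ ys) (c≢y ∷ rest) = cong₂ _+_ (⟦⟧-no (c ≟ y) c≢y) (absent ys rest)
  go : (d : Dec (c ≡ x)) → ⟦ d ⟧ + sumL (λ y → ⟦ c ≟ y ⟧) xs ≤ 1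
  go (yes refl) = ≤-reflexive (cong suc (absent xs x∉))
  go (no _) = multiplicity≤1 c xs uq

length≤∑ : ∀ B xs → All (_< B) xs → length xs ≤ ∑ B (λ c → sumL (λ x → ⟦ c ≟ x ⟧) xs)
length≤∑ B [] _ = z≤n
length≤∑ B (x ∷ xs) (x<B ∷ all) = ≤-trans (+-mono-≤ one (length≤∑ B xs all)) (≤-reflexive (sym (∑-+ B _ _)))
  where
  one : 1 ≤ ∑ B (λ c → ⟦ c ≟ x ⟧)
  one = ≤-trans (≤-reflexive (sym (⟦⟧-yes (x ≟ x) refl))) (term≤∑ B (λ c → ⟦ c ≟ x ⟧) x x<B)

unique-length : ∀ B xs → Unique xs → All (_< B) xs → length xs ≤ B
unique-length B xs uq all = ≤-trans (length≤∑ B xs all) (≤-trans (∑-mono B (λ c _ → multiplicity≤1 c xs uq))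
  (≤-reflexive (trans (∑-const B 1) (*-identityʳ B))))

numColors≤ : ∀ {n} K (cs : List (Edge n × ℕ)) → All (λ q → proj₂ q ≤ K) cs → numColors cs ≤ suc K
numColors≤ K cs all = unique-length (suc K) (deduplicate _≟_ (map proj₂ cs)) (deduplicate-! (map proj₂ cs))
  (deduplicate⁺ _≟_ (map⁺ (All.map s≤s all)))

-- The colouring algorithm

-- If c is taken, deleting it shortens the list, and the search goes on from c + 1; so at most as
-- many steps are made as there are forbidden colours.
mex : ∀ fuel c cs → length cs ≤ fuel → ∃ λ k → k ≤ length cs × c + k ∉ cs
mex fuel c cs len with c ∈? cs
... | no c∉ = 0 , z≤n , subst (_∉ cs) (sym (+-identityʳ c)) c∉
mex zero c [] len | yes ()
mex (suc fuel) c cs len | yes c∈ = suc k , ≤-trans (s≤s k≤) shorter , ∉cs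
  where
  cs′ = filter (λ x → ¬? (x ≟ c)) cs
  shorter : length cs′ < length cs
  shorter = filter-notAll (λ x → ¬? (x ≟ c)) cs (Any.map (λ { refl ≢ → ≢ refl }) c∈)
  rec = mex fuel (suc c) cs′ (s≤s⁻¹ (≤-trans shorter len))
  k = proj₁ rec
  k≤ : k ≤ length cs′
  k≤ = proj₁ (proj₂ rec)
  ∉cs : c + suc k ∉ cs
  ∉cs mem = proj₂ (proj₂ rec) (subst (_∈ cs′) (+-suc c k)
    (∈-filter⁺ (λ x → ¬? (x ≟ c)) mem (λ eq → m+1+n≢m c eq)))

module Colouring (D J E B thr M : ℕ) {{M≢0 : NonZero M}} (initial : Local) (n : ℕ) where
  open Global D J E B thr M n

  Assignment : Set
  Assignment = List (Edge n × ℕ)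

  record State : Set where
    constructor state
    field
      conf : Conf
      seed : ℕ
      done : Assignment

  open State

  share? : (f e : Edge n) → Dec (ShareEndpoint f e)
  share? f e = incident? (proj₁ f) e ⊎-dec incident? (proj₂ f) e

  Greedy : Edge n → Edge n × ℕ → Set
  Greedy e q = ShareEndpoint (proj₁ q) e × D ≤ proj₂ q

  greedy? : ∀ e q → Dec (Greedy e q)
  greedy? e q = share? (proj₁ q) e ×-dec (D ≤? proj₂ q)

  blocked : Edge n → Assignment → List ℕ
  blocked e asg = map proj₂ (filter (greedy? e) asg)

  fallback : Edge n → Assignment → ℕ
  fallback e asg = D + proj₁ (mex (length (blocked e asg)) D (blocked e asg) ≤-refl)

  sampled : Conf → ℕ → Edge n → ℕ
  sampled σ s (x , y) = choice (σ x) (σ y) (s % M)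

  final : ℕ → Edge n → Assignment → ℕ
  final ch e asg with ch <? D
  ... | yes _ = ch
  ... | no _ = fallback e asg

  colour : State → Edge n → ℕ
  colour S e = final (sampled (conf S) (seed S) e) e (done S)

  advance : State → Edge n → State
  advance S e = state (gstep (conf S) e (seed S % M)) (seed S / M) ((e , colour S e) ∷ done S)

  runState : State → List (Edge n) → Assignment
  runState S [] = []
  runState S (e ∷ es) = (e , colour S e) ∷ runState (advance S e) es

  -- An `OnlineAlg` receives only the history, so its state is recomputed by replaying all earlier
  -- edges; this agrees with carrying the state along.
  runFrom-foldl : ∀ S hist es → runFrom (λ h e → colour (foldl advance S h) e) hist es ≡ runState (foldl advance S hist) es
  runFrom-foldl S hist [] = refl
  runFrom-foldl S hist (e ∷ es) = cong ((e , colour (foldl advance S hist) e) ∷_)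
    (trans (runFrom-foldl S (hist ++ [ e ]) es) (cong (λ S → runState S es) (foldl-++ advance S hist [ e ])))

  -- The invariant behind properness: a sampled colour is no longer active at either end, whereas a
  -- newly sampled colour must be active at both. Greedy colours lie from D on and cannot meet
  -- sampled ones.
  Consistent : State → Set
  Consistent S = All (λ q → proj₂ q < D → ∀ v → Incident v (proj₁ q) → st (conf S v) (proj₂ q) ≢ active) (done S)

  next-inactive : ∀ s {P Q : Set} (d : Dec P) (e : Dec Q) → s ≢ active → next s d e ≢ active
  next-inactive active d e h = contradiction refl h
  next-inactive used d e h = λ ()
  next-inactive killed d e h = λ ()

  next-chosen : ∀ s {P Q : Set} (d : Dec P) (e : Dec Q) → P → next s d e ≢ active
  next-chosen active (yes _) e p = λ ()
  next-chosen active (no ¬p) e p = contradiction p ¬p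
  next-chosen used d e p = λ ()
  next-chosen killed d e p = λ ()

  step-inactive : ∀ u z r c → st u c ≢ active → st (step u z r) c ≢ active
  step-inactive u z r c h = next-inactive (st u c) (c ≟ choice u z r) _ h

  gstep-inactive : ∀ σ e r v c → st (σ v) c ≢ active → st (gstep σ e r v) c ≢ active
  gstep-inactive σ (x , y) r v c h with v FinP.≟ x | v FinP.≟ y
  ... | yes refl | _ = step-inactive (σ x) (σ y) r c h
  ... | no _ | yes refl = step-inactive (σ y) (σ x) r c h
  ... | no _ | no _ = h

  gstep-chosen : ∀ σ e r v → Incident v e → st (gstep σ e r v) (choice (σ (proj₁ e)) (σ (proj₂ e)) r) ≢ active
  gstep-chosen σ (x , y) r v i with v FinP.≟ x | v FinP.≟ y
  ... | yes refl | _ = next-chosen (st (σ x) _) (choice (σ x) (σ y) r ≟ choice (σ x) (σ y) r) _ refl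
  ... | no _ | yes refl = next-chosen (st (σ y) _) (choice (σ x) (σ y) r ≟ choice (σ y) (σ x) r) _ (choice-comm (σ x) (σ y) r)
  gstep-chosen σ (x , y) r v (inj₁ p) | no ¬p | no _ = contradiction p ¬p
  gstep-chosen σ (x , y) r v (inj₂ q) | no _ | no ¬q = contradiction q ¬q

  advance-consistent : ∀ S e → Consistent S → Consistent (advance S e)
  advance-consistent S e con = new (sampled (conf S) (seed S) e) refl ∷ All.map (λ h lt v i → gstep-inactive (conf S) e (seed S % M) v _ (h lt v i)) con
    where
    new : ∀ ch → sampled (conf S) (seed S) e ≡ ch → final ch e (done S) < D → ∀ v → Incident v e
      → st (gstep (conf S) e (seed S % M) v) (final ch e (done S)) ≢ active
    new ch eq lt v i with ch <? D
    ... | yes _ = subst (λ c → st (gstep (conf S) e (seed S % M) v) c ≢ active) eq (gstep-chosen (conf S) e (seed S % M) v i)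
    ... | no _ = contradiction lt (≤⇒≯ (m≤m+n D _))

  weight-pos : ∀ s x → 0 < weight s x → s ≡ active
  weight-pos active x _ = refl

  chosen-active : ∀ σ s e v → sampled σ s e < D → Incident v e → st (σ v) (sampled σ s e) ≡ active
  chosen-active σ s (x , y) v lt i = go i
    where
    ks = probs (σ x) (σ y)
    ch = choice (σ x) (σ y) (s % M)
    r< : s % M < ∑ D ks
    r< = ≰⇒> λ ge → <⇒≢ lt (pick-≥ ks D (s % M) ge)
    pos : 0 < Y (σ x) ch * Y (σ y) ch * rate (common (σ x) (σ y))
    pos = pick-pos ks D (s % M) r<
    left : ∀ a b → 0 < a * b → 0 < a
    left (suc a) b _ = s≤s z≤n
    YY : 0 < Y (σ x) ch * Y (σ y) ch
    YY = left _ _ pos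
    go : Incident v (x , y) → st (σ v) ch ≡ active
    go (inj₁ refl) = weight-pos (st (σ x) ch) (X (σ x) ch) (left _ _ YY)
    go (inj₂ refl) = weight-pos (st (σ y) ch) (X (σ y) ch) (left (Y (σ y) ch) (Y (σ x) ch) (subst (0 <_) (*-comm (Y (σ x) ch) _) YY))

  meet : ∀ (f e : Edge n) → ShareEndpoint f e → ∃ λ v → Incident v f × Incident v e
  meet f e (inj₁ i) = proj₁ f , inj₁ refl , i
  meet f e (inj₂ i) = proj₂ f , inj₂ refl , i

  colour-fresh : ∀ S e → Consistent S → All (λ q → ShareEndpoint (proj₁ q) e → proj₂ q ≢ colour S e) (done S)
  colour-fresh S e con = All.tabulate λ {q} mem sh → fresh q mem sh (sampled (conf S) (seed S) e) refl
    where
    fresh : ∀ q → q ∈ done S → ShareEndpoint (proj₁ q) e → ∀ ch → sampled (conf S) (seed S) e ≡ ch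
      → proj₂ q ≢ final ch e (done S)
    fresh q mem sh ch eq same with ch <? D
    ... | no _ = proj₂ (proj₂ (mex (length (blocked e (done S))) D (blocked e (done S)) ≤-refl))
          (subst (_∈ blocked e (done S)) same (∈-map⁺ proj₂ (∈-filter⁺ (greedy? e) mem (sh , subst (D ≤_) (sym same) (m≤m+n D _)))))
    ... | yes lt with meet (proj₁ q) e sh
    ...   | v , vq , ve = All.lookup con mem (subst (_< D) (sym same) lt) v vq
            (trans (cong (st (conf S v)) (trans same (sym eq))) (chosen-active (conf S) (seed S) e v (subst (_< D) (sym eq) lt) ve))

  Clash-free : Edge n × ℕ → Edge n × ℕ → Set
  Clash-free q p = ShareEndpoint (proj₁ q) (proj₁ p) → proj₂ q ≢ proj₂ p

  run-proper : ∀ S es → Consistent S → Proper (runState S es) × All (λ q → All (Clash-free q) (runState S es)) (done S)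
  run-proper S [] con = [] , All.tabulate (λ _ → [])
  run-proper S (e ∷ es) con with run-proper (advance S e) es (advance-consistent S e con)
  ... | proper , (here-free ∷ rest-free) = here-free ∷ proper
        , All.zipWith (λ (a , b) → a ∷ b) (colour-fresh S e con , rest-free)

  greedyAt : Fin n → Assignment → ℕ
  greedyAt v = sumL (λ q → inc v (proj₁ q) * ⟦ D ≤? proj₂ q ⟧)

  misses : Fin n → Conf → ℕ → List (Edge n) → ℕ
  misses v σ s [] = 0
  misses v σ s (e ∷ es) = inc v e * ⟦ D ≤? sampled σ s e ⟧ + misses v (gstep σ e (s % M)) (s / M) es

  blocked-length : ∀ e asg → length (blocked e asg) ≤ greedyAt (proj₁ e) asg + greedyAt (proj₂ e) asg
  blocked-length e@(x , y) asg = ≤-trans (≤-reflexive (length-map proj₂ (filter (greedy? e) asg))) (go asg)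
    where
    shared : ∀ q → Greedy e q → 1 ≤ inc x (proj₁ q) * ⟦ D ≤? proj₂ q ⟧ + inc y (proj₁ q) * ⟦ D ≤? proj₂ q ⟧
    shared q (sh , D≤) with meet (proj₁ q) e sh
    ... | v , vq , inj₁ refl = ≤-trans (≤-reflexive (sym (cong₂ _*_ (⟦⟧-yes (incident? x (proj₁ q)) vq) (⟦⟧-yes (D ≤? proj₂ q) D≤)))) (m≤m+n _ _)
    ... | v , vq , inj₂ refl = ≤-trans (≤-reflexive (sym (cong₂ _*_ (⟦⟧-yes (incident? y (proj₁ q)) vq) (⟦⟧-yes (D ≤? proj₂ q) D≤)))) (m≤n+m _ _)
    interchange : ∀ a b c d → a + b + (c + d) ≡ a + c + (b + d)
    interchange = solve-∀
    go : ∀ asg → length (filter (greedy? e) asg) ≤ greedyAt x asg + greedyAt y asg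
    go [] = z≤n
    go (q ∷ asg) = split (greedy? e q)
      where
      split : Dec (Greedy e q) → length (filter (greedy? e) (q ∷ asg)) ≤ greedyAt x (q ∷ asg) + greedyAt y (q ∷ asg)
      split (yes gq) = ≤-trans (≤-reflexive (cong length (filter-accept (greedy? e) {q} {asg} gq)))
        (≤-trans (+-mono-≤ (shared q gq) (go asg)) (≤-reflexive (interchange (inc x (proj₁ q) * ⟦ D ≤? proj₂ q ⟧) _ _ _)))
      split (no ¬gq) = ≤-trans (≤-reflexive (cong length (filter-reject (greedy? e) {q} {asg} ¬gq)))
        (≤-trans (go asg) (+-mono-≤ (m≤n+m (greedyAt x asg) (inc x (proj₁ q) * ⟦ D ≤? proj₂ q ⟧)) (m≤n+m (greedyAt y asg) (inc y (proj₁ q) * ⟦ D ≤? proj₂ q ⟧))))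

  final≤ : ∀ ch e asg → final ch e asg ≤ D + (greedyAt (proj₁ e) asg + greedyAt (proj₂ e) asg)
  final≤ ch e asg with ch <? D
  ... | yes lt = ≤-trans (<⇒≤ lt) (m≤m+n D _)
  ... | no _ = +-monoʳ-≤ D (≤-trans (proj₁ (proj₂ (mex (length (blocked e asg)) D (blocked e asg) ≤-refl))) (blocked-length e asg))

  final-greedy : ∀ ch e asg → ⟦ D ≤? final ch e asg ⟧ ≤ ⟦ D ≤? ch ⟧
  final-greedy ch e asg with ch <? D
  ... | yes lt = ≤-refl
  ... | no ¬lt = ≤-trans (⟦⟧≤1 (D ≤? fallback e asg)) (≤-reflexive (sym (⟦⟧-yes (D ≤? ch) (≮⇒≥ ¬lt))))

  -- Greedily coloured edges so far plus misses to come never increases along the run. A greedy edge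
  -- avoids at most f colours at each end, so it never needs an offset beyond 2 f.
  colours≤ : ∀ f S es → (∀ v → greedyAt v (done S) + misses v (conf S) (seed S) es ≤ f)
    → All (λ q → proj₂ q ≤ D + (f + f)) (runState S es)
  colours≤ f S [] h = []
  colours≤ f S (e ∷ es) h = ≤-trans (final≤ (sampled (conf S) (seed S) e) e (done S)) (+-monoʳ-≤ D (+-mono-≤ (now (proj₁ e)) (now (proj₂ e))))
      ∷ colours≤ f (advance S e) es later
    where
    now : ∀ v → greedyAt v (done S) ≤ f
    now v = ≤-trans (m≤m+n _ _) (h v)
    reorder : ∀ a b c → a + b + c ≡ b + (a + c)
    reorder = solve-∀
    later : ∀ v → greedyAt v (done (advance S e)) + misses v (conf (advance S e)) (seed S / M) es ≤ f
    later v = ≤-trans (+-monoˡ-≤ _ (+-monoˡ-≤ (greedyAt v (done S)) (*-monoʳ-≤ (inc v e) (final-greedy (sampled (conf S) (seed S) e) e (done S)))))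
      (≤-trans (≤-reflexive (reorder (inc v e * ⟦ D ≤? sampled (conf S) (seed S) e ⟧) (greedyAt v (done S)) _)) (h v))

  misses≤deg : ∀ v σ s es → misses v σ s es ≤ deg v es
  misses≤deg v σ s [] = z≤n
  misses≤deg v σ s (e ∷ es) = ≤-trans (+-mono-≤ (≤-trans (*-monoʳ-≤ (inc v e) (⟦⟧≤1 (D ≤? sampled σ s e))) (≤-reflexive (*-identityʳ (inc v e)))) (misses≤deg v _ (s / M) es))
    (≤-reflexive (sym (deg-cons v e es)))

  origin : ℕ → State
  origin s = state (λ _ → initial) s []

-- Greedy edges are rows of rate zero

module Misses (p : Params) (n : ℕ) where
  open Params p
  open Run p n
  open Global D J E B thr M n using (Conf; BoundedConf; gstep; gstep-bounded)
  open Colouring D J E B thr M initial n using (sampled; misses)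

  rateAt : Fin n → Conf → ℕ → List (Edge n) → ℕ → ℕ
  rateAt v σ s es i = rate (common (stateAt v σ s es i) (otherAt v σ s es i))

  unsampled : ∀ u z r → Bounded u → Bounded z → r < M → D ≤ choice u z r → rate (common u z) ≡ 0
  unsampled u z r bu bz r<M D≤ with rate (common u z) ≟ 0
  ... | yes e = e
  ... | no ≢0 = contradiction (pick-< (probs u z) D r (subst (r <_)
        (sym (trans (probs-sum u z) (rate-exact _ (common≤ u z bu bz) (n≢0⇒n>0 ≢0)))) r<M)) (≤⇒≯ D≤)

  misses≤ : ∀ v σ s es → BoundedConf σ → misses v σ s es ≤ ∑ (deg v es) (λ i → ⟦ rateAt v σ s es i ≟ 0 ⟧)
  misses≤ v σ s [] bd = z≤n
  misses≤ v σ s (e@(x , y) ∷ es) bd = subst (λ l → misses v σ s (e ∷ es) ≤ ∑ l (λ i → ⟦ rateAt v σ s (e ∷ es) i ≟ 0 ⟧))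
      (sym (deg-cons v e es)) (go (incident? v e))
    where
    σ′ = gstep σ e (s % M)
    F F′ : ℕ → Local
    F = stateAt v σ′ (s / M) es
    F′ = otherAt v σ′ (s / M) es
    ih : misses v σ′ (s / M) es ≤ ∑ (deg v es) (λ i → ⟦ rate (common (F i) (F′ i)) ≟ 0 ⟧)
    ih = misses≤ v σ′ (s / M) es (gstep-bounded σ e (s % M) bd)
    at-end : Incident v e → sampled σ s e ≡ choice (σ v) (σ (other v e)) (s % M)
    at-end i with v FinP.≟ x
    at-end i | yes refl = refl
    at-end (inj₁ q) | no ¬q = contradiction q ¬q
    at-end (inj₂ refl) | no _ = choice-comm (σ x) (σ y) (s % M)
    go : (d : Dec (Incident v e)) → ⟦ d ⟧ * ⟦ D ≤? sampled σ s e ⟧ + misses v σ′ (s / M) es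
      ≤ ∑ (⟦ d ⟧ + deg v es) (λ i → ⟦ rate (common (consIf d (σ v) F i) (consIf d (σ (other v e)) F′ i)) ≟ 0 ⟧)
    go (no _) = ih
    go (yes i) = ≤-trans (+-mono-≤ (≤-trans (≤-reflexive (+-identityʳ _))
        (⟦⟧-⇒ (D ≤? sampled σ s e) (rate (common (σ v) (σ (other v e))) ≟ 0)
          (λ D≤ → unsampled (σ v) (σ (other v e)) (s % M) (bd v) (bd (other v e)) (m%n<n s M) (subst (D ≤_) (at-end i) D≤)))) ih)
      (≤-reflexive (sym (∑-head (deg v es) _)))

-- Bounding the partial sums of the exponential series

-- (1 + 1/b)^b ≤ (1 + 1/(2b))^(2b) ≤ 4
[1+1/b]^b≤4 : ∀ b → (b + 1) ^ b ≤ 4 * b ^ b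
[1+1/b]^b≤4 zero = s≤s z≤n
[1+1/b]^b≤4 b@(suc b-1) = *-cancelʳ-≤ _ _ ((4 * b) ^ b) {{m^n≢0 (4 * b) b}} (begin
    (b + 1) ^ b * (4 * b) ^ b ≡⟨ sym (^-distribʳ-* b (b + 1) (4 * b)) ⟩
    ((b + 1) * (4 * b)) ^ b ≤⟨ ^-monoˡ-≤ b (≤-by 1 (l1 b)) ⟩
    ((b + b + 1) * (b + b + 1)) ^ b ≡⟨ ^-distribʳ-* b (b + b + 1) (b + b + 1) ⟩
    (b + b + 1) ^ b * (b + b + 1) ^ b ≤⟨ *-mono-≤ half half ⟩
    2 * (b + b) ^ b * (2 * (b + b) ^ b) ≡⟨ l2 ((b + b) ^ b) ⟩
    4 * ((b + b) ^ b * (b + b) ^ b) ≡⟨ cong (4 *_) (sym (^-distribʳ-* b (b + b) (b + b))) ⟩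
    4 * ((b + b) * (b + b)) ^ b ≡⟨ cong (λ x → 4 * x ^ b) (l3 b) ⟩
    4 * (b * (4 * b)) ^ b ≡⟨ cong (4 *_) (^-distribʳ-* b b (4 * b)) ⟩
    4 * (b ^ b * (4 * b) ^ b) ≡⟨ sym (*-assoc 4 (b ^ b) ((4 * b) ^ b)) ⟩
    4 * b ^ b * (4 * b) ^ b ∎)
  where
  open ≤-Reasoning
  half : (b + b + 1) ^ b ≤ 2 * (b + b) ^ b
  half = *-cancelʳ-≤ _ _ b (≤-trans (pow-upper b b) (≤-reflexive (l4 ((b + b) ^ b) b)))
    where
    l4 : ∀ x b → x * (b + b) ≡ 2 * x * b
    l4 = solve-∀
  l1 : ∀ b → (b + 1) * (4 * b) + 1 ≡ (b + b + 1) * (b + b + 1)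
  l1 = solve-∀
  l2 : ∀ x → 2 * x * (2 * x) ≡ 4 * (x * x)
  l2 = solve-∀
  l3 : ∀ b → (b + b) * (b + b) ≡ b * (4 * b)
  l3 = solve-∀

b^b≤ : ∀ b → b ^ b ≤ b ! * 4 ^ b
b^b≤ zero = s≤s z≤n
b^b≤ (suc b) = begin
  suc b * suc b ^ b ≡⟨ cong (λ x → suc b * x ^ b) (sym (+-comm b 1)) ⟩
  suc b * (b + 1) ^ b ≤⟨ *-monoʳ-≤ (suc b) (≤-trans ([1+1/b]^b≤4 b) (*-monoʳ-≤ 4 (b^b≤ b))) ⟩
  suc b * (4 * (b ! * 4 ^ b)) ≡⟨ lemma (suc b) (b !) (4 ^ b) ⟩
  suc b * b ! * (4 * 4 ^ b) ∎
  where
  open ≤-Reasoning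
  lemma : ∀ x y z → x * (4 * (y * z)) ≡ x * y * (4 * z)
  lemma = solve-∀

-- The ratio b^j / j! is largest at j = b, where `b^b≤` applies: consecutive ratios change by b / (j
-- + 1), which is at least 1 below b and at most 1 above.
power≤factorial : ∀ b j → b ^ j ≤ j ! * 4 ^ b
power≤factorial b j with ≤-total b j
... | inj₁ b≤j with m≤n⇒∃[o]m+o≡n b≤j
...   | o , refl = subst (λ j → b ^ j ≤ j ! * 4 ^ b) (+-comm o b) (above o)
  where
  open ≤-Reasoning
  above : ∀ o → b ^ (o + b) ≤ (o + b) ! * 4 ^ b
  above zero = b^b≤ b
  above (suc o) = begin
    b * b ^ (o + b) ≤⟨ *-mono-≤ (m≤n+m b (suc o)) (above o) ⟩
    (suc o + b) * ((o + b) ! * 4 ^ b) ≡⟨ sym (*-assoc (suc o + b) ((o + b) !) (4 ^ b)) ⟩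
    (suc o + b) * (o + b) ! * 4 ^ b ∎
power≤factorial b j | inj₂ j≤b with m≤n⇒∃[o]m+o≡n j≤b
... | o , eq = below o j eq
  where
  open ≤-Reasoning
  below : ∀ o j → j + o ≡ b → b ^ j ≤ j ! * 4 ^ b
  below zero j eq = subst (λ j → b ^ j ≤ j ! * 4 ^ b) (trans (sym eq) (+-identityʳ j)) (b^b≤ b)
  below (suc o) j eq = *-cancelˡ-≤ b {{>-nonZero (≤-trans (s≤s z≤n) j<b)}} (begin
      b ^ suc j ≤⟨ below o (suc j) (trans (sym (+-suc j o)) eq) ⟩
      suc j * j ! * 4 ^ b ≤⟨ *-monoˡ-≤ (4 ^ b) (*-monoˡ-≤ (j !) j<b) ⟩
      b * j ! * 4 ^ b ≡⟨ *-assoc b (j !) (4 ^ b) ⟩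
      b * (j ! * 4 ^ b) ∎)
    where
    j<b : suc j ≤ b
    j<b = subst (suc j ≤_) (trans (sym (+-suc j o)) eq) (m≤m+n (suc j) o)

-- expPartial a N = numer a N / N!
numer : ℕ → ℕ → ℕ
numer a zero = 0
numer a (suc N) = suc N * (numer a N + a ^ N)

numer≤ : ∀ a N → numer a N ≤ 2 * 16 ^ a * N !
numer≤ a N = *-cancelˡ-≤ (2 ^ N) {{m^n≢0 2 N}} (≤-trans (≤-trans (m≤m+n _ _) (main N)) (≤-reflexive (final (2 ^ N) (16 ^ a) (N !))))
  where
  open ≤-Reasoning
  final : ∀ x y z → 2 * x * y * z ≡ x * (2 * y * z)
  final = solve-∀
  term : ∀ N → 2 ^ N * a ^ N ≤ 16 ^ a * N !
  term N = begin
    2 ^ N * a ^ N ≡⟨ sym (^-distribʳ-* N 2 a) ⟩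
    (2 * a) ^ N ≤⟨ power≤factorial (2 * a) N ⟩
    N ! * 4 ^ (2 * a) ≡⟨ cong (N ! *_) (sym (^-*-assoc 4 2 a)) ⟩
    N ! * 16 ^ a ≡⟨ *-comm (N !) (16 ^ a) ⟩
    16 ^ a * N ! ∎
  -- Since a^j / j! ≤ 16^a / 2^j, the partial sum is at most 2 · 16^a (1 - 2^(-N)). The subtracted
  -- term is what the induction needs.
  main : ∀ N → 2 ^ N * numer a N + 2 * 16 ^ a * N ! ≤ 2 * 2 ^ N * 16 ^ a * N !
  main zero = ≤-reflexive (l0 (16 ^ a))
    where
    l0 : ∀ x → 1 * 0 + 2 * x * 1 ≡ 2 * 1 * x * 1
    l0 = solve-∀
  main (suc N) = begin
    2 * x * (suc N * (numer a N + a ^ N)) + 2 * y * (suc N * z) ≡⟨ l1 x (suc N) (numer a N) (a ^ N) y z ⟩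
    suc N * (2 * (x * numer a N) + 2 * (x * a ^ N) + 2 * (y * z)) ≤⟨ *-monoʳ-≤ (suc N) (+-monoˡ-≤ (2 * (y * z)) (+-monoʳ-≤ (2 * (x * numer a N)) (*-monoʳ-≤ 2 (term N)))) ⟩
    suc N * (2 * (x * numer a N) + 2 * (y * z) + 2 * (y * z)) ≡⟨ l2 (suc N) x (numer a N) y z ⟩
    2 * suc N * (x * numer a N + 2 * y * z) ≤⟨ *-monoʳ-≤ (2 * suc N) (main N) ⟩
    2 * suc N * (2 * x * y * z) ≡⟨ l3 (suc N) x y z ⟩
    2 * (2 * x) * y * (suc N * z) ∎
    where
    x = 2 ^ N
    y = 16 ^ a
    z = N !
    l1 : ∀ x n u p y z → 2 * x * (n * (u + p)) + 2 * y * (n * z) ≡ n * (2 * (x * u) + 2 * (x * p) + 2 * (y * z))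
    l1 = solve-∀
    l2 : ∀ n x u y z → n * (2 * (x * u) + 2 * (y * z) + 2 * (y * z)) ≡ 2 * n * (x * u + 2 * y * z)
    l2 = solve-∀
    l3 : ∀ n x y z → 2 * n * (2 * x * y * z) ≡ 2 * (2 * x) * y * (n * z)
    l3 = solve-∀

frac : ℕ → ℕ → ℚᵘ.ℚᵘ
frac n d = ℚᵘ.mkℚᵘ (int n) (pred d)

toℚᵘ-/ : ∀ n d {{_ : NonZero d}} → ℚ.toℚᵘ (int n ℚ./ d) ℚᵘ.≃ frac n d
toℚᵘ-/ n (suc d) = ℚP.toℚᵘ-fromℚᵘ (ℚᵘ.mkℚᵘ (int n) d)

frac-+ : ∀ a b c d d′ {{_ : NonZero d}} {{_ : NonZero d′}} → (a + b) * d′ ≡ c * d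
  → frac a d ℚᵘ.+ frac b d ℚᵘ.≃ frac c d′
frac-+ a b c d@(suc _) d′@(suc _) eq = ℚᵘ.*≡* (begin
  (int a ℤ.* int d ℤ.+ int b ℤ.* int d) ℤ.* int d′ ≡⟨ cong (ℤ._* int d′) (cong₂ ℤ._+_ (sym (ℤP.pos-* a d)) (sym (ℤP.pos-* b d))) ⟩
  int (a * d + b * d) ℤ.* int d′ ≡⟨ sym (ℤP.pos-* (a * d + b * d) d′) ⟩
  int ((a * d + b * d) * d′) ≡⟨ cong int (trans (l1 a b d d′) (trans (cong (d *_) eq) (l2 c d))) ⟩
  int (c * (d * d)) ≡⟨ ℤP.pos-* c (d * d) ⟩
  int c ℤ.* int (d * d) ∎)
  where
  open ≡-Reasoning
  l1 : ∀ a b d d′ → (a * d + b * d) * d′ ≡ d * ((a + b) * d′)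
  l1 = solve-∀
  l2 : ∀ c d → d * (c * d) ≡ c * (d * d)
  l2 = solve-∀

expPartial-numer : ∀ a N → ℚ.toℚᵘ (expPartial a N) ℚᵘ.≃ frac (numer a N) (N !)
expPartial-numer a zero = ℚᵘP.≃-refl
expPartial-numer a (suc N) = ℚᵘP.≃-trans (ℚP.toℚᵘ-homo-+ (expPartial a N) ((int (a ^ N) ℚ./ (N !)) {{N !≢0}}))
  (ℚᵘP.≃-trans (ℚᵘP.+-cong (expPartial-numer a N) (toℚᵘ-/ (a ^ N) (N !) {{N !≢0}}))
    (frac-+ (numer a N) (a ^ N) (numer a (suc N)) (N !) (suc N !) {{N !≢0}} {{suc N !≢0}} (lemma (numer a N + a ^ N) (suc N) (N !))))
  where
  lemma : ∀ x n z → x * (n * z) ≡ n * x * z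
  lemma = solve-∀

frac≤ : ∀ n d m {{_ : NonZero d}} → n ≤ m * d → frac n d ℚᵘ.≤ frac m 1
frac≤ n d@(suc _) m h = ℚᵘ.*≤* (subst₂ ℤ._≤_ (ℤP.pos-* n 1) (ℤP.pos-* m d) (ℤ.+≤+ (≤-trans (≤-reflexive (*-identityʳ n)) h)))

expLe : ∀ a m → 2 * 16 ^ a ≤ m → ExpLe a m
expLe a m h N = ℚP.toℚᵘ-cancel-≤ (ℚᵘP.≤-trans (ℚᵘP.≤-reflexive (expPartial-numer a N))
  (ℚᵘP.≤-trans (frac≤ (numer a N) (N !) m {{N !≢0}} (≤-trans (numer≤ a N) (*-monoˡ-≤ (N !) h)))
    (ℚᵘP.≤-reflexive (ℚᵘP.≃-sym (toℚᵘ-/ m 1)))))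

-- The bound 2 · 16^a for e^a is squared because L is only known to satisfy 2^L ≤ n².
expLe-power : ∀ a L n b → 2 ^ L ≤ n * n → 8 * a + 2 ≤ L * b → ExpLe a (n ^ b)
expLe-power a L n b 2^L≤ h = expLe a (n ^ b) (≮⇒≥ λ lt → <⇒≱ (*-mono-< lt lt) (begin
    2 * 16 ^ a * (2 * 16 ^ a) ≡⟨ l1 (16 ^ a) ⟩
    16 ^ a * 16 ^ a * 4 ≡⟨ cong (_* 4) (trans (sym (^-distribʳ-* a 16 16)) (^-*-assoc 2 8 a)) ⟩
    2 ^ (8 * a) * 2 ^ 2 ≡⟨ sym (^-distribˡ-+-* 2 (8 * a) 2) ⟩
    2 ^ (8 * a + 2) ≤⟨ ^-monoʳ-≤ 2 h ⟩
    2 ^ (L * b) ≡⟨ sym (^-*-assoc 2 L b) ⟩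
    (2 ^ L) ^ b ≤⟨ ^-monoˡ-≤ b 2^L≤ ⟩
    (n * n) ^ b ≡⟨ ^-distribʳ-* b n n ⟩
    n ^ b * n ^ b ∎))
  where
  open ≤-Reasoning
  l1 : ∀ x → 2 * x * (2 * x) ≡ x * x * 4
  l1 = solve-∀

-- Integer logarithms and roots

largest : ∀ {P : ℕ → Set} → (∀ y → Dec (P y)) → ∀ b → P 0 → ¬ P b → ∃ λ y → P y × ¬ P (suc y)
largest P? zero p0 ¬pb = contradiction p0 ¬pb
largest P? (suc b) p0 ¬pb with P? b
... | yes pb = b , pb , ¬pb
... | no ¬pb′ = largest P? b p0 ¬pb′

n<2^n : ∀ n → n < 2 ^ n
n<2^n zero = s≤s z≤n
n<2^n (suc n) = begin-strict
  suc n <⟨ s≤s (n<2^n n) ⟩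
  1 + 2 ^ n ≤⟨ +-monoˡ-≤ (2 ^ n) (>-nonZero⁻¹ (2 ^ n) {{m^n≢0 2 n}}) ⟩
  2 ^ n + 2 ^ n ≡⟨ cong (2 ^ n +_) (sym (+-identityʳ (2 ^ n))) ⟩
  2 * 2 ^ n ∎
  where open ≤-Reasoning

n≤n^k : ∀ n k → 0 < n → n ≤ n ^ suc k
n≤n^k n k n>0 = m≤m*n n (n ^ k) {{m^n≢0 n k {{>-nonZero n>0}}}}

<-pow : ∀ k {x B} → x < B → x < B ^ suc k
<-pow k {x} {B} x<B = ≤-trans x<B (n≤n^k B k (≤-trans (s≤s z≤n) x<B))

∣-factorial : ∀ N n → 0 < N → N ≤ n → N ∣ n !
∣-factorial (suc N) n _ N≤n = ∣-trans (m∣m*n (N !)) (m≤n⇒m!∣n! N≤n)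

abstract
  logarithm : ∀ n → 2 ≤ n → ∃ λ L → 0 < L × n ≤ 2 ^ L × 2 ^ L ≤ n * n
  logarithm n n≥2 with largest (λ y → 2 ^ y ≤? n) n (<⇒≤ n≥2) (<⇒≱ (n<2^n n))
  ... | y , 2^y≤ , ¬2^y = suc y , s≤s z≤n , <⇒≤ (≰⇒> ¬2^y) , *-mono-≤ n≥2 2^y≤

  scale : ∀ k K N → 0 < k → 0 < K → ∃ λ g → K * g ^ k ≤ N × ¬ (K * suc g ^ k ≤ N)
  scale (suc k) K N _ K>0 = largest (λ g → K * g ^ suc k ≤? N) (suc N) (≤-trans (≤-reflexive (*-zeroʳ K)) z≤n)
    (<⇒≱ (≤-trans (<-pow k {N} {suc N} ≤-refl) (m≤n*m (suc N ^ suc k) K {{>-nonZero K>0}})))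

-- Abstract, since conversion checking would otherwise unfold these numerals in unary.
abstract
  c K₅ K₁₁ K₁₄ : ℕ
  c = 2 ^ 20
  K₅ = 256 * 5 ^ 30
  K₁₁ = 2 ^ 11
  K₁₄ = 2 ^ 14

  K₅-spec : ∀ g → 256 * (5 * g) ^ 30 ≡ K₅ * g ^ 30
  K₅-spec g = trans (cong (256 *_) (^-distribʳ-* 30 5 g)) (sym (*-assoc 256 (5 ^ 30) (g ^ 30)))

  K₁₄-spec : ∀ y → (2 * y) ^ 14 ≡ K₁₄ * y ^ 14
  K₁₄-spec y = ^-distribʳ-* 14 2 y

  K₅≤c⁴ : K₅ ≤ c ^ 4
  K₅≤c⁴ = ≤ᵇ⇒≤ (256 * 5 ^ 30) ((2 ^ 20) ^ 4) _

  KK≤c¹⁰ : 256 * K₁₄ * K₁₁ ≤ c ^ 10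
  KK≤c¹⁰ = ≤ᵇ⇒≤ (256 * 2 ^ 14 * 2 ^ 11) ((2 ^ 20) ^ 10) _

  32K₁₄≤c : 32 * K₁₄ ≤ c
  32K₁₄≤c = ≤ᵇ⇒≤ (32 * 2 ^ 14) (2 ^ 20) _

  8≤c : 8 ≤ c
  8≤c = ≤ᵇ⇒≤ 8 (2 ^ 20) _

  1024*16≤K₁₄ : 1024 * 16 ≤ K₁₄
  1024*16≤K₁₄ = ≤ᵇ⇒≤ (1024 * 16) (2 ^ 14) _

  1632≤K₁₁ : 1632 ≤ K₁₁
  1632≤K₁₁ = ≤ᵇ⇒≤ 1632 (2 ^ 11) _

c>0 : 0 < c
c>0 = ≤-trans (s≤s z≤n) 8≤c

-- Parameters for given n, Δ and accuracy g

module Choice (n Δ L g : ℕ)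
  (Δ>0 : 0 < Δ) (g>0 : 0 < g) (n≤2^L : n ≤ 2 ^ L) (L>0 : 0 < L) (large : c ^ 32 * L * g ^ 32 ≤ Δ * Δ) where
  open ≤-Reasoning

  G d t H : ℕ
  G = g + 4
  d = 16 * (G * g)
  H = c * G

  G>0 : 0 < G
  G>0 = ≤-trans g>0 (m≤m+n g 4)

  H>0 : 0 < H
  H>0 = *-mono-≤ c>0 G>0

  instance
    G≢0 : NonZero G
    G≢0 = >-nonZero G>0
    H≢0 : NonZero H
    H≢0 = >-nonZero H>0
    g≢0 : NonZero g
    g≢0 = >-nonZero g>0
    c≢0 : NonZero c
    c≢0 = >-nonZero c>0
    d≢0 : NonZero d
    d≢0 = m*n≢0 16 (G * g) {{_}} {{m*n≢0 G g}}

  t = suc (Δ / d)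

  Δ≤dt : Δ ≤ d * t
  Δ≤dt = begin
    Δ ≡⟨ m≡m%n+[m/n]*n Δ d ⟩
    Δ % d + Δ / d * d ≤⟨ +-monoˡ-≤ (Δ / d * d) (<⇒≤ (m%n<n Δ d)) ⟩
    d + Δ / d * d ≡⟨ *-comm t d ⟩
    d * t ∎

  d[t-1]≤Δ : d * (Δ / d) ≤ Δ
  d[t-1]≤Δ = subst (_≤ Δ) (*-comm (Δ / d) d) (m/n*n≤m Δ d)

  Δ≤ : Δ ≤ 16 * (G * (g * t))
  Δ≤ = ≤-trans Δ≤dt (≤-reflexive (lemma G g t))
    where
    lemma : ∀ G g t → 16 * (G * g) * t ≡ 16 * (G * (g * t))
    lemma = solve-∀

  G≤5g : G ≤ 5 * g
  G≤5g = +-monoʳ-≤ g (*-monoʳ-≤ 4 g>0)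

  G^30≤ : 256 * G ^ 30 ≤ c ^ 4 * g ^ 30
  G^30≤ = begin
    256 * G ^ 30 ≤⟨ *-monoʳ-≤ 256 (^-monoˡ-≤ 30 G≤5g) ⟩
    256 * (5 * g) ^ 30 ≡⟨ K₅-spec g ⟩
    K₅ * g ^ 30 ≤⟨ *-monoˡ-≤ (g ^ 30) K₅≤c⁴ ⟩
    c ^ 4 * g ^ 30 ∎

  -- Here 32 splits as 28 + 4: Δ² ≤ d² t², and d² is of order G² g². Since G ≤ 5 g, the powers of G
  -- and g are interchangeable at the expense of c⁴.
  H^28L≤tt : H ^ 28 * L ≤ t * t
  H^28L≤tt = *-cancelˡ-≤ (d * d) {{m*n≢0 d d}} (begin
    d * d * (H ^ 28 * L) ≡⟨ cong (λ x → d * d * (x * L)) (^-distribʳ-* 28 c G) ⟩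
    d * d * (c ^ 28 * G ^ 28 * L) ≡⟨ l1 G g (c ^ 28) (G ^ 28) L ⟩
    256 * (G * (G * G ^ 28)) * (c ^ 28 * L * (g * g)) ≤⟨ *-monoˡ-≤ (c ^ 28 * L * (g * g)) G^30≤ ⟩
    c ^ 4 * g ^ 30 * (c ^ 28 * L * (g * g)) ≡⟨ l2 (c ^ 4) (g ^ 30) (c ^ 28) L g ⟩
    c ^ 4 * c ^ 28 * L * (g * (g * g ^ 30)) ≡⟨ cong (λ x → x * L * g ^ 32) (sym (^-distribˡ-+-* c 4 28)) ⟩
    c ^ 32 * L * g ^ 32 ≤⟨ large ⟩
    Δ * Δ ≤⟨ *-mono-≤ Δ≤dt Δ≤dt ⟩
    d * t * (d * t) ≡⟨ l3 d t ⟩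
    d * d * (t * t) ∎)
    where
    l1 : ∀ G g a b L → 16 * (G * g) * (16 * (G * g)) * (a * b * L) ≡ 256 * (G * (G * b)) * (a * L * (g * g))
    l1 = solve-∀
    l2 : ∀ a b e L g → a * b * (e * L * (g * g)) ≡ a * e * L * (g * (g * b))
    l2 = solve-∀
    l3 : ∀ d t → d * t * (d * t) ≡ d * d * (t * t)
    l3 = solve-∀

  H^14≤t : H ^ 14 ≤ t
  H^14≤t = ≮⇒≥ λ lt → <⇒≱ (*-mono-< lt lt) (begin
    H ^ 14 * H ^ 14 ≡⟨ sym (^-distribˡ-+-* H 14 14) ⟩
    H ^ 28 ≤⟨ m≤m*n (H ^ 28) L {{>-nonZero L>0}} ⟩
    H ^ 28 * L ≤⟨ H^28L≤tt ⟩
    t * t ∎)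

  H≤H^ : ∀ j k → j ≤ k → H ^ j ≤ H ^ k
  H≤H^ j k h = ^-monoʳ-≤ H h

  -- The 14th root of t serves as a crude substitute for log Δ: it dominates both H and, up to the
  -- factor 17, the logarithm. In the union bound A takes y¹⁰, D takes y² t, and the logarithm takes
  -- one more y, within y¹⁴ t.
  root : ∃ λ y → 1 * y ^ 14 ≤ t × ¬ (1 * suc y ^ 14 ≤ t)
  root = scale 14 1 t (s≤s z≤n) (s≤s z≤n)

  y : ℕ
  y = proj₁ root

  y^14≤t : y ^ 14 ≤ t
  y^14≤t = ≤-trans (≤-reflexive (sym (*-identityˡ (y ^ 14)))) (proj₁ (proj₂ root))

  H≤y : H ≤ y
  H≤y = ≮⇒≥ λ lt → proj₂ (proj₂ root) (≤-trans (≤-reflexive (*-identityˡ (suc y ^ 14))) (≤-trans (^-monoˡ-≤ 14 lt) H^14≤t))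

  G≤H : G ≤ H
  G≤H = m≤n*m G c

  c≤H : c ≤ H
  c≤H = m≤m*n c G

  G≤y : G ≤ y
  G≤y = ≤-trans G≤H H≤y

  c≤y : c ≤ y
  c≤y = ≤-trans c≤H H≤y

  t≤[y+1]^14 : t ≤ suc y ^ 14
  t≤[y+1]^14 = <⇒≤ (subst (t <_) (*-identityˡ (suc y ^ 14)) (≰⇒> (proj₂ (proj₂ root))))

  instance
    y≢0 : NonZero y
    y≢0 = >-nonZero (≤-trans c>0 c≤y)

  q τ E D ℓ b : ℕ
  -- From Δ² ≤ 256 G⁴ t² and t² ≤ 16 G² τ follows 4 Δ² ≤ 1024 · 16 G⁶ τ, which must be at most q τ.
  q = K₁₄ * G ^ 6
  τ = (t * t) / (8 * (G * G))
    where instance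
      8GG≢0 : NonZero (8 * (G * G))
      8GG≢0 = m*n≢0 8 (G * G) {{_}} {{m*n≢0 G G}}
  E = 16 * (G * G)
  D = E * t
  ℓ = y * 17
  -- The binary logarithm of the number of events: 1 for the two tails, L for the vertex and L for
  -- the desired probability 1/n, Δ for the set of rows, and D ℓ for each family of interval ends.
  b = 1 + (L + L) + Δ + (D * ℓ + D * ℓ)

  q>0 : 0 < q
  q>0 = *-mono-≤ {1} {K₁₄} (≤-trans (s≤s z≤n) 1024*16≤K₁₄) (>-nonZero⁻¹ (G ^ 6) {{m^n≢0 G 6}})

  g≤G : g ≤ G
  g≤G = m≤m+n g 4

  Δ≤D : Δ ≤ D
  Δ≤D = ≤-trans Δ≤dt (*-monoˡ-≤ t (*-monoʳ-≤ 16 (*-monoʳ-≤ G g≤G)))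

  sucΔ≤ : suc Δ ≤ 2 ^ ℓ
  sucΔ≤ = begin
    suc Δ ≤⟨ +-mono-≤ {1} {D} (*-mono-≤ (*-mono-≤ {1} {16} (s≤s z≤n) (*-mono-≤ G>0 G>0)) (s≤s z≤n)) Δ≤D ⟩
    D + D ≡⟨ l1 (G * G) t ⟩
    32 * (G * G) * t ≤⟨ *-mono-≤ (*-monoʳ-≤ 32 (*-mono-≤ G≤y G≤y)) t≤[y+1]^14 ⟩
    32 * (y * y) * suc y ^ 14 ≤⟨ *-monoʳ-≤ (32 * (y * y)) (^-monoˡ-≤ 14 (≤-trans (+-monoˡ-≤ y (>-nonZero⁻¹ y)) (≤-reflexive (cong (y +_) (sym (+-identityʳ y)))))) ⟩
    32 * (y * y) * (2 * y) ^ 14 ≡⟨ cong (32 * (y * y) *_) (K₁₄-spec y) ⟩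
    32 * (y * y) * (K₁₄ * y ^ 14) ≡⟨ l2 32 y K₁₄ (y ^ 14) ⟩
    32 * K₁₄ * (y * (y * y ^ 14)) ≤⟨ *-monoˡ-≤ (y ^ 16) (≤-trans 32K₁₄≤c c≤y) ⟩
    y ^ 17 ≤⟨ ^-monoˡ-≤ 17 (<⇒≤ (n<2^n y)) ⟩
    (2 ^ y) ^ 17 ≡⟨ ^-*-assoc 2 y 17 ⟩
    2 ^ ℓ ∎
    where
    l1 : ∀ a t → 16 * a * t + 16 * a * t ≡ 32 * a * t
    l1 = solve-∀
    l2 : ∀ a y b e → a * (y * y) * (b * e) ≡ a * b * (y * (y * e))
    l2 = solve-∀

  tests≤ : 2 * (n * (2 ^ Δ * (suc Δ ^ D * suc Δ ^ D))) * n ≤ 2 ^ b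
  tests≤ = begin
    2 * (n * (2 ^ Δ * (suc Δ ^ D * suc Δ ^ D))) * n ≡⟨ l1 n (2 ^ Δ) (suc Δ ^ D) ⟩
    2 * (n * n) * 2 ^ Δ * (suc Δ ^ D * suc Δ ^ D)
      ≤⟨ *-mono-≤ (*-monoˡ-≤ (2 ^ Δ) (*-monoʳ-≤ 2 (*-mono-≤ n≤2^L n≤2^L))) (*-mono-≤ pw pw) ⟩
    2 * (2 ^ L * 2 ^ L) * 2 ^ Δ * (2 ^ (D * ℓ) * 2 ^ (D * ℓ)) ≡⟨ cong₂ (λ x z → 2 * x * 2 ^ Δ * z) (sym (^-distribˡ-+-* 2 L L)) (sym (^-distribˡ-+-* 2 (D * ℓ) (D * ℓ))) ⟩
    2 ^ (1 + (L + L)) * 2 ^ Δ * 2 ^ (D * ℓ + D * ℓ) ≡⟨ cong (_* 2 ^ (D * ℓ + D * ℓ)) (sym (^-distribˡ-+-* 2 (1 + (L + L)) Δ)) ⟩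
    2 ^ (1 + (L + L) + Δ) * 2 ^ (D * ℓ + D * ℓ) ≡⟨ sym (^-distribˡ-+-* 2 (1 + (L + L) + Δ) (D * ℓ + D * ℓ)) ⟩
    2 ^ b ∎
    where
    l1 : ∀ n a x → 2 * (n * (a * (x * x))) * n ≡ 2 * (n * n) * a * (x * x)
    l1 = solve-∀
    pw : suc Δ ^ D ≤ 2 ^ (D * ℓ)
    pw = begin
      suc Δ ^ D ≤⟨ ^-monoˡ-≤ D sucΔ≤ ⟩
      (2 ^ ℓ) ^ D ≡⟨ trans (^-*-assoc 2 ℓ D) (cong (2 ^_) (*-comm ℓ D)) ⟩
      2 ^ (D * ℓ) ∎

  instance
    8GG≢0 : NonZero (8 * (G * G))
    8GG≢0 = m*n≢0 8 (G * G) {{_}} {{m*n≢0 G G}}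

  τ≤ : 8 * (G * G) * τ ≤ t * t
  τ≤ = subst (_≤ t * t) (*-comm τ (8 * (G * G))) (m/n*n≤m (t * t) (8 * (G * G)))

  tt≤ : t * t ≤ 16 * (G * G) * τ
  tt≤ = begin
    t * t ≡⟨ m≡m%n+[m/n]*n (t * t) (8 * (G * G)) ⟩
    t * t % (8 * (G * G)) + τ * (8 * (G * G)) ≤⟨ +-monoˡ-≤ (τ * (8 * (G * G))) (<⇒≤ (m%n<n (t * t) (8 * (G * G)))) ⟩
    8 * (G * G) + τ * (8 * (G * G)) ≤⟨ +-monoˡ-≤ (τ * (8 * (G * G))) (m≤n*m (8 * (G * G)) τ {{>-nonZero τ>0}}) ⟩
    τ * (8 * (G * G)) + τ * (8 * (G * G)) ≡⟨ l1 τ (G * G) ⟩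
    16 * (G * G) * τ ∎
    where
    l1 : ∀ τ a → τ * (8 * a) + τ * (8 * a) ≡ 16 * a * τ
    l1 = solve-∀
    8GG≤tt : 8 * (G * G) ≤ t * t
    8GG≤tt = begin
      8 * (G * G) ≤⟨ *-mono-≤ 8≤c (m≤m*n (G * G) 1) ⟩
      c * (G * G * 1) ≤⟨ *-monoˡ-≤ (G * G * 1) (m≤m*n c c) ⟩
      c * c * (G * G * 1) ≡⟨ l2 c G ⟩
      H * H ≤⟨ *-mono-≤ H≤t H≤t ⟩
      t * t ∎
      where
      l2 : ∀ c G → c * c * (G * G * 1) ≡ c * G * (c * G)
      l2 = solve-∀
      H≤t : H ≤ t
      H≤t = ≤-trans (n≤n^k H 13 H>0) H^14≤t
    τ>0 : 0 < τ
    τ>0 = ≤-trans (≤-reflexive (sym (n/n≡1 (8 * (G * G))))) (/-monoˡ-≤ (8 * (G * G)) 8GG≤tt)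

  t≥ : 4 * (G * G * G * G * G) ≤ t
  t≥ = begin
    4 * (G * G * G * G * G) ≤⟨ *-monoˡ-≤ (G * G * G * G * G) (≤-trans (≤ᵇ⇒≤ 4 8 _) (≤-trans 8≤c (n≤n^k c 4 c>0))) ⟩
    c ^ 5 * (G * G * G * G * G) ≡⟨ cong (c ^ 5 *_) (l1 G) ⟩
    c ^ 5 * G ^ 5 ≡⟨ sym (^-distribʳ-* 5 c G) ⟩
    H ^ 5 ≤⟨ H≤H^ 5 14 (≤ᵇ⇒≤ 5 14 _) ⟩
    H ^ 14 ≤⟨ H^14≤t ⟩
    t ∎
    where
    l1 : ∀ G → G * G * G * G * G ≡ G * (G * (G * (G * (G * 1))))
    l1 = solve-∀

  A : ℕ
  A = 16 * (G * G) * (16 * q * (G * G))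

  A-small : A * K₁₁ ≤ H ^ 10
  A-small = begin
    16 * (G * G) * (16 * (K₁₄ * G ^ 6) * (G * G)) * K₁₁ ≡⟨ l1 K₁₄ K₁₁ G (G ^ 6) ⟩
    256 * K₁₄ * K₁₁ * (G * (G * (G * (G * G ^ 6)))) ≤⟨ *-monoˡ-≤ (G ^ 10) KK≤c¹⁰ ⟩
    c ^ 10 * G ^ 10 ≡⟨ sym (^-distribʳ-* 10 c G) ⟩
    H ^ 10 ∎
    where
    l1 : ∀ a b G x → 16 * (G * G) * (16 * (a * x) * (G * G)) * b ≡ 256 * a * b * (G * (G * (G * (G * x))))
    l1 = solve-∀

  b≤ : b ≤ 3 * L + 3 * (D * ℓ)
  b≤ = begin
    1 + (L + L) + Δ + (D * ℓ + D * ℓ) ≤⟨ +-monoˡ-≤ (D * ℓ + D * ℓ) (+-mono-≤ (+-monoˡ-≤ (L + L) L>0) (≤-trans Δ≤D (m≤m*n D ℓ {{m*n≢0 y 17}}))) ⟩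
    L + (L + L) + D * ℓ + (D * ℓ + D * ℓ) ≡⟨ l1 L (D * ℓ) ⟩
    3 * L + 3 * (D * ℓ) ∎
    where
    l1 : ∀ L x → L + (L + L) + x + (x + x) ≡ 3 * L + 3 * x
    l1 = solve-∀

  Ab≤ : A * b ≤ t * t
  Ab≤ = *-cancelˡ-≤ 2 (begin
    2 * (A * b) ≤⟨ *-monoʳ-≤ 2 (*-monoʳ-≤ A b≤) ⟩
    2 * (A * (3 * L + 3 * (D * ℓ))) ≡⟨ l1 A L (G * G) t y ⟩
    A * 6 * L + A * 1632 * (G * G * t * y) ≤⟨ +-mono-≤ partL partD ⟩
    t * t + t * t ≡⟨ cong (t * t +_) (sym (+-identityʳ (t * t))) ⟩
    2 * (t * t) ∎)
    where
    l1 : ∀ A L a t y → 2 * (A * (3 * L + 3 * (16 * a * t * (y * 17)))) ≡ A * 6 * L + A * 1632 * (a * t * y)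
    l1 = solve-∀
    partL : A * 6 * L ≤ t * t
    partL = begin
      A * 6 * L ≤⟨ *-monoˡ-≤ L (≤-trans (*-monoʳ-≤ A (≤-trans (≤ᵇ⇒≤ 6 1632 _) 1632≤K₁₁)) (≤-trans A-small (H≤H^ 10 28 (≤ᵇ⇒≤ 10 28 _)))) ⟩
      H ^ 28 * L ≤⟨ H^28L≤tt ⟩
      t * t ∎
    partD : A * 1632 * (G * G * t * y) ≤ t * t
    partD = begin
      A * 1632 * (G * G * t * y) ≤⟨ *-mono-≤ (≤-trans (*-monoʳ-≤ A 1632≤K₁₁) (≤-trans A-small (^-monoˡ-≤ 10 H≤y)))
          (*-monoˡ-≤ y (*-monoˡ-≤ t (*-mono-≤ G≤y G≤y))) ⟩
      y ^ 10 * (y * y * t * y) ≡⟨ l2 (y ^ 10) y t ⟩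
      y * (y * (y * y ^ 10)) * t ≤⟨ *-monoˡ-≤ t (≤-trans (m≤n*m (y ^ 13) y) y^14≤t) ⟩
      t * t ∎
      where
      l2 : ∀ a y t → a * (y * y * t * y) ≡ y * (y * (y * a)) * t
      l2 = solve-∀

  pp : ℕ
  pp = 2 * q * G

  -- Each of the two terms takes half of q τ: the union bound through `Ab≤`, and the loss at the
  -- links through the size of q.
  enough : pp * suc pp * b + 2 * (Δ * Δ) ≤ q * τ
  enough = *-cancelˡ-≤ 2 (begin
    2 * (pp * suc pp * b + 2 * (Δ * Δ)) ≤⟨ *-monoʳ-≤ 2 (+-monoˡ-≤ (2 * (Δ * Δ)) (*-monoˡ-≤ b (*-monoʳ-≤ pp suc-pp≤))) ⟩
    2 * (pp * (pp + pp) * b + 2 * (Δ * Δ)) ≡⟨ l1 q G b (Δ * Δ) ⟩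
    q * (16 * q * (G * G) * b) + 4 * (Δ * Δ) ≤⟨ +-mono-≤ (*-monoʳ-≤ q first-part) second-part ⟩
    q * τ + q * τ ≡⟨ cong (q * τ +_) (sym (+-identityʳ (q * τ))) ⟩
    2 * (q * τ) ∎)
    where
    suc-pp≤ : suc pp ≤ pp + pp
    suc-pp≤ = +-monoˡ-≤ pp (*-mono-≤ (*-mono-≤ {1} {2} (s≤s z≤n) q>0) G>0)
    l1 : ∀ q G b x → 2 * (2 * q * G * (2 * q * G + 2 * q * G) * b + 2 * x) ≡ q * (16 * q * (G * G) * b) + 4 * x
    l1 = solve-∀
    first-part : 16 * q * (G * G) * b ≤ τ
    first-part = *-cancelˡ-≤ (16 * (G * G)) {{m*n≢0 16 (G * G) {{_}} {{m*n≢0 G G}}}} (begin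
      16 * (G * G) * (16 * q * (G * G) * b) ≡⟨ sym (*-assoc (16 * (G * G)) (16 * q * (G * G)) b) ⟩
      A * b ≤⟨ Ab≤ ⟩
      t * t ≤⟨ tt≤ ⟩
      16 * (G * G) * τ ∎)
    second-part : 4 * (Δ * Δ) ≤ q * τ
    second-part = begin
      4 * (Δ * Δ) ≤⟨ *-monoʳ-≤ 4 (*-mono-≤ Δ≤D Δ≤D) ⟩
      4 * (16 * (G * G) * t * (16 * (G * G) * t)) ≡⟨ l2 (G * G) t ⟩
      1024 * (G * G) * (G * G) * (t * t) ≤⟨ *-monoʳ-≤ (1024 * (G * G) * (G * G)) tt≤ ⟩
      1024 * (G * G) * (G * G) * (16 * (G * G) * τ) ≡⟨ l3 1024 16 G τ ⟩
      1024 * 16 * G ^ 6 * τ ≤⟨ *-monoˡ-≤ τ (*-monoˡ-≤ (G ^ 6) 1024*16≤K₁₄) ⟩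
      q * τ ∎
      where
      l2 : ∀ a t → 4 * (16 * a * t * (16 * a * t)) ≡ 1024 * a * a * (t * t)
      l2 = solve-∀
      l3 : ∀ u v G τ → u * (G * G) * (G * G) * (v * (G * G) * τ) ≡ u * v * (G * (G * (G * (G * (G * (G * 1)))))) * τ
      l3 = solve-∀

  e₁ J Dh M : ℕ
  e₁ = 16 * (G * (G * G))
  J = 4 * e₁
  Dh = 16 * (G * ((g + 3) * t))
  M = (D * (J * G * (J * G))) !

  params : Params
  params = record
    { g = g ; t = t ; e = pred e₁ ; e₁ = e₁ ; J = J ; τ = τ ; M = M ; G = G ; D = D ; E = E ; Dh = Dh
    ; g>0 = g>0 ; t>0 = s≤s z≤n ; M>0 = 1≤n! (D * (J * G * (J * G)))
    ; G≡ = refl ; E≡ = refl ; D≡ = refl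
    ; e₁≡suc = sym (suc-pred e₁ {{m*n≢0 16 (G * (G * G)) {{_}} {{m*n≢0 G (G * G) {{G≢0}} {{m*n≢0 G G}}}}}})
    ; J≡ = refl ; e≡ = refl ; Dh≡ = refl ; τ≤ = τ≤ ; t≥ = t≥
    ; M-div = λ N N>0 N≤ → ∣-factorial N _ N>0 N≤
    }

  -- The 83 G t consist of 16 G t for rounding Δ up to d t, 64 G t for G - g = 4, and 3 G t for the
  -- 2 t + 1 greedy colours. With t ≤ 2 (Δ / d), 88 = 11 · 16 / 2 makes d appear.
  few-colours : (D + (t + t) + 1 ∸ Δ) * g ≤ 11 * Δ
  few-colours = begin
    (D + (t + t) + 1 ∸ Δ) * g ≤⟨ *-monoˡ-≤ g (m≤n+o⇒m∸n≤o (D + (t + t) + 1) Δ D≤) ⟩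
    83 * (G * t) * g ≤⟨ *-monoˡ-≤ g (*-monoˡ-≤ (G * t) (≤ᵇ⇒≤ 83 88 _)) ⟩
    88 * (G * t) * g ≤⟨ *-monoˡ-≤ g (*-monoʳ-≤ 88 (*-monoʳ-≤ G t≤2s)) ⟩
    88 * (G * (s + s)) * g ≡⟨ l1 G s g ⟩
    11 * (d * s) ≤⟨ *-monoʳ-≤ 11 d[t-1]≤Δ ⟩
    11 * Δ ∎
    where
    s = Δ / d
    l1 : ∀ G s g → 88 * (G * (s + s)) * g ≡ 11 * (16 * (G * g) * s)
    l1 = solve-∀
    4G≤t : 4 * G ≤ t
    4G≤t = ≤-trans (*-monoʳ-≤ 4 (≤-trans (m≤n*m G (G * G * G * G) {{m*n≢0 (G * G * G) G {{m*n≢0 (G * G) G {{m*n≢0 G G}}}}}}) ≤-refl)) t≥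
    t≤2s : t ≤ s + s
    t≤2s = +-monoˡ-≤ s (s≤s⁻¹ (≤-trans (≤-trans (≤ᵇ⇒≤ 2 4 _) (*-monoʳ-≤ 4 G>0)) 4G≤t))
    g≤t : g ≤ t
    g≤t = ≤-trans g≤G (≤-trans (m≤n*m G 4) 4G≤t)
    t≤Gt : t ≤ G * t
    t≤Gt = m≤n*m t G
    D≤ : D + (t + t) + 1 ≤ Δ + 83 * (G * t)
    D≤ = begin
      16 * (G * (g + 4)) * t + (t + t) + 1 ≡⟨ l2 G g t ⟩
      16 * (G * g) * t + (64 * (G * t) + (t + t + 1)) ≡⟨ cong (_+ (64 * (G * t) + (t + t + 1))) (*-suc d s) ⟩
      d + d * s + (64 * (G * t) + (t + t + 1)) ≤⟨ +-mono-≤ (+-mono-≤ (*-monoʳ-≤ 16 (*-monoʳ-≤ G g≤t)) d[t-1]≤Δ)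
          (+-monoʳ-≤ (64 * (G * t)) (+-mono-≤ (+-mono-≤ t≤Gt t≤Gt) (≤-trans (s≤s z≤n) t≤Gt))) ⟩
      16 * (G * t) + Δ + (64 * (G * t) + (G * t + G * t + G * t)) ≡⟨ l3 (G * t) Δ ⟩
      Δ + 83 * (G * t) ∎
      where
      l2 : ∀ G g t → 16 * (G * (g + 4)) * t + (t + t) + 1 ≡ 16 * (G * g) * t + (64 * (G * t) + (t + t + 1))
      l2 = solve-∀
      l3 : ∀ x Δ → 16 * x + Δ + (64 * x + (x + x + x)) ≡ Δ + 83 * x
      l3 = solve-∀

-- Choice of the parameters and the final bound

sumL-+ : ∀ {a} {A : Set a} (f g : A → ℕ) xs → sumL (λ x → f x + g x) xs ≡ sumL f xs + sumL g xs
sumL-+ f g [] = refl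
sumL-+ f g (x ∷ xs) = trans (cong (f x + g x +_) (sumL-+ f g xs)) (lemma (f x) (g x) (sumL f xs) (sumL g xs))
  where
  lemma : ∀ a b c d → a + b + (c + d) ≡ a + c + (b + d)
  lemma = solve-∀

sumL-member : ∀ {a} {A : Set a} (f : A → ℕ) {x xs} → x ∈ xs → f x ≤ sumL f xs
sumL-member f {xs = x ∷ xs} (here refl) = m≤m+n (f x) (sumL f xs)
sumL-member f {xs = y ∷ xs} (there mem) = ≤-trans (sumL-member f mem) (m≤n+m (sumL f xs) (f y))

sumL-cong : ∀ {a} {A : Set a} {f g : A → ℕ} xs → (∀ x → f x ≡ g x) → sumL f xs ≡ sumL g xs
sumL-cong [] h = refl
sumL-cong (x ∷ xs) h = cong₂ _+_ (h x) (sumL-cong xs h)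

sumL-const : ∀ {a} {A : Set a} (f : A → ℕ) k xs → (∀ x → f x ≤ k) → sumL f xs ≤ length xs * k
sumL-const f k [] h = z≤n
sumL-const f k (x ∷ xs) h = +-mono-≤ (h x) (sumL-const f k xs h)

-- The number of digits in a seed has to be fixed from n and Δ alone, before the graph is seen.
length≤n*Δ : ∀ {n} (es : List (Edge n)) Δ → (∀ v → deg v es ≤ Δ) → length es ≤ n * Δ
length≤n*Δ {n} es Δ h = ≤-trans (count es) (≤-trans (sumL-const (λ v → deg v es) Δ (allFin n) h)
    (≤-reflexive (cong (_* Δ) (length-tabulate {n = n} (λ i → i)))))
  where
  count : ∀ es → length es ≤ sumL (λ v → deg v es) (allFin n)
  count [] = z≤n
  count (e ∷ es) = ≤-trans (+-mono-≤ (≤-trans (≤-reflexive (sym (⟦⟧-yes (incident? (proj₁ e) e) (inj₁ refl))))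
      (sumL-member (λ v → inc v e) (∈-allFin (proj₁ e)))) (count es))
    (≤-reflexive (sym (trans (sumL-cong (allFin n) (λ v → deg-cons v e es)) (sumL-+ (λ v → inc v e) (λ v → deg v es) (allFin n)))))

sumL-tabulate : ∀ N {n} (g : Fin N → Fin n) (f : ℕ → ℕ) k → (∀ i → toℕ (g i) ≡ k + toℕ i)
  → sumL (λ i → f (toℕ i)) (tabulate g) ≡ ∑ N (λ i → f (k + i))
sumL-tabulate zero g f k h = refl
sumL-tabulate (suc N) g f k h = trans (cong₂ _+_ (cong f (h Fin.zero))
    (trans (sumL-tabulate N (λ i → g (Fin.suc i)) f (suc k) (λ i → trans (h (Fin.suc i)) (+-suc k (toℕ i))))
      (∑-cong N (λ i _ → cong f (sym (+-suc k i))))))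
  (sym (∑-head N (λ i → f (k + i))))

length≤filter+ : ∀ {a} {A : Set a} {P : A → Set} (P? : ∀ x → Dec (P x)) xs
  → length xs ≤ length (filter (λ x → ¬? (P? x)) xs) + sumL (λ x → ⟦ P? x ⟧) xs
length≤filter+ P? [] = z≤n
length≤filter+ {P = P} P? (x ∷ xs) = go (P? x) (length≤filter+ P? xs)
  where
  Q? = λ x → ¬? (P? x)
  go : (d : Dec (P x)) → length xs ≤ length (filter Q? xs) + sumL (λ x → ⟦ P? x ⟧) xs
    → suc (length xs) ≤ length (filter Q? (x ∷ xs)) + (⟦ P? x ⟧ + sumL (λ x → ⟦ P? x ⟧) xs)
  go (yes p) ih = ≤-trans (s≤s ih) (≤-trans (≤-reflexive (sym (+-suc _ _)))
    (+-mono-≤ (≤-reflexive (cong length (sym (filter-reject Q? {x} {xs} (λ ¬p → ¬p p)))))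
      (+-monoˡ-≤ (sumL (λ x → ⟦ P? x ⟧) xs) (≤-reflexive (sym (⟦⟧-yes (P? x) p))))))
  go (no ¬p) ih = ≤-trans (s≤s ih)
    (+-mono-≤ (≤-reflexive (cong length (sym (filter-accept Q? {x} {xs} ¬p)))) (m≤n+m (sumL (λ x → ⟦ P? x ⟧) xs) ⟦ P? x ⟧))

-- Maximality of g gives Δ² ≤ c^k L (g + 1)^k, and g + 1 ≤ 2 g turns this into the lower bound on g
-- that makes 11 Δ / g small enough.
final-arith : ∀ k c L x g Δ → 0 < g → x * g ≤ 11 * Δ → Δ * Δ ≤ c ^ k * L * suc g ^ k
  → x ^ k * (Δ * Δ) ≤ L * ((22 * c) ^ k * Δ ^ k)
final-arith k c L x g Δ g>0 xg≤ ΔΔ≤ = begin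
  x ^ k * (Δ * Δ) ≤⟨ *-monoʳ-≤ (x ^ k) (≤-trans ΔΔ≤ (*-monoʳ-≤ (c ^ k * L) (^-monoˡ-≤ k sg≤))) ⟩
  x ^ k * (c ^ k * L * (2 * g) ^ k) ≡⟨ l1 (x ^ k) (c ^ k) L ((2 * g) ^ k) ⟩
  L * (c ^ k * (x ^ k * (2 * g) ^ k)) ≡⟨ cong (λ z → L * (c ^ k * z)) (sym (^-distribʳ-* k x (2 * g))) ⟩
  L * (c ^ k * (x * (2 * g)) ^ k) ≤⟨ *-monoʳ-≤ L (*-monoʳ-≤ (c ^ k) (^-monoˡ-≤ k xg)) ⟩
  L * (c ^ k * (22 * Δ) ^ k) ≡⟨ cong (L *_) (sym (^-distribʳ-* k c (22 * Δ))) ⟩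
  L * (c * (22 * Δ)) ^ k ≡⟨ cong (λ z → L * z ^ k) (l2 c Δ) ⟩
  L * (22 * c * Δ) ^ k ≡⟨ cong (L *_) (^-distribʳ-* k (22 * c) Δ) ⟩
  L * ((22 * c) ^ k * Δ ^ k) ∎
  where
  open ≤-Reasoning
  l1 : ∀ x c L y → x * (c * L * y) ≡ L * (c * (x * y))
  l1 = solve-∀
  l2 : ∀ c Δ → c * (22 * Δ) ≡ 22 * c * Δ
  l2 = solve-∀
  l3 : ∀ x g → x * (2 * g) ≡ 2 * (x * g)
  l3 = solve-∀
  l4 : ∀ Δ → 2 * (11 * Δ) ≡ 22 * Δ
  l4 = solve-∀
  sg≤ : suc g ≤ 2 * g
  sg≤ = ≤-trans (+-monoˡ-≤ g g>0) (≤-reflexive (cong (g +_) (sym (+-identityʳ g))))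
  xg : x * (2 * g) ≤ 22 * Δ
  xg = ≤-trans (≤-reflexive (l3 x g)) (≤-trans (*-monoʳ-≤ 2 xg≤) (≤-reflexive (l4 Δ)))

-- Doubling the constant under the k-th power gains 2^k ≥ 10, which absorbs the factor 8 and the
-- summand 2 of `expLe-power`.
exponent-arith : ∀ k c L a D → 10 ≤ 2 ^ k → 0 < c → 0 < L → 0 < D → a ≤ L * ((22 * c) ^ k * D)
  → 8 * a + 2 ≤ L * ((44 * c) ^ k * D)
exponent-arith k c L a D 10≤ c>0 L>0 D>0 h = begin
  8 * a + 2 ≤⟨ +-mono-≤ (*-monoʳ-≤ 8 h) (*-monoʳ-≤ 2 one) ⟩
  8 * x + 2 * x ≡⟨ sym (*-distribʳ-+ x 8 2) ⟩
  10 * x ≤⟨ *-monoˡ-≤ x 10≤ ⟩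
  2 ^ k * (L * ((22 * c) ^ k * D)) ≡⟨ l1 (2 ^ k) L ((22 * c) ^ k) D ⟩
  L * (2 ^ k * (22 * c) ^ k * D) ≡⟨ cong (λ z → L * (z * D)) (sym (^-distribʳ-* k 2 (22 * c))) ⟩
  L * ((2 * (22 * c)) ^ k * D) ≡⟨ cong (λ z → L * (z ^ k * D)) (l2 c) ⟩
  L * ((44 * c) ^ k * D) ∎
  where
  open ≤-Reasoning
  x = L * ((22 * c) ^ k * D)
  one : 1 ≤ x
  one = *-mono-≤ L>0 (*-mono-≤ (>-nonZero⁻¹ ((22 * c) ^ k) {{m^n≢0 (22 * c) k {{m*n≢0 22 c {{_}} {{>-nonZero c>0}}}}}}) D>0)
  l1 : ∀ a L b D → a * (L * (b * D)) ≡ L * (a * b * D)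
  l1 = solve-∀
  l2 : ∀ c → 2 * (22 * c) ≡ 44 * c
  l2 = solve-∀

C : ℕ
C = 44 * c

colour-bound : ∀ n Δ L k → 0 < L → 0 < Δ → 2 ^ L ≤ n * n → (k ∸ Δ) ^ 32 * (Δ * Δ) ≤ L * ((22 * c) ^ 32 * Δ ^ 32)
  → ColorBound C n Δ k
colour-bound n Δ L k L>0 Δ>0 2^L≤ h = expLe-power a L n (C ^ 32 * Δ ^ 30) 2^L≤
    (exponent-arith 32 c L a (Δ ^ 30) (≤ᵇ⇒≤ 10 (2 ^ 32) _) c>0 L>0 (>-nonZero⁻¹ (Δ ^ 30) {{m^n≢0 Δ 30 {{>-nonZero Δ>0}}}}) a≤)
  where
  a = (k ∸ Δ) ^ 32
  l1 : ∀ L x D y → L * (x * (D * (D * y))) ≡ L * (x * y) * (D * D)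
  l1 = solve-∀
  a≤ : a ≤ L * ((22 * c) ^ 32 * Δ ^ 30)
  a≤ = *-cancelʳ-≤ _ _ (Δ * Δ) {{m*n≢0 Δ Δ {{>-nonZero Δ>0}} {{>-nonZero Δ>0}}}} (≤-trans h (≤-reflexive (l1 L ((22 * c) ^ 32) Δ (Δ ^ 30))))

-- Assembling the algorithm and its guarantee

record Machine : Set where
  field
    D J E B thr M : ℕ
    M≢0 : NonZero M
    init : Local

module Guarantees (mc : Machine) (n Δ : ℕ) where
  open Machine mc
  open Colouring D J E B thr M {{M≢0}} init n public

  S : ℕ
  S = M ^ (n * Δ)

  S≡ : suc (pred S) ≡ S
  S≡ = suc-pred S {{m^n≢0 M (n * Δ) {{M≢0}}}}

  -- The exponent 1 corresponds to a failure probability of at most 1/n.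
  Guarantee : List (Edge n) → Set
  Guarantee es = (∀ (s : Fin (suc (pred S))) → Proper (runState (origin (toℕ s)) es))
    × ∃ λ (good : List (Fin (suc (pred S)))) → Unique good
      × All (λ s → ColorBound C n Δ (numColors (runState (origin (toℕ s)) es))) good
      × ((suc (pred S) ∸ length good) ^ 1 * n ≤ suc (pred S) ^ 1)

  guarantee : ∀ es {Bad : ℕ → Set} (bad? : ∀ s → Dec (Bad s))
    → (∀ s → ¬ Bad s → ColorBound C n Δ (numColors (runState (origin s) es)))
    → ∑ S (λ s → ⟦ bad? s ⟧) * n ≤ S → Guarantee es
  guarantee es {Bad} bad? bound few = (λ s → proj₁ (run-proper (origin (toℕ s)) es []))
      , good , filter⁺ good? (allFin⁺ (suc (pred S))) , All.map (λ {s} → bound (toℕ s)) (all-filter good? (allFin (suc (pred S))))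
      , (begin
          (suc (pred S) ∸ length good) ^ 1 * n ≡⟨ cong (_* n) (^-identityʳ (suc (pred S) ∸ length good)) ⟩
          (suc (pred S) ∸ length good) * n ≤⟨ *-monoˡ-≤ n (m≤n+o⇒m∸n≤o (suc (pred S)) (length good) all≤) ⟩
          ∑ S (λ s → ⟦ bad? s ⟧) * n ≤⟨ few ⟩
          S ≡⟨ sym S≡ ⟩
          suc (pred S) ≡⟨ sym (^-identityʳ (suc (pred S))) ⟩
          suc (pred S) ^ 1 ∎)
    where
    open ≤-Reasoning
    good? : (s : Fin (suc (pred S))) → Dec (¬ Bad (toℕ s))
    good? s = ¬? (bad? (toℕ s))
    good : List (Fin (suc (pred S)))
    good = filter good? (allFin (suc (pred S)))
    all≤ : suc (pred S) ≤ length good + ∑ S (λ s → ⟦ bad? s ⟧)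
    all≤ = begin
      suc (pred S) ≡⟨ sym (length-tabulate {n = suc (pred S)} (λ i → i)) ⟩
      length (allFin (suc (pred S))) ≤⟨ length≤filter+ (λ s → bad? (toℕ s)) (allFin (suc (pred S))) ⟩
      length good + sumL (λ s → ⟦ bad? (toℕ s) ⟧) (allFin (suc (pred S)))
        ≡⟨ cong (length good +_) (trans (sumL-tabulate (suc (pred S)) (λ i → i) (λ s → ⟦ bad? s ⟧) 0 (λ _ → refl))
             (cong (λ N → ∑ N (λ s → ⟦ bad? s ⟧)) S≡)) ⟩
      length good + ∑ S (λ s → ⟦ bad? s ⟧) ∎

  RunGuarantee : List (Edge n) → Set
  RunGuarantee es = (∀ (s : Fin (suc (pred S))) → Proper (run′ s))
    × ∃ λ (good : List (Fin (suc (pred S)))) → Unique good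
      × All (λ s → ColorBound C n Δ (numColors (run′ s))) good
      × ((suc (pred S) ∸ length good) ^ 1 * n ≤ suc (pred S) ^ 1)
    where
    run′ : Fin (suc (pred S)) → List (Edge n × ℕ)
    run′ s = runFrom (λ h e → colour (foldl advance (origin (toℕ s)) h) e) [] es

  run-guarantee : ∀ es → Guarantee es → RunGuarantee es
  run-guarantee es (proper , good , unique , bounded , few) =
      (λ s → subst Proper (sym (run≡ s)) (proper s))
    , good , unique
    , All.map (λ {s} → subst (λ r → ColorBound C n Δ (numColors r)) (sym (run≡ s))) bounded , few
    where
    run≡ : ∀ s → _ ≡ runState (origin (toℕ s)) es
    run≡ s = runFrom-foldl (origin (toℕ s)) [] es

-- With an empty palette every edge goes to the greedy rule, and M = 1 leaves a single seed.
greedyMachine : Machine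
greedyMachine = record { D = 0 ; J = 0 ; E = 0 ; B = 0 ; thr = 0 ; M = 1 ; M≢0 = _
  ; init = mkLocal (λ _ → 0) (λ _ → 0) (λ _ → active) 0 }

samplingMachine : Params → Machine
samplingMachine p = record { D = D ; J = J ; E = E ; B = B ; thr = thr ; M = M ; M≢0 = M≢0 ; init = initial }
  where open Params p

module Greedy (n Δ L : ℕ) (Δ>0 : 0 < Δ) (L>0 : 0 < L) (2^L≤ : 2 ^ L ≤ n * n)
  (small : Δ * Δ ≤ c ^ 32 * L * 1 ^ 32) where
  open Guarantees greedyMachine n Δ

  greedy-guarantee : ∀ es → (∀ v → deg v es ≤ Δ) → Guarantee es
  greedy-guarantee es deg≤ = guarantee es {λ _ → ⊥} (λ _ → no λ ()) (λ s _ → bound s)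
      (≤-trans (≤-reflexive (cong (_* n) (∑-zero S (λ _ _ → refl)))) z≤n)
    where
    bound : ∀ s → ColorBound C n Δ (numColors (runState (origin s) es))
    -- Greedy colouring uses at most 2 Δ + 1 ≤ 3 Δ colours. As g = 0 is not allowed in
    -- `final-arith`, it is applied with 1 instead, at the expense of weakening `small`.
    bound s = colour-bound n Δ L k L>0 Δ>0 2^L≤ (final-arith 32 c L (k ∸ Δ) 1 Δ ≤-refl
        (≤-trans (≤-reflexive (*-identityʳ (k ∸ Δ))) (≤-trans k∸Δ≤ (*-monoˡ-≤ Δ (≤ᵇ⇒≤ 2 11 _))))
        (≤-trans small (*-monoʳ-≤ (c ^ 32 * L) (^-monoˡ-≤ 32 (n≤1+n 1)))))
      where
      k = numColors (runState (origin s) es)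
      k≤ : k ≤ suc (Δ + Δ)
      k≤ = numColors≤ (Δ + Δ) _ (colours≤ Δ (origin s) es (λ v → ≤-trans (misses≤deg v _ s es) (deg≤ v)))
      k∸Δ≤ : k ∸ Δ ≤ 2 * Δ
      k∸Δ≤ = m≤n+o⇒m∸n≤o k Δ (≤-trans k≤ (≤-trans (+-monoˡ-≤ (Δ + Δ) Δ>0) (+-monoʳ-≤ Δ (≤-reflexive (cong (Δ +_) (sym (+-identityʳ Δ)))))))

module Sampling (p : Params) (n Δ : ℕ) (Δ≤ : Δ ≤ 16 * (Params.G p * (Params.g p * Params.t p))) (q : ℕ) (q>0 : 0 < q) (n>0 : 0 < n) where
  open Params p
  open Tests p n Δ Δ≤ q q>0
  open Guarantees (samplingMachine p) n Δ
  open Misses p n using (misses≤)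
  open Run p n using (initially-bounded; initially)

  sampling-guarantee : ∀ es → Simple es → (∀ v → deg v es ≤ Δ)
    → ∀ b → pp * suc pp * b + 2 * (Δ * Δ) ≤ q * τ
    → 2 * (n * (2 ^ Δ * (suc Δ ^ D * suc Δ ^ D))) * n ≤ 2 ^ b
    → (∀ k → k ≤ D + (t + t) + 1 → ColorBound C n Δ k)
    → Guarantee es
  sampling-guarantee es simple deg≤ b enough tests≤ bound = guarantee es (λ s → bad? s es)
      (λ s good → bound _ (≤-trans (numColors≤ (D + (t + t)) _ (colours≤ t (origin s) es (misses-small s good)))
        (≤-reflexive (+-comm 1 (D + (t + t))))))
      (*-cancelʳ-≤ _ _ (2 * ln) {{m*n≢0 2 ln}} (begin
        bads * n * (2 * ln) ≡⟨ l1 bads n ln ⟩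
        bads * (2 * ln * n) ≤⟨ *-monoʳ-≤ bads tests≤ ⟩
        bads * 2 ^ b ≤⟨ Union.union es simple deg≤ b enough (n * Δ) (length≤n*Δ es Δ deg≤) ⟩
        length tests * (2 * S) ≡⟨ cong (_* (2 * S)) length-tests ⟩
        ln * (2 * S) ≡⟨ l2 ln S ⟩
        S * (2 * ln) ∎))
    where
    open ≤-Reasoning
    ln bads : ℕ
    ln = n * (2 ^ Δ * (suc Δ ^ D * suc Δ ^ D))
    bads = ∑ S (λ s → ⟦ bad? s es ⟧)
    instance
      ln≢0 : NonZero ln
      ln≢0 = m*n≢0 n _ {{>-nonZero n>0}} {{m*n≢0 (2 ^ Δ) _ {{m^n≢0 2 Δ}} {{m*n≢0 (suc Δ ^ D) _ {{m^n≢0 (suc Δ) D}} {{m^n≢0 (suc Δ) D}}}}}}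
    l1 : ∀ a n l → a * n * (2 * l) ≡ a * (2 * l * n)
    l1 = solve-∀
    l2 : ∀ a s → a * (2 * s) ≡ s * (2 * a)
    l2 = solve-∀
    misses-small : ∀ s → ¬ Any (Fails s es) tests → ∀ v → 0 + misses v initially s es ≤ t
    misses-small s good v = ≤-trans (misses≤ v initially s es initially-bounded) (Outcome.failures es deg≤ s good v)

Scale : ℕ → ℕ → Set
Scale Δ L = ∃ λ g → c ^ 32 * L * g ^ 32 ≤ Δ * Δ × ¬ (c ^ 32 * L * suc g ^ 32 ≤ Δ * Δ)

Log : ℕ → Set
Log n = ∃ λ L → 0 < L × n ≤ 2 ^ L × 2 ^ L ≤ n * n

scaleOf : ∀ Δ L → 0 < L → Scale Δ L
scaleOf Δ L L>0 = scale 32 (c ^ 32 * L) (Δ * Δ) (s≤s z≤n) (*-mono-≤ (>-nonZero⁻¹ (c ^ 32) {{m^n≢0 c 32 {{>-nonZero c>0}}}}) L>0)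

-- The decision is an argument, so that the guarantee can be proved by cases on it while the
-- algorithm uses the same term.
fromScale : ∀ n Δ L → 0 < Δ → 0 < L → n ≤ 2 ^ L → (s : Scale Δ L) → Dec (0 < proj₁ s) → Machine
fromScale n Δ L Δ>0 L>0 n≤ (g , large , _) (yes g>0) = samplingMachine (Choice.params n Δ L g Δ>0 g>0 n≤ L>0 large)
fromScale n Δ L Δ>0 L>0 n≤ _ (no _) = greedyMachine

fromLog : ∀ n Δ → 0 < Δ → Log n → Machine
fromLog n Δ Δ>0 (L , L>0 , n≤ , _) = fromScale n Δ L Δ>0 L>0 n≤ (scaleOf Δ L L>0) (0 <? proj₁ (scaleOf Δ L L>0))

select : ∀ n Δ → Dec (2 ≤ n) → Dec (0 < Δ) → Machine
select n Δ (yes n≥2) (yes Δ>0) = fromLog n Δ Δ>0 (logarithm n n≥2)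
select n Δ _ _ = greedyMachine

module _ (n Δ : ℕ) (es : List (Edge n)) (simple : Simple es) (deg≤ : ∀ v → deg v es ≤ Δ) where

  fromScale-guarantee : ∀ L (n>0 : 0 < n) (Δ>0 : 0 < Δ) (L>0 : 0 < L) (n≤ : n ≤ 2 ^ L) → 2 ^ L ≤ n * n → ∀ (s : Scale Δ L) d
    → Guarantees.Guarantee (fromScale n Δ L Δ>0 L>0 n≤ s d) n Δ es
  fromScale-guarantee L n>0 Δ>0 L>0 n≤ 2^L≤ (g , large , ¬next) (yes g>0) =
    Sampling.sampling-guarantee params n Δ Δ≤ q q>0 n>0 es simple deg≤ b enough tests≤ bound
    where
    open Choice n Δ L g Δ>0 g>0 n≤ L>0 large
    bound : ∀ k → k ≤ D + (t + t) + 1 → ColorBound C n Δ k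
    bound k k≤ = colour-bound n Δ L k L>0 Δ>0 2^L≤ (final-arith 32 c L (k ∸ Δ) g Δ g>0
      (≤-trans (*-monoˡ-≤ g (∸-monoˡ-≤ Δ k≤)) few-colours) (<⇒≤ (≰⇒> ¬next)))
  fromScale-guarantee L n>0 Δ>0 L>0 n≤ 2^L≤ (zero , _ , ¬next) (no _) =
    Greedy.greedy-guarantee n Δ L Δ>0 L>0 2^L≤ (<⇒≤ (≰⇒> ¬next)) es deg≤
  fromScale-guarantee L n>0 Δ>0 L>0 n≤ 2^L≤ (suc g , _) (no g≯0) = contradiction (s≤s z≤n) g≯0

  fromLog-guarantee : 0 < n → (Δ>0 : 0 < Δ) (l : Log n) → Guarantees.Guarantee (fromLog n Δ Δ>0 l) n Δ es
  fromLog-guarantee n>0 Δ>0 (L , L>0 , n≤ , 2^L≤) = fromScale-guarantee L n>0 Δ>0 L>0 n≤ 2^L≤ (scaleOf Δ L L>0) (0 <? proj₁ (scaleOf Δ L L>0))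

  select-guarantee : 2 ≤ n → 0 < Δ → ∀ d e → Guarantees.Guarantee (select n Δ d e) n Δ es
  select-guarantee n≥2 Δ>0 (yes p) (yes q) = fromLog-guarantee (<⇒≤ n≥2) q (logarithm n p)
  select-guarantee n≥2 Δ>0 (yes _) (no ¬q) = contradiction Δ>0 ¬q
  select-guarantee n≥2 Δ>0 (no ¬p) _ = contradiction n≥2 ¬p

abstract
  machine : ℕ → ℕ → Machine
  machine n Δ = select n Δ (2 ≤? n) (0 <? Δ)

  machine-guarantee : ∀ n Δ es → Simple es → (∀ v → deg v es ≤ Δ) → 2 ≤ n → 0 < Δ
    → Guarantees.RunGuarantee (machine n Δ) n Δ es
  machine-guarantee n Δ es simple deg≤ n≥2 Δ>0 = Guarantees.run-guarantee (machine n Δ) n Δ es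
    (select-guarantee n Δ es simple deg≤ n≥2 Δ>0 (2 ≤? n) (0 <? Δ))

algorithm : OnlineAlg
algorithm = record
  { seeds = λ n Δ → pred (Guarantees.S (machine n Δ) n Δ)
  ; color = λ n Δ s hist e → let open Guarantees (machine n Δ) n Δ in colour (foldl advance (origin (toℕ s)) hist) e
  }

theorem4p1 : Σ ℕ λ C → 1 ≤ C × Σ ℕ λ m → 1 ≤ m × Σ OnlineAlg λ A →
    ∀ (n Δ : ℕ) → 2 ≤ n → 1 ≤ Δ →
    ∀ (es : List (Edge n)) → Simple es → MaxDegree es Δ →
    (∀ (s : Fin (suc (seeds A n Δ))) → Proper (run A n Δ s es))
    × ∃ λ (good : List (Fin (suc (seeds A n Δ)))) → Unique good
    × All (λ s → ColorBound C n Δ (numColors (run A n Δ s es))) good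
    × ((suc (seeds A n Δ) ∸ length good) ^ m * n ≤ suc (seeds A n Δ) ^ m)
theorem4p1 = C , *-mono-≤ {1} {44} (s≤s z≤n) c>0 , 1 , s≤s z≤n , algorithm
  , λ n Δ n≥2 Δ>0 es simple maxDegree → machine-guarantee n Δ es simple (proj₁ maxDegree) n≥2 Δ>0
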